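{- Let $m,n$ be nonnegative integers with $p=2m+n\geq 2$, and let $\Delta\geq 5$. Let $\mathcal{G}_\Delta$ be the family of simple graphs with maximum degree $\Delta$. Then $p^{\Delta/2}\leq \chi_{(m,n)}(\mathcal{G}_\Delta)\leq 2(\Delta-1)^p p^{\Delta-1}+2$.
   Context: An $(m,n)$-colored mixed graph is a graph whose connections are either arcs, each colored with one of $m$ colors $\alpha_1,\dots,\alpha_m$, or edges, each colored with one of $n$ colors $\beta_1,\dots,\beta_n$, such that the underlying undirected graph (forgetting orientations and colors) is simple. A colored homomorphism of $G$ to $H$ is a vertex map sending each arc (resp. edge) of $G$ to an arc (resp. edge) of $H$ of the same color, preserving arc direction. For an $(m,n)$-colored mixed graph $G$, $\chi_{(m,n)}(G)$ is the minimum number of vertices of an $(m,n)$-colored mixed graph $H$ such that $G$ admits a colored homomorphism to $H$. For a simple undirected graph $G$, $\chi_{(m,n)}(G)$ is the maximum of $\chi_{(m,n)}(G')$ over all $(m,n)$-colored mixed graphs $G'$ with underlying graph $G$; for a family $\mathcal{F}$ of simple graphs, $\chi_{(m,n)}(\mathcal{F})$ is the supremum of $\chi_{(m,n)}(G)$ over $G\in\mathcal{F}$. -}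

module Defs where

open import Data.Nat using (ℕ; zero; suc; _+_; _*_; _∸_; _^_; _≤_)
open import Data.Fin using (Fin)
open import Data.Bool using (Bool; true; false; if_then_else_)
open import Data.List using (List; map; allFin)
open import Data.Nat.ListAction using (sum)
open import Data.Product using (Σ; ∃; _×_; _,_)
open import Relation.Binary.PropositionalEquality using (_≡_)

record SimpleGraph (N : ℕ) : Set where
  field
    adj   : Fin N → Fin N → Bool
    sym   : ∀ u v → adj u v ≡ adj v u
    irrefl : ∀ u → adj u u ≡ false
open SimpleGraph public

deg : ∀ {N} → SimpleGraph N → Fin N → ℕ
deg {N} G v = sum (map (λ w → if adj G v w then 1 else 0) (allFin N))

MaxDegree : ∀ {N} → SimpleGraph N → ℕ → Set
MaxDegree G Δ = (∀ v → deg G v ≤ Δ) × ∃ λ v → deg G v ≡ Δ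

-- What sits on an ordered pair (u , v) of an (m,n)-colored mixed graph:
-- nothing, an arc of colour αᵢ from u to v, an arc of colour αᵢ from v to u,
-- or an edge of colour βⱼ.
data Conn (m n : ℕ) : Set where
  none   : Conn m n
  arcOut : Fin m → Conn m n
  arcIn  : Fin m → Conn m n
  edge   : Fin n → Conn m n

flipC : ∀ {m n} → Conn m n → Conn m n
flipC none       = none
flipC (arcOut i) = arcIn i
flipC (arcIn i)  = arcOut i
flipC (edge j)   = edge j

present : ∀ {m n} → Conn m n → Bool
present none = false
present _    = true

-- (m,n)-colored mixed graph on Fin N (underlying graph automatically simple)
record MixedGraph (m n N : ℕ) : Set where
  field
    conn    : Fin N → Fin N → Conn m n
    loopless : ∀ u → conn u u ≡ none
    flipped : ∀ u v → conn v u ≡ flipC (conn u v)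
open MixedGraph public

IsColHom : ∀ {m n N K} → MixedGraph m n N → MixedGraph m n K → (Fin N → Fin K) → Set
IsColHom G H f = ∀ u v → present (conn G u v) ≡ true → conn H (f u) (f v) ≡ conn G u v

HasColHom : ∀ {m n N K} → MixedGraph m n N → MixedGraph m n K → Set
HasColHom G H = Σ _ λ f → IsColHom G H f

Underlies : ∀ {m n N} → SimpleGraph N → MixedGraph m n N → Set
Underlies G G' = ∀ u v → present (conn G' u v) ≡ adj G u v

χ≤ : ∀ {m n N} → MixedGraph m n N → ℕ → Set
χ≤ {m} {n} G' k = Σ ℕ λ K → K ≤ k × Σ (MixedGraph m n K) λ H → HasColHom G' H

{-# OPTIONS --safe #-}

-- Lower bound: every (m,n)-colouring of K_{Δ,Δ} is determined by a map of its 2Δ vertices to a target,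
-- so a target with K vertices for all p^(Δ²) of them (put side by side) has p^(Δ²) ≤ K^(2Δ).
--
-- Upper bound, with s = Δ - 1: colour one vertex at a time, maintaining that an uncoloured vertex has at
-- most s coloured neighbours, whose images are in general position; two adjacent vertices with s coloured
-- neighbours each are coloured together.  This needs a target in which lists of at most s constraints
-- have many solutions, and in which the solutions of any two lists of s constraints are joined by every
-- type of connection.  A uniformly random mixed graph of the required size is such a target, by a union
-- bound over configurations of a constraint list and a few vertices badly joined to its solutions, except
-- for p = 2 and s = 4, 5, where the size is too small.  There the target is a doubled Paley graph
-- (q = 241, 797) or tournament (q = 251, 787): the number of solutions of s sign conditions is estimated by
-- sums of products of two or four values of the quadratic character, which reduce to finitely many
-- computed cubic sums, and a second-moment identity shows that two large solution sets are joined.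
module Submission where

open import Defs
open import Data.Nat using (ℕ; zero; suc; _+_; _*_; _∸_; _^_; _≤_; _<_; z≤n; s≤s; _≤?_; _<?_; NonZero; _<ᵇ_; _!; >-nonZero; _≤ᵇ_)
open import Data.Nat.Properties
open import Data.Nat.ListAction using (sum)
open import Data.Fin using (Fin; zero; suc; toℕ; splitAt; _↑ˡ_; _↑ʳ_; combine; remQuot; finToFun; funToFin; fromℕ<)
import Data.Fin.Properties as Fin
open import Data.Bool using (Bool; true; false; if_then_else_; _∧_)
import Data.Bool.Properties as Bool
open import Data.List using (List; []; _∷_; _++_; map; length; filter; allFin; take; replicate)
open import Data.List.Properties using (length-map; length-++; length-tabulate)
open import Data.List.Membership.Propositional using (_∈_; _∉_)
open import Data.List.Membership.Propositional.Properties using (∈-allFin; ∈-filter⁺; ∈-filter⁻; ∈-map⁺; ∈-map⁻; ∈-++⁺ˡ; ∈-++⁺ʳ; ∈-++⁻)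
import Data.List.Membership.DecPropositional as DecMembership
open import Data.List.Relation.Unary.All using (All; []; _∷_)
import Data.List.Relation.Unary.All as All
import Data.List.Relation.Unary.All.Properties as All
open import Data.List.Relation.Unary.Any using (Any; here; there)
open import Data.List.Relation.Unary.AllPairs using (AllPairs; []; _∷_)
open import Data.List.Relation.Unary.Unique.Propositional using (Unique)
import Data.List.Relation.Unary.Unique.Propositional.Properties as Unique
open import Data.Product using (Σ; ∃; _×_; _,_; proj₁; proj₂; uncurry)
open import Data.Sum using (_⊎_; inj₁; inj₂)
open import Data.Empty using (⊥; ⊥-elim)
open import Data.Unit using (⊤; tt)
open import Function using (_∘_; id; case_of_)
open import Relation.Nullary using (¬_; Dec; yes; no; contradiction)
open import Relation.Nullary.Decidable using (¬?; _×-dec_; does)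
open import Relation.Binary.PropositionalEquality using (_≡_; _≢_; refl; trans; cong; cong₂; subst; subst₂; _≗_; module ≡-Reasoning) renaming (sym to symm)
open import Data.Nat.Solver using (module +-*-Solver)
open import Data.Vec using (Vec; []; _∷_; lookup; _[_]≔_; tabulate)
import Data.Vec.Properties as Vec
open import Data.Maybe using (Maybe; just; nothing; is-just)
import Data.Maybe as Maybe

-- The obstacle is lack of room. Colouring a vertex with l coloured neighbours must keep up to s + 1
-- - l uncoloured neighbours in general position, each excluding up to F vertices; so more than (s +
-- 1 - l) F solutions are wanted. This count is estimated for l = s only: fewer constraints are
-- handled by splitting along fresh vertices.
--
-- A random target with about M = 2 s^p p^s vertices leaves a list of s constraints about 2 s^p
-- solutions, while the union bound ranges over (p M)^s lists, whose logarithm is of order s² for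
-- fixed p. For p ≥ 3 a power of s is gained as s grows; for p = 2 both exponents are of order s²
-- and only constants decide, which is why several probes and a separate treatment of small s are
-- needed. Probabilities appear throughout as inequalities between natural numbers, cleared of
-- denominators.
--
-- In the Paley targets every residue carries both signs. Counting the solutions of both signs
-- together cancels the symmetric functions of odd degree, so only products of two and of four
-- characters remain.

private
  module _ {A : Set} where
    remove : ∀ {x : A} {ys} → x ∈ ys → List A
    remove {ys = y ∷ ys} (here _)  = ys
    remove {ys = y ∷ ys} (there p) = y ∷ remove p

    length-remove : ∀ {x : A} {ys} (p : x ∈ ys) → length ys ≡ suc (length (remove p))
    length-remove (here _)  = refl
    length-remove (there p) = cong suc (length-remove p)

    ∈-remove : ∀ {x y : A} {ys} (p : x ∈ ys) → y ∈ ys → y ≢ x → y ∈ remove p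
    ∈-remove (here refl) (here refl) y≢x = contradiction refl y≢x
    ∈-remove (here _)    (there q)   y≢x = q
    ∈-remove (there p)   (here e)    y≢x = here e
    ∈-remove (there p)   (there q)   y≢x = there (∈-remove p q y≢x)

unique-⊆⇒length≤ : {A : Set} (xs ys : List A) → Unique xs → (∀ {x} → x ∈ xs → x ∈ ys) →
                   length xs ≤ length ys
unique-⊆⇒length≤ []       ys _ _ = z≤n
unique-⊆⇒length≤ (x ∷ xs) ys (x∉ ∷ u) sub = subst (suc (length xs) ≤_) (symm (length-remove x∈ys))
  (s≤s (unique-⊆⇒length≤ xs (remove x∈ys) u
    (λ {y} y∈ → ∈-remove x∈ys (sub (there y∈)) (λ { refl → All.lookup x∉ y∈ refl }))))
  where x∈ys = sub (here refl)

-- Greedy colouring into a target.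

-- A constraint (u , c) on a vertex y of a mixed graph demands conn y u ≡ c.
Constraint : ℕ → ℕ → ℕ → Set
Constraint m n K = Fin K × Conn m n

Sat : ∀ {m n K} → MixedGraph m n K → Fin K → List (Constraint m n K) → Set
Sat H y = All (λ { (u , c) → conn H y u ≡ c })

-- What a graph needs in order to receive, vertex by vertex, every mixed graph of
-- maximum degree at most s + 1.
record Target {m n K} (H : MixedGraph m n K) (s : ℕ) : Set₁ where
  field
    Ok      : List (Constraint m n K) → Set
    ok-[]   : Ok []
    -- `L` belongs to the vertex being coloured, `Ls` to its uncoloured neighbours, each of which
    -- must be able to take one more constraint; the last bound is the degree bound s + 1.
    extend₁ : ∀ L → Ok L → length L ≤ s →
              (Ls : List (List (Constraint m n K) × Conn m n)) →
              All (λ { (L' , c) → Ok L' × length L' < s × present c ≡ true }) Ls →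
              length L + length Ls ≤ suc s →
              ∃ λ y → Sat H y L × All (λ { (L' , c) → Ok ((y , c) ∷ L') }) Ls
    extend₂ : ∀ L L' c → Ok L → Ok L' → length L ≡ s → length L' ≡ s → present c ≡ true →
              ∃ λ α → ∃ λ ω → Sat H α L × Sat H ω L' × conn H α ω ≡ c

present-flipC : ∀ {m n} (c : Conn m n) → present (flipC c) ≡ present c
present-flipC none       = refl
present-flipC (arcOut _) = refl
present-flipC (arcIn _)  = refl
present-flipC (edge _)   = refl

length-filter-true : ∀ {A : Set} (f : A → Bool) xs →
  length (filter (λ x → f x Bool.≟ true) xs) ≡ sum (map (λ x → if f x then 1 else 0) xs)
length-filter-true f []       = refl
length-filter-true f (x ∷ xs) with f x
... | true  = cong suc (length-filter-true f xs)
... | false = length-filter-true f xs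

module Greedy {m n N K s} (G : SimpleGraph N) (deg≤ : ∀ v → deg G v ≤ suc s)
              (G' : MixedGraph m n N) (und : Underlies G G')
              (H : MixedGraph m n K) (T : Target H s) where
  open Target T
  open DecMembership (Fin._≟_ {N}) using (_∈?_)

  Adj : Fin N → Fin N → Set
  Adj x u = present (conn G' x u) ≡ true

  adj? : ∀ x u → Dec (Adj x u)
  adj? x u = present (conn G' x u) Bool.≟ true

  adj-symm : ∀ {x u} → Adj x u → Adj u x
  adj-symm {x} {u} a = trans (cong present (flipped G' x u)) (trans (present-flipC (conn G' x u)) a)

  State : Set
  State = List (Fin N × Fin K)

  vertices : State → List (Fin N)
  vertices = map proj₁

  constraints : State → Fin N → List (Constraint m n K)
  constraints []             x = []
  constraints ((u , a) ∷ st) x with adj? x u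
  ... | yes _ = (a , conn G' x u) ∷ constraints st x
  ... | no _  = constraints st x

  constraints-yes : ∀ {u a st x} → Adj x u →
                    constraints ((u , a) ∷ st) x ≡ (a , conn G' x u) ∷ constraints st x
  constraints-yes {u} {a} {st} {x} p with adj? x u
  ... | yes _ = refl
  ... | no ¬p = contradiction p ¬p

  constraints-no : ∀ {u a st x} → ¬ Adj x u → constraints ((u , a) ∷ st) x ≡ constraints st x
  constraints-no {u} {a} {st} {x} ¬p with adj? x u
  ... | yes p = contradiction p ¬p
  ... | no _  = refl

  coloured : State → Fin N → List (Fin N)
  coloured st x = filter (adj? x) (vertices st)

  length-constraints : ∀ st x → length (constraints st x) ≡ length (coloured st x)
  length-constraints []             x = refl
  length-constraints ((u , a) ∷ st) x with adj? x u
  ... | yes _ = cong suc (length-constraints st x)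
  ... | no _  = length-constraints st x

  open-nbr? : ∀ st x u → Dec (Adj x u × u ∉ vertices st)
  open-nbr? st x u = adj? x u ×-dec ¬? (u ∈? vertices st)

  open-nbrs : State → Fin N → List (Fin N)
  open-nbrs st x = filter (open-nbr? st x) (allFin N)

  -- The head of the state is the vertex coloured last, so each vertex is tested against those
  -- coloured before it only.
  Partial : State → Set
  Partial []             = ⊤
  Partial ((v , y) ∷ st) = Sat H y (constraints st v) × Partial st

  record Inv (st : State) : Set where
    field
      unique  : Unique (vertices st)
      partial : Partial st
      ok      : ∀ x → x ∉ vertices st → Ok (constraints st x)
      short   : ∀ x → x ∉ vertices st → length (constraints st x) ≤ s
  open Inv

  degree-bound : ∀ st → Inv st → ∀ x → length (constraints st x) + length (open-nbrs st x) ≤ suc s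
  degree-bound st inv x = begin
    length (constraints st x) + length (open-nbrs st x) ≡⟨ cong (_+ length (open-nbrs st x)) (length-constraints st x) ⟩
    length (coloured st x) + length (open-nbrs st x)    ≡⟨ length-++ (coloured st x) ⟨
    length (coloured st x ++ open-nbrs st x)            ≤⟨ unique-⊆⇒length≤ _ _ uniq sub ⟩
    length (filter (λ u → adj G x u Bool.≟ true) (allFin N)) ≡⟨ length-filter-true (adj G x) (allFin N) ⟩
    deg G x                                             ≤⟨ deg≤ x ⟩
    suc s                                               ∎
    where
      open ≤-Reasoning
      uniq : Unique (coloured st x ++ open-nbrs st x)
      uniq = Unique.++⁺ (Unique.filter⁺ (adj? x) (unique inv))
                        (Unique.filter⁺ (open-nbr? st x) (Unique.allFin⁺ N))
                        (λ { (p , q) → proj₂ (proj₂ (∈-filter⁻ (open-nbr? st x) {xs = allFin N} q))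
                                             (proj₁ (∈-filter⁻ (adj? x) {xs = vertices st} p)) })
      isAdj : ∀ {u} → u ∈ coloured st x ++ open-nbrs st x → Adj x u
      isAdj p with ∈-++⁻ (coloured st x) p
      ... | inj₁ q = proj₂ (∈-filter⁻ (adj? x) {xs = vertices st} q)
      ... | inj₂ q = proj₁ (proj₂ (∈-filter⁻ (open-nbr? st x) {xs = allFin N} q))
      sub : ∀ {u} → u ∈ coloured st x ++ open-nbrs st x →
            u ∈ filter (λ w → adj G x w Bool.≟ true) (allFin N)
      sub {u} p = ∈-filter⁺ (λ w → adj G x w Bool.≟ true) (∈-allFin u) (trans (symm (und x u)) (isAdj p))

  open-nbr⁺ : ∀ {st x u} → Adj x u → u ∉ vertices st → u ∈ open-nbrs st x
  open-nbr⁺ {st} {x} {u} a u∉ = ∈-filter⁺ (open-nbr? st x) (∈-allFin u) (a , u∉)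

  -- The obstruction to colouring `v` alone: its uncoloured neighbour `x` would then carry s + 1
  -- constraints.
  Crowded : State → Fin N → Fin N → Set
  Crowded st v x = (Adj v x × x ∉ vertices st) × ¬ length (constraints st x) < s

  crowded? : ∀ st v → Dec (∃ (Crowded st v))
  crowded? st v = Fin.any? (λ x → open-nbr? st v x ×-dec ¬? (length (constraints st x) <? s))

  single : ∀ st v → Inv st → v ∉ vertices st → ¬ ∃ (Crowded st v) → ∃ λ y → Inv ((v , y) ∷ st)
  single st v inv v∉ ¬cr = y , record
    { unique  = All.¬Any⇒All¬ _ v∉ ∷ unique inv
    ; partial = satisfied , partial inv
    ; ok      = ok'
    ; short   = short'
    }
    where
      nbrs = open-nbrs st v
      entry : Fin N → List (Constraint m n K) × Conn m n
      entry x = constraints st x , conn G' x v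
      open-nbr⁻ : ∀ {x} → x ∈ nbrs → Adj v x × x ∉ vertices st
      open-nbr⁻ x∈ = proj₂ (∈-filter⁻ (open-nbr? st v) {xs = allFin N} x∈)
      small : ∀ {x} → Adj v x → x ∉ vertices st → length (constraints st x) < s
      small {x} a x∉ with length (constraints st x) <? s
      ... | yes lt = lt
      ... | no ¬lt = contradiction (x , (a , x∉) , ¬lt) ¬cr
      choice = extend₁ (constraints st v) (ok inv v v∉) (short inv v v∉) (map entry nbrs)
                 (All.map⁺ (All.tabulate λ {x} x∈ →
                   let (a , x∉) = open-nbr⁻ x∈ in ok inv x x∉ , small a x∉ , adj-symm a))
                 (subst (λ k → length (constraints st v) + k ≤ suc s) (symm (length-map entry nbrs))
                        (degree-bound st inv v))
      y = proj₁ choice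
      satisfied = proj₁ (proj₂ choice)
      oks = All.map⁻ (proj₂ (proj₂ choice))
      ok' : ∀ x → x ∉ v ∷ vertices st → Ok (constraints ((v , y) ∷ st) x)
      ok' x x∉ with adj? x v
      ... | yes a = All.lookup oks (open-nbr⁺ (adj-symm a) (x∉ ∘ there))
      ... | no _  = ok inv x (x∉ ∘ there)
      short' : ∀ x → x ∉ v ∷ vertices st → length (constraints ((v , y) ∷ st) x) ≤ s
      short' x x∉ with adj? x v
      ... | yes a = small (adj-symm a) (x∉ ∘ there)
      ... | no _  = short inv x (x∉ ∘ there)

  -- Of the at most s + 1 neighbours of `x`, s are already coloured, which leaves room for one more.
  only-open-nbr : ∀ {st x v z} → Inv st → ¬ length (constraints st x) < s →
                  v ∈ open-nbrs st x → z ∈ open-nbrs st x → z ≡ v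
  only-open-nbr {st} {x} {v} {z} inv ¬lt v∈ z∈ with z Fin.≟ v
  ... | yes e = e
  ... | no z≢v = contradiction (begin-strict
      suc s                                               ≡⟨ +-comm 1 s ⟩
      s + 1                                               <⟨ +-monoʳ-< s (s≤s (s≤s z≤n)) ⟩
      s + 2                                               ≤⟨ +-mono-≤ (≮⇒≥ ¬lt)
                                                              (unique-⊆⇒length≤ (z ∷ v ∷ []) _
                                                                ((z≢v ∷ []) ∷ [] ∷ [])
                                                                λ { (here refl) → z∈ ; (there (here refl)) → v∈ }) ⟩
      length (constraints st x) + length (open-nbrs st x) ≤⟨ degree-bound st inv x ⟩
      suc s                                               ∎) (<-irrefl refl)
    where open ≤-Reasoning

  -- Two adjacent uncoloured vertices, each with s coloured neighbours: they have no
  -- other uncoloured neighbour, and are coloured simultaneously.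
  double : ∀ st v x → Inv st → v ∉ vertices st → Crowded st v x → Crowded st x v →
           ∃ λ α → ∃ λ ω → Inv ((v , α) ∷ (x , ω) ∷ st)
  double st v x inv v∉ ((v~x , x∉) , ¬ltx) (_ , ¬ltv) = α , ω , record
    { unique  = All.¬Any⇒All¬ _ v∉' ∷ All.¬Any⇒All¬ _ x∉ ∷ unique inv
    ; partial = subst (Sat H α) (symm (constraints-yes v~x)) (edge-ok ∷ sat-α) , sat-ω , partial inv
    ; ok      = λ z z∉ → subst Ok (symm (same z z∉)) (ok inv z (z∉ ∘ there ∘ there))
    ; short   = λ z z∉ → subst (λ L → length L ≤ s) (symm (same z z∉)) (short inv z (z∉ ∘ there ∘ there))
    }
    where
      full : ∀ {u} → u ∉ vertices st → ¬ length (constraints st u) < s → length (constraints st u) ≡ s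
      full u∉ ¬lt = ≤-antisym (short inv _ u∉) (≮⇒≥ ¬lt)
      choice = extend₂ (constraints st v) (constraints st x) (conn G' v x) (ok inv v v∉) (ok inv x x∉)
                 (full v∉ ¬ltv) (full x∉ ¬ltx) v~x
      α = proj₁ choice
      ω = proj₁ (proj₂ choice)
      sat-α = proj₁ (proj₂ (proj₂ choice))
      sat-ω = proj₁ (proj₂ (proj₂ (proj₂ choice)))
      edge-ok = proj₂ (proj₂ (proj₂ (proj₂ choice)))
      v≢x : v ≢ x
      v≢x refl = case trans (symm v~x) (cong present (loopless G' v)) of λ ()
      v∉' : v ∉ x ∷ vertices st
      v∉' (here e)  = v≢x e
      v∉' (there p) = v∉ p
      same : ∀ z → z ∉ v ∷ x ∷ vertices st → constraints ((v , α) ∷ (x , ω) ∷ st) z ≡ constraints st z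
      same z z∉ = trans (constraints-no ¬zv) (constraints-no ¬zx)
        where
          z∉st = z∉ ∘ there ∘ there
          ¬zv : ¬ Adj z v
          ¬zv a = z∉ (there (here (only-open-nbr inv ¬ltv (open-nbr⁺ v~x x∉) (open-nbr⁺ (adj-symm a) z∉st))))
          ¬zx : ¬ Adj z x
          ¬zx a = z∉ (here (only-open-nbr inv ¬ltx (open-nbr⁺ (adj-symm v~x) v∉) (open-nbr⁺ (adj-symm a) z∉st)))

  step : ∀ st v → Inv st → v ∉ vertices st → ∃ λ st' → Inv st' × length st < length st'
  step st v inv v∉ with crowded? st v
  ... | no ¬cr = let (_ , inv') = single st v inv v∉ ¬cr in _ , inv' , ≤-refl
  ... | yes (x , cr@((v~x , x∉) , ¬ltx)) with crowded? st x
  ...   | no ¬cr = let (_ , inv') = single st x inv x∉ ¬cr in _ , inv' , ≤-refl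
  -- Both `v` and `z` are uncoloured neighbours of the full vertex `x`, so they coincide: `v` and
  -- `x` crowd each other.
  ...   | yes (z , cr'@((x~z , z∉) , _)) with only-open-nbr inv ¬ltx (open-nbr⁺ (adj-symm v~x) v∉) (open-nbr⁺ x~z z∉)
  ...     | refl = let (_ , _ , inv') = double st v x inv v∉ cr cr' in _ , inv' , m≤n⇒m≤1+n ≤-refl

  complete : ∀ fuel st → Inv st → N ≤ fuel + length st → ∃ λ st' → Inv st' × (∀ v → v ∈ vertices st')
  complete fuel st inv le with Fin.any? (λ v → ¬? (v ∈? vertices st))
  ... | no all = st , inv , λ v → case v ∈? vertices st of λ
        { (yes p) → p ; (no ¬p) → contradiction (v , ¬p) all }
  ... | yes (v , v∉) with fuel
  ...   | zero = contradiction (begin-strict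
            length st            ≡⟨ length-map proj₁ st ⟨
            length (vertices st) <⟨ unique-⊆⇒length≤ (v ∷ vertices st) (allFin N)
                                      (All.¬Any⇒All¬ _ v∉ ∷ unique inv) (λ {u} _ → ∈-allFin u) ⟩
            length (allFin N)    ≡⟨ length-tabulate id ⟩
            N                    ≤⟨ le ⟩
            length st            ∎) (<-irrefl refl)
          where open ≤-Reasoning
  ...   | suc f = let (st' , inv' , lt) = step st v inv v∉ in
          complete f st' inv' (≤-trans le (≤-trans (≤-reflexive (symm (+-suc f (length st)))) (+-monoʳ-≤ f lt)))

  colour : ∀ st {v} → v ∈ vertices st → Fin K
  colour ((_ , y) ∷ _)  (here _)  = y
  colour (_ ∷ st)       (there p) = colour st p

  lookup-constraint : ∀ st {x u} → Adj x u → (p : u ∈ vertices st) →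
                      (colour st p , conn G' x u) ∈ constraints st x
  lookup-constraint ((u , a) ∷ st) {x} x~u (here refl) rewrite constraints-yes {u} {a} {st} {x} x~u = here refl
  lookup-constraint ((w , b) ∷ st) {x} x~u (there p) with adj? x w
  ... | yes _ = there (lookup-constraint st x~u p)
  ... | no _  = lookup-constraint st x~u p

  colour-respects : ∀ st → Partial st → ∀ {u v} (p : u ∈ vertices st) (q : v ∈ vertices st) → Adj u v →
                    conn H (colour st p) (colour st q) ≡ conn G' u v
  colour-respects (_ ∷ st) (sat , _) (here refl) (here refl) a =
    case trans (symm a) (cong present (loopless G' _)) of λ ()
  colour-respects (_ ∷ st) (sat , _) (here refl) (there q)   a = All.lookup sat (lookup-constraint st a q)
  colour-respects ((v , y) ∷ st) (sat , _) {u} (there p) (here refl) a = begin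
    conn H (colour st p) y         ≡⟨ flipped H y (colour st p) ⟩
    flipC (conn H y (colour st p)) ≡⟨ cong flipC (All.lookup sat (lookup-constraint st (adj-symm a) p)) ⟩
    flipC (conn G' v u)            ≡⟨ flipped G' v u ⟨
    conn G' u v                    ∎
    where open ≡-Reasoning
  colour-respects (_ ∷ st) (_ , par) (there p) (there q) a = colour-respects st par p q a

  hom : HasColHom G' H
  hom with complete N [] inv₀ (m≤m+n N 0)
    where
      inv₀ : Inv []
      inv₀ = record { unique = [] ; partial = _ ; ok = λ _ _ → ok-[] ; short = λ _ _ → z≤n }
  ... | st , inv , all = (λ v → colour st (all v)) ,
                         (λ u v → colour-respects st (partial inv) (all u) (all v))

-- Types of connections and the lower bound.

^-distribʳ-* : ∀ n a b → (a * b) ^ n ≡ a ^ n * b ^ n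
^-distribʳ-* zero    a b = refl
^-distribʳ-* (suc n) a b =
  trans (cong ((a * b) *_) (^-distribʳ-* n a b)) ([m*n]*[o*p]≡[m*o]*[n*p] a b (a ^ n) (b ^ n))

-- A vertex sees an arc of each colour in two directions, whence the factor 2.
Types : ℕ → ℕ → ℕ
Types m n = 2 * m + n

module _ {m n : ℕ} where

  private
    decode-arc : Fin m ⊎ Fin (m + 0) → Conn m n
    decode-arc (inj₁ i) = arcOut i
    decode-arc (inj₂ i) with splitAt m i
    ... | inj₁ j = arcIn j

    decode-sum : Fin (2 * m) ⊎ Fin n → Conn m n
    decode-sum (inj₁ i) = decode-arc (splitAt m i)
    decode-sum (inj₂ j) = edge j

  decode : Fin (Types m n) → Conn m n
  decode t = decode-sum (splitAt (2 * m) t)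

  encode : (c : Conn m n) → present c ≡ true → Fin (Types m n)
  encode (arcOut i) _ = (i ↑ˡ (m + 0)) ↑ˡ n
  encode (arcIn i)  _ = (m ↑ʳ (i ↑ˡ 0)) ↑ˡ n
  encode (edge j)   _ = (2 * m) ↑ʳ j

  decode-encode : ∀ c pr → decode (encode c pr) ≡ c
  decode-encode (arcOut i) _
    rewrite Fin.splitAt-↑ˡ (2 * m) (i ↑ˡ (m + 0)) n | Fin.splitAt-↑ˡ m i (m + 0) = refl
  decode-encode (arcIn i) _
    rewrite Fin.splitAt-↑ˡ (2 * m) (m ↑ʳ (i ↑ˡ 0)) n | Fin.splitAt-↑ʳ m (m + 0) (i ↑ˡ 0)
          | Fin.splitAt-↑ˡ m i 0 = refl
  decode-encode (edge j) _ rewrite Fin.splitAt-↑ʳ (2 * m) n j = refl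

  decode-present : ∀ t → present (decode t) ≡ true
  decode-present t with splitAt (2 * m) t
  ... | inj₂ j = refl
  ... | inj₁ i with splitAt m i
  ...   | inj₁ a = refl
  ...   | inj₂ b with splitAt m b
  ...     | inj₁ _ = refl

  encode-decode : ∀ t pr → encode (decode t) pr ≡ t
  encode-decode t pr with splitAt (2 * m) t in eq
  ... | inj₂ j = Fin.splitAt⁻¹-↑ʳ eq
  ... | inj₁ i with splitAt m i in eq'
  ...   | inj₁ a = trans (cong (_↑ˡ n) (Fin.splitAt⁻¹-↑ˡ eq')) (Fin.splitAt⁻¹-↑ˡ eq)
  ...   | inj₂ b with splitAt m b in eq″
  ...     | inj₁ c = trans (cong (λ z → (m ↑ʳ z) ↑ˡ n) (Fin.splitAt⁻¹-↑ˡ eq″))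
                       (trans (cong (_↑ˡ n) (Fin.splitAt⁻¹-↑ʳ eq')) (Fin.splitAt⁻¹-↑ˡ eq))

  decode-injective : ∀ {t t'} → decode t ≡ decode t' → t ≡ t'
  decode-injective {t} {t'} eq = trans (symm (encode-decode t (decode-present t)))
      (trans (lemma eq (decode-present t) (decode-present t')) (encode-decode t' (decode-present t')))
    where
      lemma : ∀ {c c'} → c ≡ c' → (pr : present c ≡ true) (pr' : present c' ≡ true) → encode c pr ≡ encode c' pr'
      lemma {arcOut _} refl _ _ = refl
      lemma {arcIn _}  refl _ _ = refl
      lemma {edge _}   refl _ _ = refl

flipC-involutive : ∀ {m n} (c : Conn m n) → flipC (flipC c) ≡ c
flipC-involutive none       = refl
flipC-involutive (arcOut _) = refl
flipC-involutive (arcIn _)  = refl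
flipC-involutive (edge _)   = refl

-- The disjoint union of all (m , n)-coloured mixed graphs on the complete bipartite graph K_{D,D}.
module AllBipartite (m n D : ℕ) where
  P = Types m n ^ (D * D)
  N = P * (D + D)

  type : Fin P → Fin D → Fin D → Fin (Types m n)
  type k i j = finToFun k (combine i j)

  between : Fin P → Fin D ⊎ Fin D → Fin D ⊎ Fin D → Conn m n
  between k (inj₁ i) (inj₂ j) = decode (type k i j)
  between k (inj₂ j) (inj₁ i) = flipC (decode (type k i j))
  between k _        _        = none

  between-flip : ∀ k a b → between k b a ≡ flipC (between k a b)
  between-flip k (inj₁ i) (inj₁ i') = refl
  between-flip k (inj₁ i) (inj₂ j)  = refl
  between-flip k (inj₂ j) (inj₁ i)  = symm (flipC-involutive _)
  between-flip k (inj₂ j) (inj₂ j') = refl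

  joined : Fin P × Fin (D + D) → Fin P × Fin (D + D) → Conn m n
  joined (k , e) (k' , e') with k Fin.≟ k'
  ... | yes _ = between k (splitAt D e) (splitAt D e')
  ... | no _  = none

  joined-same : ∀ k e e' → joined (k , e) (k , e') ≡ between k (splitAt D e) (splitAt D e')
  joined-same k e e' with k Fin.≟ k
  ... | yes _ = refl
  ... | no ¬p = contradiction refl ¬p

  joined-loop : ∀ a → joined a a ≡ none
  joined-loop (k , e) rewrite joined-same k e e with splitAt D e
  ... | inj₁ _ = refl
  ... | inj₂ _ = refl

  joined-flip : ∀ a b → joined b a ≡ flipC (joined a b)
  joined-flip (k , e) (k' , e') with k Fin.≟ k' | k' Fin.≟ k
  ... | yes refl | yes _ = between-flip k (splitAt D e) (splitAt D e')
  ... | yes refl | no ¬p = contradiction refl ¬p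
  ... | no ¬p    | yes q = contradiction (symm q) ¬p
  ... | no _     | no _  = refl

  at : Fin N → Fin P × Fin (D + D)
  at = remQuot (D + D)

  vertex : Fin P → Fin (D + D) → Fin N
  vertex = combine

  graph : MixedGraph m n N
  graph = record
    { conn     = λ u v → joined (at u) (at v)
    ; loopless = λ u → joined-loop (at u)
    ; flipped  = λ u v → joined-flip (at u) (at v)
    }

  underlying : SimpleGraph N
  underlying = record
    { adj    = λ u v → present (conn graph u v)
    ; sym    = λ u v → trans (symm (present-flipC (conn graph u v))) (cong present (symm (flipped graph u v)))
    ; irrefl = λ u → cong present (loopless graph u)
    }

  private
    opposite : Fin D ⊎ Fin D → Fin D → Fin (D + D)
    opposite (inj₁ _) j = D ↑ʳ j
    opposite (inj₂ _) i = i ↑ˡ D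

    opposite-injective : ∀ a {j j'} → opposite a j ≡ opposite a j' → j ≡ j'
    opposite-injective (inj₁ _) = Fin.↑ʳ-injective D _ _
    opposite-injective (inj₂ _) = Fin.↑ˡ-injective D _ _

    present-opposite : ∀ k a j → present (between k a (splitAt D (opposite a j))) ≡ true
    present-opposite k (inj₁ i) j rewrite Fin.splitAt-↑ʳ D D j = decode-present (type k i j)
    present-opposite k (inj₂ j) i rewrite Fin.splitAt-↑ˡ D i D =
      trans (present-flipC (decode (type k i j))) (decode-present (type k i j))

    opposite-surjective : ∀ k a e → present (between k a (splitAt D e)) ≡ true → ∃ λ j → e ≡ opposite a j
    opposite-surjective k (inj₁ i) e pr with splitAt D e in eq
    ... | inj₂ j = j , symm (Fin.splitAt⁻¹-↑ʳ eq)
    opposite-surjective k (inj₂ j) e pr with splitAt D e in eq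
    ... | inj₁ i = i , symm (Fin.splitAt⁻¹-↑ˡ eq)

  degree : ∀ v → deg underlying v ≡ D
  degree v = begin
    deg underlying v          ≡⟨ length-filter-true (adj underlying v) (allFin N) ⟨
    length (filter Q? (allFin N)) ≡⟨ ≤-antisym
       (unique-⊆⇒length≤ _ _ (Unique.filter⁺ Q? (Unique.allFin⁺ N)) to)
       (unique-⊆⇒length≤ _ _ (Unique.map⁺ inj (Unique.allFin⁺ D)) from) ⟩
    length (map nbr (allFin D)) ≡⟨ length-map nbr (allFin D) ⟩
    length (allFin D)           ≡⟨ length-tabulate id ⟩
    D                           ∎
    where
      open ≡-Reasoning
      k = proj₁ (at v)
      e = proj₂ (at v)
      Q? = λ w → adj underlying v w Bool.≟ true
      nbr : Fin D → Fin N
      nbr j = vertex k (opposite (splitAt D e) j)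
      inj : ∀ {i j} → nbr i ≡ nbr j → i ≡ j
      inj {i} {j} eq = opposite-injective (splitAt D e) (Fin.combine-injectiveʳ k _ k _ eq)
      from : ∀ {w} → w ∈ map nbr (allFin D) → w ∈ filter Q? (allFin N)
      from w∈ with ∈-map⁻ nbr w∈
      ... | j , _ , refl = ∈-filter⁺ Q? (∈-allFin _) (trans
            (cong (λ z → present (joined (at v) z)) (Fin.remQuot-combine k (opposite (splitAt D e) j)))
            (trans (cong present (joined-same k e (opposite (splitAt D e) j))) (present-opposite k (splitAt D e) j)))
      to : ∀ {w} → w ∈ filter Q? (allFin N) → w ∈ map nbr (allFin D)
      to {w} w∈ = lemma (at w) (Fin.combine-remQuot {P} (D + D) w) (proj₂ (∈-filter⁻ Q? {xs = allFin N} w∈))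
        where
          lemma : ∀ b → uncurry combine b ≡ w → present (joined (k , e) b) ≡ true → w ∈ map nbr (allFin D)
          lemma (k' , e') refl pr with k Fin.≟ k'
          ... | yes refl with opposite-surjective k (splitAt D e) e' pr
          ...   | j , refl = ∈-map⁺ nbr (∈-allFin j)

  private
    funToFin-cong : ∀ {a b} {f g : Fin a → Fin b} → f ≗ g → funToFin f ≡ funToFin g
    funToFin-cong {zero}  _ = refl
    funToFin-cong {suc a} e = cong₂ combine (e zero) (funToFin-cong (e ∘ suc))

  -- On the copy `k` the homomorphism restricts to a map of 2D vertices into `Fin K`, and the
  -- connections of `H` between the images give the colouring `k` back. So distinct colourings have
  -- distinct maps.
  colourings≤maps : ∀ {K} (H : MixedGraph m n K) → HasColHom graph H → P ≤ K ^ (D + D)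
  colourings≤maps {K} H (f , hom) = Fin.injective⇒≤ {f = λ k → funToFin (image k)} inj
    where
      image : Fin P → Fin (D + D) → Fin K
      image k e = f (vertex k e)
      pulled : ∀ k i j → conn H (image k (i ↑ˡ D)) (image k (D ↑ʳ j)) ≡ decode (type k i j)
      pulled k i j = trans (hom _ _ (trans (cong present here') (decode-present (type k i j)))) here'
        where
          here' : conn graph (vertex k (i ↑ˡ D)) (vertex k (D ↑ʳ j)) ≡ decode (type k i j)
          here' = trans (cong₂ joined (Fin.remQuot-combine k (i ↑ˡ D)) (Fin.remQuot-combine k (D ↑ʳ j)))
                    (trans (joined-same k (i ↑ˡ D) (D ↑ʳ j))
                      (cong₂ (between k) (Fin.splitAt-↑ˡ D i D) (Fin.splitAt-↑ʳ D D j)))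
      inj : ∀ {k k'} → funToFin (image k) ≡ funToFin (image k') → k ≡ k'
      inj {k} {k'} eq = begin
        k                     ≡⟨ Fin.funToFin-finToFin {D * D} k ⟨
        funToFin {D * D} (finToFun k)  ≡⟨ funToFin-cong same ⟩
        funToFin {D * D} (finToFun k') ≡⟨ Fin.funToFin-finToFin {D * D} k' ⟩
        k'                    ∎
        where
          open ≡-Reasoning
          img : image k ≗ image k'
          img e = trans (symm (Fin.finToFun-funToFin (image k) e))
                    (trans (cong (λ z → finToFun z e) eq) (Fin.finToFun-funToFin (image k') e))
          same : finToFun {Types m n} {D * D} k ≗ finToFun k'
          same c with Fin.combine-surjective {D} {D} c
          ... | i , j , refl = decode-injective (trans (symm (pulled k i j))
                  (trans (cong₂ (conn H) (img (i ↑ˡ D)) (img (D ↑ʳ j))) (pulled k' i j)))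

lower-bound : ∀ m n Δ → 2 ≤ 2 * m + n → 5 ≤ Δ →
  Σ ℕ λ N → Σ (SimpleGraph N) λ G → MaxDegree G Δ ×
    Σ (MixedGraph m n N) λ G' → Underlies G G' ×
      ((K : ℕ) (H : MixedGraph m n K) → HasColHom G' H → (2 * m + n) ^ Δ ≤ K * K)
lower-bound m n Δ@(suc D) p≥2 Δ≥5 = N , underlying ,
    ((λ v → ≤-reflexive (degree v)) , (vertex k₀ zero , degree (vertex k₀ zero))) ,
    graph , (λ _ _ → refl) , bound
  where
    open AllBipartite m n Δ
    p = 2 * m + n
    k₀ : Fin P
    k₀ = funToFin {Δ * Δ} (λ _ → Data.Fin.fromℕ< (≤-trans (s≤s z≤n) p≥2))
    bound : (K : ℕ) (H : MixedGraph m n K) → HasColHom graph H → p ^ Δ ≤ K * K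
    bound K H h with p ^ Δ ≤? K * K
    ... | yes le = le
    ... | no ¬le = contradiction (begin-strict
        (K * K) ^ Δ     <⟨ ^-monoˡ-< Δ (≰⇒> ¬le) ⟩
        (p ^ Δ) ^ Δ     ≡⟨ ^-*-assoc p Δ Δ ⟩
        p ^ (Δ * Δ)     ≤⟨ colourings≤maps H h ⟩
        K ^ (Δ + Δ)     ≡⟨ ^-distribˡ-+-* K Δ Δ ⟩
        K ^ Δ * K ^ Δ   ≡⟨ ^-distribʳ-* Δ K K ⟨
        (K * K) ^ Δ     ∎) (<-irrefl refl)
      where open ≤-Reasoning

-- Targets from large solution sets of full lists.

AtLeast : ∀ {K} → ℕ → (Fin K → Set) → Set
AtLeast {K} b P = Σ (List (Fin K)) λ ys → Unique ys × All P ys × b ≤ length ys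

module _ {K : ℕ} where
  open DecMembership (Fin._≟_ {K}) using (_∈?_)

  atLeast-≤ : ∀ {a b} {P : Fin K → Set} → a ≤ b → AtLeast b P → AtLeast a P
  atLeast-≤ a≤b (ys , u , ps , b≤) = ys , u , ps , ≤-trans a≤b b≤

  atLeast-all : AtLeast K (λ (_ : Fin K) → ⊤)
  atLeast-all = allFin K , Unique.allFin⁺ K , All.universal (λ _ → tt) _ , ≤-reflexive (symm (length-tabulate id))

  atLeast-avoid : ∀ {b} {P : Fin K → Set} → AtLeast b P → (zs : List (Fin K)) → length zs < b →
                  ∃ λ y → P y × y ∉ zs
  atLeast-avoid (ys , u , ps , b≤) zs lt with All.all? (_∈? zs) ys
  ... | yes all = contradiction (≤-trans b≤ (unique-⊆⇒length≤ ys zs u (All.lookup all))) (<⇒≱ lt)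
  ... | no ¬all = find ps (All.¬All⇒Any¬ (_∈? zs) ys ¬all)
    where
      find : ∀ {ys} → All _ ys → Any (_∉ zs) ys → ∃ λ y → _ × y ∉ zs
      find (p ∷ _)  (here y∉) = _ , p , y∉
      find (_ ∷ ps) (there a) = find ps a

  atLeast-⊎ : ∀ {a b} {P Q R : Fin K → Set} → (∀ {y} → P y → R y) → (∀ {y} → Q y → R y) →
              (∀ {y} → P y → Q y → ⊥) → AtLeast a P → AtLeast b Q → AtLeast (a + b) R
  atLeast-⊎ f g dis (xs , ux , ps , a≤) (ys , uy , qs , b≤) =
    xs ++ ys , Unique.++⁺ ux uy (λ { (p , q) → dis (All.lookup ps p) (All.lookup qs q) }) ,
    All.++⁺ (All.map f ps) (All.map g qs) ,
    subst (_ ≤_) (symm (length-++ xs)) (+-mono-≤ a≤ b≤)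

-- If every admissible list of s constraints leaves more than F vertices, then, splitting
-- according to the connection with a fresh vertex, one of s - d constraints leaves
-- more than (d + 1) F of them.
module FromCells {m n K s} (H : MixedGraph m n K) (F : ℕ) (2F<K : F + F < K)
  (c₁ c₂ : Conn m n) (pr₁ : present c₁ ≡ true) (pr₂ : present c₂ ≡ true) (c₁≢c₂ : c₁ ≢ c₂)
  (Ok : List (Constraint m n K) → Set) (ok-[] : Ok [])
  (forbidden : ∀ L c → Ok L → length L < s → present c ≡ true →
     Σ (List (Fin K)) λ bad → length bad ≤ F × (∀ y → y ∉ bad → Ok ((y , c) ∷ L)))
  (full : ∀ L → Ok L → length L ≡ s → AtLeast (suc F) (λ y → Sat H y L))
  (pair : ∀ L L' c → Ok L → Ok L' → length L ≡ s → length L' ≡ s → present c ≡ true →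
     ∃ λ α → ∃ λ ω → Sat H α L × Sat H ω L' × conn H α ω ≡ c)
  where

  cell : ∀ d L → Ok L → length L + d ≡ s → AtLeast (suc (suc d * F)) (λ y → Sat H y L)
  cell zero L ok eq = atLeast-≤ (s≤s (≤-reflexive (+-identityʳ F))) (full L ok (trans (symm (+-identityʳ _)) eq))
  cell (suc d) L ok eq with forbidden L c₁ ok lt pr₁ | forbidden L c₂ ok lt pr₂
    where lt = subst (length L <_) eq (m<m+n (length L) (s≤s z≤n))
  -- The bound 2 F < K provides a vertex `u` outside both forbidden sets; its two types give
  -- disjoint classes of solutions.
  ... | bad₁ , len₁ , ok₁ | bad₂ , len₂ , ok₂ with atLeast-avoid atLeast-all (bad₁ ++ bad₂)
        (≤-<-trans (≤-trans (≤-reflexive (length-++ bad₁)) (+-mono-≤ len₁ len₂)) 2F<K)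
  ...   | u , _ , u∉ = atLeast-≤ enough (atLeast-⊎ All.tail All.tail
            (λ { (p ∷ _) (q ∷ _) → c₁≢c₂ (trans (symm p) q) })
            (cell d ((u , c₁) ∷ L) (ok₁ u (u∉ ∘ ∈-++⁺ˡ)) eq')
            (cell d ((u , c₂) ∷ L) (ok₂ u (u∉ ∘ ∈-++⁺ʳ bad₁)) eq'))
    where
      eq' : suc (length L) + d ≡ s
      eq' = trans (symm (+-suc (length L) d)) eq
      enough : suc (suc (suc d) * F) ≤ suc (suc d * F) + suc (suc d * F)
      enough = s≤s (begin
        F + suc d * F               ≡⟨ +-comm F (suc d * F) ⟩
        suc d * F + F               ≤⟨ +-monoʳ-≤ (suc d * F) (m≤n⇒m≤1+n (m≤m+n F (d * F))) ⟩
        suc d * F + suc (suc d * F) ∎)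
        where open ≤-Reasoning

  collect : (Ls : List (List (Constraint m n K) × Conn m n)) →
            All (λ { (L' , c) → Ok L' × length L' < s × present c ≡ true }) Ls →
            Σ (List (Fin K)) λ bad → length bad ≤ length Ls * F ×
              (∀ y → y ∉ bad → All (λ { (L' , c) → Ok ((y , c) ∷ L') }) Ls)
  collect [] [] = [] , z≤n , λ _ _ → []
  collect ((L' , c) ∷ Ls) ((ok , lt , pr) ∷ rest) with forbidden L' c ok lt pr | collect Ls rest
  ... | bad , len , good | bads , lens , goods =
    bad ++ bads , ≤-trans (≤-reflexive (length-++ bad)) (+-mono-≤ len lens) ,
    λ y y∉ → good y (y∉ ∘ ∈-++⁺ˡ) ∷ goods y (y∉ ∘ ∈-++⁺ʳ bad)

  target : Target H s
  target = record { Ok = Ok ; ok-[] = ok-[] ; extend₂ = pair ; extend₁ = extend }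
    where
      extend : ∀ L → Ok L → length L ≤ s →
               (Ls : List (List (Constraint m n K) × Conn m n)) →
               All (λ { (L' , c) → Ok L' × length L' < s × present c ≡ true }) Ls →
               length L + length Ls ≤ suc s →
               ∃ λ y → Sat H y L × All (λ { (L' , c) → Ok ((y , c) ∷ L') }) Ls
      extend L ok len≤ Ls oks le with collect Ls oks
      -- By the degree bound at most s + 1 - `length L` neighbours forbid F vertices each, at least
      -- one vertex fewer than the cell contains.
      ... | bad , blen , good with atLeast-avoid (cell (s ∸ length L) L ok (m+[n∸m]≡n len≤)) bad (s≤s (begin
              length bad               ≤⟨ blen ⟩
              length Ls * F            ≤⟨ *-monoˡ-≤ F (+-cancelˡ-≤ (length L) _ _ (begin
                  length L + length Ls             ≤⟨ le ⟩
                  suc s                            ≡⟨ cong suc (m+[n∸m]≡n len≤) ⟨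
                  suc (length L + (s ∸ length L))  ≡⟨ +-suc (length L) (s ∸ length L) ⟨
                  length L + suc (s ∸ length L)    ∎)) ⟩
              suc (s ∸ length L) * F   ∎))
        where open ≤-Reasoning
      ...   | y , sat , y∉ = y , sat , good y y∉

-- Finite averages over words.

∑ : ∀ k → (Fin k → ℕ) → ℕ
∑ zero    f = 0
∑ (suc k) f = f zero + ∑ k (f ∘ suc)

∑-cong : ∀ k {f g : Fin k → ℕ} → f ≗ g → ∑ k f ≡ ∑ k g
∑-cong zero    e = refl
∑-cong (suc k) e = cong₂ _+_ (e zero) (∑-cong k (e ∘ suc))

∑-mono : ∀ k {f g : Fin k → ℕ} → (∀ i → f i ≤ g i) → ∑ k f ≤ ∑ k g
∑-mono zero    e = z≤n
∑-mono (suc k) e = +-mono-≤ (e zero) (∑-mono k (e ∘ suc))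

∑-const : ∀ k c → ∑ k (λ _ → c) ≡ k * c
∑-const zero    c = refl
∑-const (suc k) c = cong (c +_) (∑-const k c)

∑-+ : ∀ k (f g : Fin k → ℕ) → ∑ k (λ i → f i + g i) ≡ ∑ k f + ∑ k g
∑-+ zero    f g = refl
∑-+ (suc k) f g = trans (cong (f zero + g zero +_) (∑-+ k (f ∘ suc) (g ∘ suc)))
                        (solve 4 (λ a b c d → a :+ b :+ (c :+ d) := a :+ c :+ (b :+ d)) refl (f zero) (g zero) (∑ k (f ∘ suc)) (∑ k (g ∘ suc)))
  where open +-*-Solver

∑-*ˡ : ∀ k c (f : Fin k → ℕ) → ∑ k (λ i → c * f i) ≡ c * ∑ k f
∑-*ˡ zero    c f = symm (*-zeroʳ c)
∑-*ˡ (suc k) c f = trans (cong (c * f zero +_) (∑-*ˡ k c (f ∘ suc))) (symm (*-distribˡ-+ c (f zero) _))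

∑-comm : ∀ k l (f : Fin k → Fin l → ℕ) → ∑ k (λ i → ∑ l (f i)) ≡ ∑ l (λ j → ∑ k (λ i → f i j))
∑-comm zero    l f = symm (trans (∑-const l 0) (*-zeroʳ l))
∑-comm (suc k) l f = trans (cong (∑ l (f zero) +_) (∑-comm k l (f ∘ suc)))
                           (symm (∑-+ l (f zero) (λ j → ∑ k (λ i → f (suc i) j))))

≤-∑ : ∀ k (f : Fin k → ℕ) i → f i ≤ ∑ k f
≤-∑ (suc k) f zero    = m≤m+n (f zero) _
≤-∑ (suc k) f (suc i) = ≤-trans (≤-∑ k (f ∘ suc) i) (m≤n+m _ (f zero))

∑-<⇒∃ : ∀ k c (f : Fin k → ℕ) → ∑ k f < k * c → ∃ λ i → f i < c
∑-<⇒∃ (suc k) c f lt with f zero <? c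
... | yes p = zero , p
... | no ¬p with ∑-<⇒∃ k c (f ∘ suc) (+-cancelˡ-< c _ _ (≤-<-trans (+-monoˡ-≤ _ (≮⇒≥ ¬p)) lt))
...   | i , q = suc i , q

module Sums (p : ℕ) where

  -- This is p^n times the expectation over n independent uniform coordinates.
  ∑V : ∀ n → (Vec (Fin p) n → ℕ) → ℕ
  ∑V zero    F = F []
  ∑V (suc n) F = ∑ p (λ t → ∑V n (λ X → F (t ∷ X)))

  ∑V-cong : ∀ n {F G : Vec (Fin p) n → ℕ} → F ≗ G → ∑V n F ≡ ∑V n G
  ∑V-cong zero    e = e []
  ∑V-cong (suc n) e = ∑-cong p (λ t → ∑V-cong n (λ X → e (t ∷ X)))

  ∑V-mono : ∀ n {F G : Vec (Fin p) n → ℕ} → (∀ X → F X ≤ G X) → ∑V n F ≤ ∑V n G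
  ∑V-mono zero    e = e []
  ∑V-mono (suc n) e = ∑-mono p (λ t → ∑V-mono n (λ X → e (t ∷ X)))

  ∑V-const : ∀ n c → ∑V n (λ _ → c) ≡ p ^ n * c
  ∑V-const zero    c = symm (+-identityʳ c)
  ∑V-const (suc n) c = trans (∑-cong p (λ _ → ∑V-const n c))
                             (trans (∑-const p (p ^ n * c)) (symm (*-assoc p (p ^ n) c)))

  ∑V-+ : ∀ n (F G : Vec (Fin p) n → ℕ) → ∑V n (λ X → F X + G X) ≡ ∑V n F + ∑V n G
  ∑V-+ zero    F G = refl
  ∑V-+ (suc n) F G = trans (∑-cong p (λ t → ∑V-+ n _ _)) (∑-+ p _ _)

  ∑V-*ˡ : ∀ n c (F : Vec (Fin p) n → ℕ) → ∑V n (λ X → c * F X) ≡ c * ∑V n F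
  ∑V-*ˡ zero    c F = refl
  ∑V-*ˡ (suc n) c F = trans (∑-cong p (λ t → ∑V-*ˡ n c _)) (∑-*ˡ p c _)

  ∑V-∑ : ∀ n k (F : Fin k → Vec (Fin p) n → ℕ) → ∑V n (λ X → ∑ k (λ i → F i X)) ≡ ∑ k (λ i → ∑V n (F i))
  ∑V-∑ zero    k F = refl
  ∑V-∑ (suc n) k F = trans (∑-cong p (λ t → ∑V-∑ n k _)) (∑-comm p k _)

  ∑V-<⇒∃ : ∀ n c (F : Vec (Fin p) n → ℕ) → ∑V n F < p ^ n * c → ∃ λ X → F X < c
  ∑V-<⇒∃ zero    c F lt = [] , subst (F [] <_) (+-identityʳ c) lt
  ∑V-<⇒∃ (suc n) c F lt with ∑-<⇒∃ p (p ^ n * c) _ (subst (∑V (suc n) F <_) (*-assoc p (p ^ n) c) lt)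
  ... | t , lt' with ∑V-<⇒∃ n c (λ X → F (t ∷ X)) lt'
  ...   | X , q = t ∷ X , q

  -- Overwriting coordinate `i` by each of the p letters produces every vector exactly p times.
  resample : ∀ n (i : Fin n) (F : Vec (Fin p) n → ℕ) →
             p * ∑V n F ≡ ∑V n (λ X → ∑ p (λ t → F (X [ i ]≔ t)))
  resample (suc n) zero F = trans (cong (p *_) (symm (∑V-∑ n p (λ t X → F (t ∷ X)))))
                                  (symm (∑-const p _))
  resample (suc n) (suc i) F = trans (symm (∑-*ˡ p p _)) (∑-cong p (λ t → resample n i (λ X → F (t ∷ X))))

  ∑L : ℕ → (List (Fin p) → ℕ) → ℕ
  ∑L zero    F = F []
  ∑L (suc k) F = ∑ p (λ t → ∑L k (λ z → F (t ∷ z)))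

  ∑L-cong : ∀ k {F G : List (Fin p) → ℕ} → F ≗ G → ∑L k F ≡ ∑L k G
  ∑L-cong zero    e = e []
  ∑L-cong (suc k) e = ∑-cong p (λ t → ∑L-cong k (λ z → e (t ∷ z)))

  ∑L-const : ∀ k c → ∑L k (λ _ → c) ≡ p ^ k * c
  ∑L-const zero    c = symm (+-identityʳ c)
  ∑L-const (suc k) c = trans (∑-cong p (λ _ → ∑L-const k c))
                             (trans (∑-const p (p ^ k * c)) (symm (*-assoc p (p ^ k) c)))

  ∑L-*ˡ : ∀ k c (F : List (Fin p) → ℕ) → ∑L k (λ z → c * F z) ≡ c * ∑L k F
  ∑L-*ˡ zero    c F = refl
  ∑L-*ˡ (suc k) c F = trans (∑-cong p (λ t → ∑L-*ˡ k c _)) (∑-*ˡ p c _)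

  Ignores : ∀ {n} {A : Set} → List (Fin n) → (Vec (Fin p) n → A) → Set
  Ignores cs f = ∀ X {i} t → i ∈ cs → f (X [ i ]≔ t) ≡ f X

  -- Uniformly distributed coordinates may be averaged out one after the other.
  integrate : ∀ n (cs : List (Fin n)) → Unique cs → (Ψ : Vec (Fin p) n → List (Fin p) → ℕ) →
              (∀ z → Ignores cs (λ X → Ψ X z)) →
              p ^ length cs * ∑V n (λ X → Ψ X (map (lookup X) cs)) ≡ ∑V n (λ X → ∑L (length cs) (Ψ X))
  integrate n []       _        Ψ ig = +-identityʳ _
  integrate n (c ∷ cs) (c∉ ∷ u) Ψ ig = begin
    p * p ^ k * ∑V n (λ X → Ψ X (lookup X c ∷ map (lookup X) cs))
      ≡⟨ cong (_* ∑V n (λ X → Ψ X (lookup X c ∷ map (lookup X) cs))) (*-comm p (p ^ k)) ⟩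
    p ^ k * p * ∑V n (λ X → Ψ X (lookup X c ∷ map (lookup X) cs))
      ≡⟨ *-assoc (p ^ k) p _ ⟩
    p ^ k * (p * ∑V n (λ X → Ψ X (lookup X c ∷ map (lookup X) cs)))
      ≡⟨ cong (p ^ k *_) (resample n c _) ⟩
    p ^ k * ∑V n (λ X → ∑ p (λ t → Ψ (X [ c ]≔ t) (lookup (X [ c ]≔ t) c ∷ map (lookup (X [ c ]≔ t)) cs)))
      ≡⟨ cong (p ^ k *_) (∑V-cong n (λ X → ∑-cong p (λ t → trans (ig _ X t (here refl))
           (cong (Ψ X) (cong₂ _∷_ (Vec.lookup∘update c X t) (untouched X t cs c∉)))))) ⟩
    p ^ k * ∑V n (λ X → ∑ p (λ t → Ψ X (t ∷ map (lookup X) cs)))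
      ≡⟨ cong (p ^ k *_) (∑V-∑ n p _) ⟩
    p ^ k * ∑ p (λ t → ∑V n (λ X → Ψ X (t ∷ map (lookup X) cs)))
      ≡⟨ ∑-*ˡ p (p ^ k) _ ⟨
    ∑ p (λ t → p ^ k * ∑V n (λ X → Ψ X (t ∷ map (lookup X) cs)))
      ≡⟨ ∑-cong p (λ t → integrate n cs u (λ X z → Ψ X (t ∷ z)) (λ z X t' i∈ → ig (t ∷ z) X t' (there i∈))) ⟩
    ∑ p (λ t → ∑V n (λ X → ∑L k (λ z → Ψ X (t ∷ z))))
      ≡⟨ ∑V-∑ n p _ ⟨
    ∑V n (λ X → ∑ p (λ t → ∑L k (λ z → Ψ X (t ∷ z)))) ∎
    where
      open ≡-Reasoning
      k = length cs
      untouched : ∀ X t ds → All (c ≢_) ds → map (lookup (X [ c ]≔ t)) ds ≡ map (lookup X) ds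
      untouched X t []       []       = refl
      untouched X t (d ∷ ds) (c≢d ∷ r) = cong₂ _∷_ (Vec.lookup∘update′ (c≢d ∘ symm) X t) (untouched X t ds r)

  matches : List (Fin p) → List (Fin p) → Bool
  matches (t ∷ ts) (x ∷ xs) = does (x Fin.≟ t) ∧ matches ts xs
  matches _        _        = true

  private
    ∑-select : ∀ {k} (t : Fin k) a b → ∑ k (λ x → if does (x Fin.≟ t) then a else b) + b ≡ k * b + a
    ∑-select {suc k} zero a b = begin
      a + ∑ k (λ _ → b) + b ≡⟨ cong (λ z → a + z + b) (∑-const k b) ⟩
      a + k * b + b         ≡⟨ solve 3 (λ a b c → a :+ c :+ b := b :+ c :+ a) refl a b (k * b) ⟩
      b + k * b + a         ∎
      where open ≡-Reasoning
            open +-*-Solver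
    ∑-select {suc k} (suc t) a b = begin
      b + ∑ k (λ x → if does (suc x Fin.≟ suc t) then a else b) + b
        ≡⟨ cong (λ z → b + z + b) (∑-cong k (λ x → cong (λ d → if d then a else b) (suc-does x t))) ⟩
      b + ∑ k (λ x → if does (x Fin.≟ t) then a else b) + b
        ≡⟨ +-assoc b _ b ⟩
      b + (∑ k (λ x → if does (x Fin.≟ t) then a else b) + b)
        ≡⟨ cong (b +_) (∑-select t a b) ⟩
      b + (k * b + a) ≡⟨ +-assoc b (k * b) a ⟨
      b + k * b + a   ∎
      where
        open ≡-Reasoning
        suc-does : ∀ {k} (x t : Fin k) → does (suc x Fin.≟ suc t) ≡ does (x Fin.≟ t)
        suc-does x t with x Fin.≟ t
        ... | yes _ = refl
        ... | no _  = refl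

  ∑-match : ∀ (t : Fin p) a b → ∑ p (λ x → if does (x Fin.≟ t) then a else b) + b ≡ p * b + a
  ∑-match = ∑-select

  -- Exactly one word matches and contributes `a` in place of `b`; the extra `b` on the left avoids
  -- subtracting 1 from the power.
  ∑L-matches : ∀ ts a b → ∑L (length ts) (λ z → if matches ts z then a else b) + b ≡ p ^ length ts * b + a
  ∑L-matches []       a b = trans (+-comm a b) (cong (_+ a) (symm (+-identityʳ b)))
  ∑L-matches (t ∷ ts) a b = begin
    ∑ p (λ x → ∑L k (λ z → if does (x Fin.≟ t) ∧ matches ts z then a else b)) + b
      ≡⟨ cong (_+ b) (∑-cong p inner) ⟩
    ∑ p (λ x → if does (x Fin.≟ t) then A else p ^ k * b) + b
      ≡⟨ +-cancelʳ-≡ (p ^ k * b) _ _ (begin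
           ∑ p (λ x → if does (x Fin.≟ t) then A else p ^ k * b) + b + p ^ k * b
             ≡⟨ solve 3 (λ x y z → x :+ y :+ z := x :+ z :+ y) refl (∑ p (λ x → if does (x Fin.≟ t) then A else p ^ k * b)) b (p ^ k * b) ⟩
           ∑ p (λ x → if does (x Fin.≟ t) then A else p ^ k * b) + p ^ k * b + b
             ≡⟨ cong (_+ b) (∑-match t A (p ^ k * b)) ⟩
           p * (p ^ k * b) + A + b ≡⟨ +-assoc (p * (p ^ k * b)) A b ⟩
           p * (p ^ k * b) + (A + b) ≡⟨ cong (p * (p ^ k * b) +_) (∑L-matches ts a b) ⟩
           p * (p ^ k * b) + (p ^ k * b + a) ≡⟨ solve 3 (λ x y z → x :+ (y :+ z) := x :+ z :+ y) refl (p * (p ^ k * b)) (p ^ k * b) a ⟩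
           p * (p ^ k * b) + a + p ^ k * b ∎) ⟩
    p * (p ^ k * b) + a ≡⟨ cong (_+ a) (*-assoc p (p ^ k) b) ⟨
    p * p ^ k * b + a   ∎
    where
      open ≡-Reasoning
      open +-*-Solver
      k = length ts
      A = ∑L k (λ z → if matches ts z then a else b)
      inner : ∀ x → ∑L k (λ z → if does (x Fin.≟ t) ∧ matches ts z then a else b)
                    ≡ (if does (x Fin.≟ t) then A else p ^ k * b)
      inner x with does (x Fin.≟ t)
      ... | true  = refl
      ... | false = ∑L-const k b

  -- The number of words of length h in which a given letter occurs fewer than b times
  -- (the letter may depend on the position).
  few : ℕ → ℕ → ℕ
  few h       zero    = 0
  few zero    (suc b) = 1
  few (suc h) (suc b) = few h b + (p ∸ 1) * few h (suc b)

  count : List Bool → List (Fin p) → List (Fin p) → ℕ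
  count (true ∷ hs)  (t ∷ ts) (x ∷ xs) = (if does (x Fin.≟ t) then 1 else 0) + count hs ts xs
  count (false ∷ hs) (t ∷ ts) (x ∷ xs) = count hs ts xs
  count _ _ _ = 0

  trues : List Bool → ℕ
  trues []           = 0
  trues (true ∷ hs)  = suc (trues hs)
  trues (false ∷ hs) = trues hs

  falses : List Bool → ℕ
  falses []           = 0
  falses (true ∷ hs)  = falses hs
  falses (false ∷ hs) = suc (falses hs)

  private
    ⌊_<_⌋ : ℕ → ℕ → ℕ
    ⌊ a < b ⌋ = if a <ᵇ b then 1 else 0

  -- The positions marked `false` are unrestricted and contribute a factor p each; the marked ones
  -- form a word of the kind that `few` counts.
  ∑L-count : ∀ (hs : List Bool) (ts : List (Fin p)) b → length hs ≡ length ts →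
             ∑L (length ts) (λ z → if count hs ts z <ᵇ b then 1 else 0) ≡ few (trues hs) b * p ^ falses hs
  ∑L-count [] [] zero    _ = refl
  ∑L-count [] [] (suc b) _ = refl
  ∑L-count (false ∷ hs) (t ∷ ts) b eq = begin
    ∑ p (λ _ → ∑L (length ts) (λ z → ⌊ count hs ts z < b ⌋)) ≡⟨ ∑-const p _ ⟩
    p * ∑L (length ts) (λ z → ⌊ count hs ts z < b ⌋) ≡⟨ cong (p *_) (∑L-count hs ts b (suc-injective eq)) ⟩
    p * (few (trues hs) b * p ^ falses hs)
      ≡⟨ solve 3 (λ x y z → x :* (y :* z) := y :* (x :* z)) refl p (few (trues hs) b) (p ^ falses hs) ⟩
    few (trues hs) b * (p * p ^ falses hs) ∎
    where open ≡-Reasoning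
          open +-*-Solver
  ∑L-count (true ∷ hs) (t ∷ ts) zero eq = begin
    ∑ p (λ x → ∑L (length ts) (λ _ → 0)) ≡⟨ ∑-cong p (λ _ → trans (∑L-const (length ts) 0) (*-zeroʳ (p ^ length ts))) ⟩
    ∑ p (λ _ → 0) ≡⟨ trans (∑-const p 0) (*-zeroʳ p) ⟩
    0 ∎
    where open ≡-Reasoning
  ∑L-count (true ∷ hs) (t ∷ ts) (suc b) eq = begin
    ∑ p (λ x → ∑L (length ts) (λ z → ⌊ (if does (x Fin.≟ t) then 1 else 0) + count hs ts z < suc b ⌋))
      ≡⟨ ∑-cong p inner ⟩
    ∑ p (λ x → if does (x Fin.≟ t) then A else B)
      ≡⟨ +-cancelʳ-≡ B _ _ (trans (∑-match t A B) (trans (cong (λ z → z * B + A) (symm p≡)) (solve 3 (λ q x y → (con 1 :+ q) :* x :+ y := y :+ q :* x :+ x) refl (p ∸ 1) B A))) ⟩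
    A + (p ∸ 1) * B
      ≡⟨ cong₂ (λ x y → x + (p ∸ 1) * y) (∑L-count hs ts b eq') (∑L-count hs ts (suc b) eq') ⟩
    few (trues hs) b * p ^ falses hs + (p ∸ 1) * (few (trues hs) (suc b) * p ^ falses hs)
      ≡⟨ solve 4 (λ x y q z → x :* z :+ q :* (y :* z) := (x :+ q :* y) :* z) refl (few (trues hs) b) (few (trues hs) (suc b)) (p ∸ 1) (p ^ falses hs) ⟩
    (few (trues hs) b + (p ∸ 1) * few (trues hs) (suc b)) * p ^ falses hs ∎
    where
      open ≡-Reasoning
      open +-*-Solver
      eq' = suc-injective eq
      A = ∑L (length ts) (λ z → ⌊ count hs ts z < b ⌋)
      B = ∑L (length ts) (λ z → ⌊ count hs ts z < suc b ⌋)
      p≡ : suc (p ∸ 1) ≡ p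
      p≡ = positive t
        where
          positive : ∀ {k} → Fin k → suc (k ∸ 1) ≡ k
          positive {suc k} _ = refl
      inner : ∀ x → ∑L (length ts) (λ z → ⌊ (if does (x Fin.≟ t) then 1 else 0) + count hs ts z < suc b ⌋)
                    ≡ (if does (x Fin.≟ t) then A else B)
      inner x with does (x Fin.≟ t)
      ... | true  = refl
      ... | false = refl

-- Configurations as labellings of the vertices, and their number.

data Label (p : ℕ) : Set where
  free  : Label p
  fixed : Fin p → Label p
  probe : Label p

isFree : ∀ {p} → Label p → Maybe ⊤
isFree free      = just tt
isFree (fixed _) = nothing
isFree probe     = nothing

isFixed : ∀ {p} → Label p → Maybe (Fin p)
isFixed free      = nothing
isFixed (fixed t) = just t
isFixed probe     = nothing

isProbe : ∀ {p} → Label p → Maybe ⊤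
isProbe free      = nothing
isProbe (fixed _) = nothing
isProbe probe     = just tt

module _ {A B : Set} (f : A → Maybe B) where

  private
    cons-maybe : ∀ {C : Set} → Maybe C → List C → List C
    cons-maybe (just c) cs = c ∷ cs
    cons-maybe nothing  cs = cs

    shift : ∀ {M} → Fin M × B → Fin (suc M) × B
    shift (u , b) = suc u , b

    at-zero : ∀ {M} → B → Fin (suc M) × B
    at-zero b = zero , b

  select : ∀ {M} → Vec A M → List (Fin M × B)
  select []      = []
  select (x ∷ ℓ) = cons-maybe (Maybe.map at-zero (f x)) (map shift (select ℓ))

  selected : ∀ {M} → Vec A M → ℕ
  selected []      = 0
  selected (x ∷ ℓ) = (if is-just (f x) then 1 else 0) + selected ℓ

  length-select : ∀ {M} (ℓ : Vec A M) → length (select ℓ) ≡ selected ℓ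
  length-select []      = refl
  length-select (x ∷ ℓ) with f x
  ... | just _  = cong suc (trans (length-map shift (select ℓ)) (length-select ℓ))
  ... | nothing = trans (length-map shift (select ℓ)) (length-select ℓ)

  ∈-select⁻ : ∀ {M} (ℓ : Vec A M) {u b} → (u , b) ∈ select ℓ → f (lookup ℓ u) ≡ just b
  ∈-select⁻ (x ∷ ℓ) p with f x in eq
  ∈-select⁻ (x ∷ ℓ) (here refl) | just b = eq
  ∈-select⁻ (x ∷ ℓ) (there p)   | just b with ∈-map⁻ shift p
  ... | _ , q , refl = ∈-select⁻ ℓ q
  ∈-select⁻ (x ∷ ℓ) p           | nothing with ∈-map⁻ shift p
  ... | _ , q , refl = ∈-select⁻ ℓ q

  ∈-select⁺ : ∀ {M} (ℓ : Vec A M) u {b} → f (lookup ℓ u) ≡ just b → (u , b) ∈ select ℓ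
  ∈-select⁺ (x ∷ ℓ) zero    eq rewrite eq = here refl
  ∈-select⁺ (x ∷ ℓ) (suc u) eq with f x
  ... | just _  = there (∈-map⁺ shift (∈-select⁺ ℓ u eq))
  ... | nothing = ∈-map⁺ shift (∈-select⁺ ℓ u eq)

  private
    shift-proj : ∀ {M} (xs : List (Fin M × B)) → map proj₁ (map shift xs) ≡ map suc (map proj₁ xs)
    shift-proj []       = refl
    shift-proj (_ ∷ xs) = cong (_ ∷_) (shift-proj xs)

  unique-select : ∀ {M} (ℓ : Vec A M) → Unique (map proj₁ (select ℓ))
  unique-select []      = []
  unique-select (x ∷ ℓ) with f x
  ... | nothing rewrite shift-proj (select ℓ) = Unique.map⁺ Fin.suc-injective (unique-select ℓ)
  ... | just b  rewrite shift-proj (select ℓ) =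
    All.map⁺ (All.universal (λ _ ()) _) ∷ Unique.map⁺ Fin.suc-injective (unique-select ℓ)

label-count : ∀ {p M} (ℓ : Vec (Label p) M) → selected isFree ℓ + (selected isFixed ℓ + selected isProbe ℓ) ≡ M
label-count []            = refl
label-count (free ∷ ℓ)    = cong suc (label-count ℓ)
label-count (fixed _ ∷ ℓ) = trans (+-suc (selected isFree ℓ) _) (cong suc (label-count ℓ))
label-count (probe ∷ ℓ)   = trans (cong (selected isFree ℓ +_) (+-suc (selected isFixed ℓ) _))
                              (trans (+-suc (selected isFree ℓ) _) (cong suc (label-count ℓ)))

module _ {p : ℕ} where

  mutual
    ∑Lab : ∀ M → ℕ → ℕ → (Vec (Label p) M → ℕ) → ℕ
    ∑Lab zero    zero    zero    F = F []
    ∑Lab zero    zero    (suc r) F = 0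
    ∑Lab zero    (suc j) r       F = 0
    ∑Lab (suc M) j       r       F = ∑Lab M j r (λ ℓ → F (free ∷ ℓ)) + (∑fixed M j r F + ∑probe M j r F)

    ∑fixed : ∀ M → ℕ → ℕ → (Vec (Label p) (suc M) → ℕ) → ℕ
    ∑fixed M zero    r F = 0
    ∑fixed M (suc j) r F = ∑ p (λ t → ∑Lab M j r (λ ℓ → F (fixed t ∷ ℓ)))

    ∑probe : ∀ M → ℕ → ℕ → (Vec (Label p) (suc M) → ℕ) → ℕ
    ∑probe M j zero    F = 0
    ∑probe M j (suc r) F = ∑Lab M j r (λ ℓ → F (probe ∷ ℓ))

  ≤-∑Lab : ∀ {M} (ℓ : Vec (Label p) M) F → F ℓ ≤ ∑Lab M (selected isFixed ℓ) (selected isProbe ℓ) F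
  ≤-∑Lab []            F = ≤-refl
  ≤-∑Lab (free ∷ ℓ)    F = ≤-trans (≤-∑Lab ℓ (λ ℓ → F (free ∷ ℓ))) (m≤m+n _ _)
  ≤-∑Lab {suc M} ℓ'@(fixed t ∷ ℓ) F = ≤-trans
    (≤-trans (≤-∑Lab ℓ (λ ℓ → F (fixed t ∷ ℓ))) (≤-∑ p (λ t → ∑Lab M _ _ (λ ℓ → F (fixed t ∷ ℓ))) t))
    (≤-trans (m≤m+n _ (∑probe M (selected isFixed ℓ') (selected isProbe ℓ') F))
             (m≤n+m _ (∑Lab M (selected isFixed ℓ') (selected isProbe ℓ') (λ ℓ → F (free ∷ ℓ)))))
  ≤-∑Lab {suc M} ℓ'@(probe ∷ ℓ) F = ≤-trans (≤-∑Lab ℓ (λ ℓ → F (probe ∷ ℓ)))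
    (≤-trans (m≤n+m _ (∑fixed M (selected isFixed ℓ') (selected isProbe ℓ') F))
             (m≤n+m _ (∑Lab M (selected isFixed ℓ') (selected isProbe ℓ') (λ ℓ → F (free ∷ ℓ)))))

  labellings : ℕ → ℕ → ℕ → ℕ
  labellings M j r = ∑Lab M j r (λ _ → 1)

  ∑Lab-bound : ∀ M j r F B → (∀ ℓ → selected isFixed ℓ ≡ j → selected isProbe ℓ ≡ r → F ℓ ≤ B) →
               ∑Lab M j r F ≤ labellings M j r * B
  ∑Lab-bound zero zero zero    F B h = ≤-trans (h [] refl refl) (m≤m+n B 0)
  ∑Lab-bound zero zero (suc r) F B h = z≤n
  ∑Lab-bound zero (suc j) r    F B h = z≤n
  ∑Lab-bound (suc M) j r       F B h = ≤-trans
      (+-mono-≤ (∑Lab-bound M j r _ B (λ ℓ → h (free ∷ ℓ))) (+-mono-≤ (fixed≤ j h) (probe≤ r h)))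
      (≤-reflexive (symm (trans (*-distribʳ-+ B L₁ (L₂ + L₃)) (cong (L₁ * B +_) (*-distribʳ-+ B L₂ L₃)))))
    where
      L₁ = labellings M j r
      L₂ = ∑fixed M j r (λ _ → 1)
      L₃ = ∑probe M j r (λ _ → 1)
      fixed≤ : ∀ j → (∀ ℓ → selected isFixed ℓ ≡ j → selected isProbe ℓ ≡ r → F ℓ ≤ B) →
               ∑fixed M j r F ≤ ∑fixed M j r (λ _ → 1) * B
      fixed≤ zero    h = z≤n
      fixed≤ (suc j) h = ≤-trans
        (∑-mono p (λ t → ∑Lab-bound M j r _ B (λ ℓ e → h (fixed t ∷ ℓ) (cong suc e))))
        (≤-reflexive (trans (∑-cong p (λ t → *-comm _ B)) (trans (∑-*ˡ p B _) (*-comm B _))))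
      probe≤ : ∀ r → (∀ ℓ → selected isFixed ℓ ≡ j → selected isProbe ℓ ≡ r → F ℓ ≤ B) →
               ∑probe M j r F ≤ ∑probe M j r (λ _ → 1) * B
      probe≤ zero    h = z≤n
      probe≤ (suc r) h = ∑Lab-bound M j r _ B (λ ℓ e e' → h (probe ∷ ℓ) e (cong suc e'))

  private
    -- These are the first two terms of the binomial expansion on the right.
    power-step : ∀ M k → M ^ suc k + suc k * M ^ k ≤ suc M ^ suc k
    power-step M zero    = ≤-reflexive (solve 1 (λ m → m :* con 1 :+ con 1 := (con 1 :+ m) :* con 1) refl M)
      where open +-*-Solver
    power-step M (suc k) = begin
      M * A + (A + suc k * A)           ≡⟨ solve 3 (λ m a k → m :* a :+ (a :+ (con 1 :+ k) :* a) := (a :+ m :* a) :+ (con 1 :+ k) :* a) refl M A k ⟩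
      (A + M * A) + suc k * A           ≤⟨ +-monoʳ-≤ (A + M * A) (m≤n+m _ (suc k * M ^ k)) ⟩
      (A + M * A) + (suc k * M ^ k + suc k * A) ≡⟨ solve 4 (λ m a k b → (a :+ m :* a) :+ ((con 1 :+ k) :* b :+ (con 1 :+ k) :* (m :* b)) := (con 1 :+ m) :* (a :+ (con 1 :+ k) :* b)) refl M A k (M ^ k) ⟩
      suc M * (A + suc k * M ^ k)       ≤⟨ *-monoʳ-≤ (suc M) (power-step M k) ⟩
      suc M * suc M ^ suc k             ∎
      where open ≤-Reasoning
            open +-*-Solver
            A = M ^ suc k

  -- A multinomial coefficient times p^j, with the factorials kept on the left instead of dividing.
  -- The induction on M follows Pascal's rule, each step being an instance of `power-step`.
  labellings-bound : ∀ M j r → labellings M j r * (j ! * r !) ≤ p ^ j * M ^ (j + r)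
  labellings-bound zero zero zero    = ≤-refl
  labellings-bound zero zero (suc r) = z≤n
  labellings-bound zero (suc j) r    = z≤n
  labellings-bound (suc M) zero zero = begin
    (labellings M 0 0 + 0) * 1 ≡⟨ cong (_* 1) (+-identityʳ (labellings M 0 0)) ⟩
    labellings M 0 0 * 1       ≤⟨ labellings-bound M 0 0 ⟩
    1                          ∎
    where open ≤-Reasoning
  labellings-bound (suc M) zero (suc r) = begin
    (labellings M 0 (suc r) + labellings M 0 r) * (1 * (suc r * r !))
      ≡⟨ solve 4 (λ a b r f → (a :+ b) :* (con 1 :* ((con 1 :+ r) :* f)) := a :* (con 1 :* ((con 1 :+ r) :* f)) :+ (con 1 :+ r) :* (b :* (con 1 :* f))) refl (labellings M 0 (suc r)) (labellings M 0 r) r (r !) ⟩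
    labellings M 0 (suc r) * (1 * (suc r * r !)) + suc r * (labellings M 0 r * (1 * r !))
      ≤⟨ +-mono-≤ (labellings-bound M 0 (suc r)) (*-monoʳ-≤ (suc r) (labellings-bound M 0 r)) ⟩
    1 * M ^ suc r + suc r * (1 * M ^ r)
      ≡⟨ cong₂ (λ a b → a + suc r * b) (*-identityˡ (M ^ suc r)) (*-identityˡ (M ^ r)) ⟩
    M ^ suc r + suc r * M ^ r ≤⟨ power-step M r ⟩
    suc M ^ suc r             ≡⟨ *-identityˡ (suc M ^ suc r) ⟨
    1 * suc M ^ suc r         ∎
    where open ≤-Reasoning
          open +-*-Solver
  labellings-bound (suc M) (suc j) zero = begin
    (labellings M (suc j) 0 + (∑ p (λ _ → labellings M j 0) + 0)) * (suc j * j ! * 1)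
      ≡⟨ cong (λ z → (labellings M (suc j) 0 + (z + 0)) * (suc j * j ! * 1)) (∑-const p (labellings M j 0)) ⟩
    (labellings M (suc j) 0 + (p * labellings M j 0 + 0)) * (suc j * j ! * 1)
      ≡⟨ solve 5 (λ a b j f p → (a :+ (p :* b :+ con 0)) :* ((con 1 :+ j) :* f :* con 1) := a :* ((con 1 :+ j) :* f :* con 1) :+ p :* (con 1 :+ j) :* (b :* (f :* con 1))) refl (labellings M (suc j) 0) (labellings M j 0) j (j !) p ⟩
    labellings M (suc j) 0 * (suc j * j ! * 1) + p * suc j * (labellings M j 0 * (j ! * 1))
      ≤⟨ +-mono-≤ (labellings-bound M (suc j) 0) (*-monoʳ-≤ (p * suc j) (labellings-bound M j 0)) ⟩
    p ^ suc j * M ^ suc (j + 0) + p * suc j * (p ^ j * M ^ (j + 0))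
      ≡⟨ solve 5 (λ p q m n j → p :* q :* m :+ p :* (con 1 :+ j) :* (q :* n) := p :* q :* (m :+ (con 1 :+ j) :* n)) refl p (p ^ j) (M ^ suc (j + 0)) (M ^ (j + 0)) j ⟩
    p ^ suc j * (M ^ suc (j + 0) + suc j * M ^ (j + 0))
      ≡⟨ cong (λ k → p ^ suc j * (M ^ suc (j + 0) + suc k * M ^ (j + 0))) (+-identityʳ j) ⟨
    p ^ suc j * (M ^ suc (j + 0) + suc (j + 0) * M ^ (j + 0)) ≤⟨ *-monoʳ-≤ (p ^ suc j) (power-step M (j + 0)) ⟩
    p ^ suc j * suc M ^ suc (j + 0) ∎
    where open ≤-Reasoning
          open +-*-Solver
  labellings-bound (suc M) (suc j) (suc r) = begin
    (L + (∑ p (λ _ → L₂) + L₃)) * (suc j * j ! * (suc r * r !))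
      ≡⟨ cong (λ z → (L + (z + L₃)) * (suc j * j ! * (suc r * r !))) (∑-const p L₂) ⟩
    (L + (p * L₂ + L₃)) * (suc j * j ! * (suc r * r !))
      ≡⟨ solve 8 (λ a b c j f r g p → (a :+ (p :* b :+ c)) :* ((con 1 :+ j) :* f :* ((con 1 :+ r) :* g)) := a :* ((con 1 :+ j) :* f :* ((con 1 :+ r) :* g)) :+ (p :* (con 1 :+ j) :* (b :* (f :* ((con 1 :+ r) :* g))) :+ (con 1 :+ r) :* (c :* ((con 1 :+ j) :* f :* g)))) refl L L₂ L₃ j (j !) r (r !) p ⟩
    L * (suc j * j ! * (suc r * r !)) + (p * suc j * (L₂ * (j ! * (suc r * r !))) + suc r * (L₃ * (suc j * j ! * r !)))
      ≤⟨ +-mono-≤ (labellings-bound M (suc j) (suc r)) (+-mono-≤ (*-monoʳ-≤ (p * suc j) (labellings-bound M j (suc r))) (*-monoʳ-≤ (suc r) (labellings-bound M (suc j) r))) ⟩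
    p ^ suc j * M ^ suc (j + suc r) + (p * suc j * (p ^ j * M ^ (j + suc r)) + suc r * (p ^ suc j * M ^ suc (j + r)))
      ≡⟨ cong (λ k → p ^ suc j * M ^ suc (j + suc r) + (p * suc j * (p ^ j * M ^ (j + suc r)) + suc r * (p ^ suc j * M ^ k))) (+-suc j r) ⟨
    p ^ suc j * M ^ suc (j + suc r) + (p * suc j * (p ^ j * M ^ (j + suc r)) + suc r * (p ^ suc j * M ^ (j + suc r)))
      ≡⟨ solve 6 (λ p q m n j r → p :* q :* m :+ (p :* (con 1 :+ j) :* (q :* n) :+ (con 1 :+ r) :* (p :* q :* n)) := p :* q :* (m :+ (con 1 :+ (j :+ (con 1 :+ r))) :* n)) refl p (p ^ j) (M ^ suc (j + suc r)) (M ^ (j + suc r)) j r ⟩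
    p ^ suc j * (M ^ suc (j + suc r) + suc (j + suc r) * M ^ (j + suc r)) ≤⟨ *-monoʳ-≤ (p ^ suc j) (power-step M (j + suc r)) ⟩
    p ^ suc j * suc M ^ suc (j + suc r) ∎
    where
      open ≤-Reasoning
      open +-*-Solver
      L  = labellings M (suc j) (suc r)
      L₂ = labellings M j (suc r)
      L₃ = labellings M (suc j) r

module _ {p : ℕ} where
  open Sums p

  ∑V-∑Lab : ∀ n M j r (F : Vec (Label p) M → Vec (Fin p) n → ℕ) →
            ∑V n (λ X → ∑Lab M j r (λ ℓ → F ℓ X)) ≡ ∑Lab M j r (λ ℓ → ∑V n (F ℓ))
  ∑V-∑Lab n zero zero zero    F = refl
  ∑V-∑Lab n zero zero (suc r) F = trans (∑V-const n 0) (*-zeroʳ (p ^ n))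
  ∑V-∑Lab n zero (suc j) r    F = trans (∑V-const n 0) (*-zeroʳ (p ^ n))
  ∑V-∑Lab n (suc M) j r       F = trans (∑V-+ n _ _)
      (cong₂ _+_ (∑V-∑Lab n M j r _) (trans (∑V-+ n _ _) (cong₂ _+_ (fixed≡ j) (probe≡ r))))
    where
      fixed≡ : ∀ j → ∑V n (λ X → ∑fixed M j r (λ ℓ → F ℓ X)) ≡ ∑fixed M j r (λ ℓ → ∑V n (F ℓ))
      fixed≡ zero    = trans (∑V-const n 0) (*-zeroʳ (p ^ n))
      fixed≡ (suc j) = trans (∑V-∑ n p _) (∑-cong p (λ t → ∑V-∑Lab n M j r _))
      probe≡ : ∀ r → ∑V n (λ X → ∑probe M j r (λ ℓ → F ℓ X)) ≡ ∑probe M j r (λ ℓ → ∑V n (F ℓ))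
      probe≡ zero    = trans (∑V-const n 0) (*-zeroʳ (p ^ n))
      probe≡ (suc r) = ∑V-∑Lab n M j r _

-- The random mixed graph and a Chernoff bound for one configuration.

prodL : {A : Set} → (A → ℕ) → List A → ℕ
prodL f []       = 1
prodL f (x ∷ xs) = f x * prodL f xs

prodL-cong : {A : Set} {f g : A → ℕ} (xs : List A) → (∀ {x} → x ∈ xs → f x ≡ g x) → prodL f xs ≡ prodL g xs
prodL-cong []       e = refl
prodL-cong (x ∷ xs) e = cong₂ _*_ (e (here refl)) (prodL-cong xs (e ∘ there))

prodL-++ : {A : Set} (f : A → ℕ) (xs ys : List A) → prodL f (xs ++ ys) ≡ prodL f xs * prodL f ys
prodL-++ f []       ys = symm (+-identityʳ _)
prodL-++ f (x ∷ xs) ys = trans (cong (f x *_) (prodL-++ f xs ys)) (symm (*-assoc (f x) _ _))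

prodL-map : {A B : Set} (f : B → ℕ) (g : A → B) (xs : List A) → prodL f (map g xs) ≡ prodL (f ∘ g) xs
prodL-map f g []       = refl
prodL-map f g (x ∷ xs) = cong (f (g x) *_) (prodL-map f g xs)

prodL-const : {A : Set} (c : ℕ) (xs : List A) → prodL (λ _ → c) xs ≡ c ^ length xs
prodL-const c []       = refl
prodL-const c (x ∷ xs) = cong (c *_) (prodL-const c xs)

indicator : Bool → ℕ
indicator b = if b then 1 else 0

module Random (m n M : ℕ) where
  p = Types m n
  E = M * M
  open Sums p

  flipT : Fin p → Fin p
  flipT t = encode (flipC (decode {m} {n} t)) (trans (present-flipC (decode {m} {n} t)) (decode-present {m} {n} t))

  decode-flipT : ∀ t → decode {m} {n} (flipT t) ≡ flipC (decode t)
  decode-flipT t = decode-encode (flipC (decode t)) _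

  -- The unordered pair {w , u} is coded by one coordinate; relative w u t is the entry there
  -- which makes t the type seen from w.
  idx : Fin M → Fin M → Fin E
  idx w u with toℕ w <? toℕ u
  ... | yes _ = combine w u
  ... | no _  = combine u w

  relative : Fin M → Fin M → Fin p → Fin p
  relative w u t with toℕ w <? toℕ u
  ... | yes _ = t
  ... | no _  = flipT t

  idx-pair : ∀ {w u x v} → idx w u ≡ idx x v → (w ≡ x × u ≡ v) ⊎ (w ≡ v × u ≡ x)
  idx-pair {w} {u} {x} {v} e with toℕ w <? toℕ u | toℕ x <? toℕ v
  ... | yes _ | yes _ = inj₁ (Fin.combine-injective w u x v e)
  ... | yes _ | no _  = inj₂ (Fin.combine-injective w u v x e)
  ... | no _  | yes _ = let (a , b) = Fin.combine-injective u w x v e in inj₂ (b , a)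
  ... | no _  | no _  = let (a , b) = Fin.combine-injective u w v x e in inj₁ (b , a)

  connection : Vec (Fin p) E → Fin M → Fin M → Conn m n
  connection X w u with w Fin.≟ u
  ... | yes _ = none
  ... | no _ with toℕ w <? toℕ u
  ...   | yes _ = decode (lookup X (combine w u))
  ...   | no _  = flipC (decode (lookup X (combine u w)))

  connection-loop : ∀ X w → connection X w w ≡ none
  connection-loop X w with w Fin.≟ w
  ... | yes _ = refl
  ... | no ¬p = contradiction refl ¬p

  connection-flip : ∀ X w u → connection X u w ≡ flipC (connection X w u)
  connection-flip X w u with w Fin.≟ u | u Fin.≟ w
  ... | yes _    | yes _    = refl
  ... | yes refl | no ¬p    = contradiction refl ¬p
  ... | no ¬p    | yes refl = contradiction refl ¬p
  ... | no w≢u   | no _ with toℕ w <? toℕ u | toℕ u <? toℕ w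
  ...   | yes a | yes b = contradiction b (<⇒≯ a)
  ...   | yes a | no _  = refl
  ...   | no _  | yes b = symm (flipC-involutive _)
  ...   | no ¬a | no ¬b = contradiction (Fin.toℕ-injective (≤-antisym (≮⇒≥ ¬b) (≮⇒≥ ¬a))) w≢u

  graph : Vec (Fin p) E → MixedGraph m n M
  graph X = record { conn = connection X ; loopless = connection-loop X ; flipped = connection-flip X }

  connection⁺ : ∀ X {w u t} → w ≢ u → lookup X (idx w u) ≡ relative w u t → connection X w u ≡ decode t
  connection⁺ X {w} {u} {t} w≢u e with w Fin.≟ u
  ... | yes w≡u = contradiction w≡u w≢u
  ... | no _ with toℕ w <? toℕ u
  ...   | yes _ = cong decode e
  ...   | no _  = trans (cong (flipC ∘ decode) e)
                    (trans (cong flipC (decode-flipT t)) (flipC-involutive (decode t)))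

  -- A configuration: fixed vertices with prescribed types, probes, and the free rest.
  module Configuration (ℓ : Vec (Label p) M) (t₀ : Fin p) where
    fixeds : List (Fin M × Fin p)
    fixeds = select isFixed ℓ
    frees probes : List (Fin M)
    frees  = map proj₁ (select isFree ℓ)
    probes = map proj₁ (select isProbe ℓ)

    W = length frees
    j = length fixeds
    r = length probes

    row : Fin M → List (Fin E)
    row w = map (λ { (u , _) → idx w u }) fixeds

    row-types : Fin M → List (Fin p)
    row-types w = map (λ { (u , t) → relative w u t }) fixeds

    hit : Vec (Fin p) E → Fin M → Bool
    hit X w = matches (row-types w) (map (lookup X) (row w))

    column : Fin M → List (Fin E)
    column α = map (λ w → idx w α) frees

    column-types : Fin M → List (Fin p)
    column-types α = map (λ w → relative w α t₀) frees

    hits : Vec (Fin p) E → List (Fin M) → List Bool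
    hits X = map (hit X)

    -- A free vertex enters only if it solves the fixed constraints and is joined to `α` by `t₀`;
    -- probes are left out so that the columns stay independent.
    agreeing : Vec (Fin p) E → Fin M → ℕ
    agreeing X α = count (hits X frees) (column-types α) (map (lookup X) (column α))

    free-label : ∀ {w} → w ∈ frees → lookup ℓ w ≡ free
    free-label w∈ with ∈-map⁻ proj₁ w∈
    ... | (w , tt) , q , refl with lookup ℓ w | ∈-select⁻ isFree ℓ q
    ...   | free | _ = refl

    probe-label : ∀ {w} → w ∈ probes → lookup ℓ w ≡ probe
    probe-label w∈ with ∈-map⁻ proj₁ w∈
    ... | (w , tt) , q , refl with lookup ℓ w | ∈-select⁻ isProbe ℓ q
    ...   | probe | _ = refl

    fixed-label : ∀ {u t} → (u , t) ∈ fixeds → lookup ℓ u ≡ fixed t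
    fixed-label {u} q with lookup ℓ u | ∈-select⁻ isFixed ℓ q
    ... | fixed _ | refl = refl

    NotFixed : Fin M → Set
    NotFixed w = ∀ {t} → lookup ℓ w ≢ fixed t

    free-notFixed : ∀ {w} → w ∈ frees → NotFixed w
    free-notFixed w∈ e = case trans (symm (free-label w∈)) e of λ ()

    probe-notFixed : ∀ {w} → w ∈ probes → NotFixed w
    probe-notFixed w∈ e = case trans (symm (probe-label w∈)) e of λ ()

    lookup-ignores : ∀ (cs ds : List (Fin E)) → (∀ {c d} → c ∈ cs → d ∈ ds → c ≢ d) →
                     Ignores cs (λ X → map (lookup X) ds)
    lookup-ignores cs []       dis X t i∈ = refl
    lookup-ignores cs (d ∷ ds) dis X t i∈ =
      cong₂ _∷_ (Vec.lookup∘update′ (dis i∈ (here refl) ∘ symm) X t)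
                (lookup-ignores cs ds (λ c∈ d∈ → dis c∈ (there d∈)) X t i∈)

    ∈-row : ∀ {w c} → c ∈ row w → ∃ λ u → ∃ λ t → c ≡ idx w u × (u , t) ∈ fixeds
    ∈-row c∈ with ∈-map⁻ _ c∈
    ... | (u , t) , q , e = u , t , e , q

    ∈-column : ∀ {α c} → c ∈ column α → ∃ λ w → c ≡ idx w α × w ∈ frees
    ∈-column c∈ with ∈-map⁻ _ c∈
    ... | w , q , e = w , e , q

    -- Rows consist of pairs with a fixed vertex, columns of pairs of a free vertex and a probe.
    -- That no coordinate is shared is the independence behind the whole estimate.
    column-row : ∀ {α w} → α ∈ probes → NotFixed w → ∀ {c d} → c ∈ column α → d ∈ row w → c ≢ d
    column-row {α} {w} α∈ nf c∈ d∈ c≡d with ∈-column {α} c∈ | ∈-row {w} d∈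
    ... | x , e , x∈ | u , t , e' , u∈ with idx-pair {x} {α} {w} {u} (trans (symm e) (trans c≡d e'))
    ...   | inj₁ (_ , refl) = probe-notFixed α∈ (fixed-label u∈)
    ...   | inj₂ (refl , _) = free-notFixed x∈ (fixed-label u∈)

    row-row : ∀ {w w'} → w ≢ w' → NotFixed w → NotFixed w' → ∀ {c d} → c ∈ row w → d ∈ row w' → c ≢ d
    row-row {w} {w'} w≢ nf nf' c∈ d∈ c≡d with ∈-row {w} c∈ | ∈-row {w'} d∈
    ... | u , _ , e , u∈ | v , _ , e' , v∈ with idx-pair {w} {u} {w'} {v} (trans (symm e) (trans c≡d e'))
    ...   | inj₁ (w≡ , _) = w≢ w≡
    ...   | inj₂ (refl , _) = nf (fixed-label v∈)

    column-column : ∀ {α β} → α ≢ β → α ∈ probes → β ∈ probes → ∀ {c d} → c ∈ column α → d ∈ column β → c ≢ d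
    column-column {α} {β} α≢ α∈ β∈ c∈ d∈ c≡d with ∈-column {α} c∈ | ∈-column {β} d∈
    ... | w , e , w∈ | x , e' , x∈ with idx-pair {w} {α} {x} {β} (trans (symm e) (trans c≡d e'))
    ...   | inj₁ (_ , α≡) = α≢ α≡
    ...   | inj₂ (refl , _) = case trans (symm (free-label w∈)) (probe-label β∈) of λ ()

    unique-row : ∀ {w} → NotFixed w → Unique (row w)
    unique-row {w} nf = subst Unique (map-∘ fixeds) (unique-idx (map proj₁ fixeds) sub (unique-select isFixed ℓ))
      where
        map-∘ : ∀ xs → map (idx w) (map proj₁ xs) ≡ map (λ { (u , _) → idx w u }) xs
        map-∘ []       = refl
        map-∘ (_ ∷ xs) = cong (_ ∷_) (map-∘ xs)
        sub : ∀ {u} → u ∈ map proj₁ fixeds → ∃ λ t → lookup ℓ u ≡ fixed t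
        sub u∈ with ∈-map⁻ proj₁ u∈
        ... | (u , t) , q , refl = t , fixed-label q
        unique-idx : ∀ us → (∀ {u} → u ∈ us → ∃ λ t → lookup ℓ u ≡ fixed t) → Unique us → Unique (map (idx w) us)
        unique-idx []       _  []       = []
        unique-idx (u ∷ us) fx (u∉ ∷ q) = All.map⁺ (All.tabulate λ {v} v∈ e → case idx-pair {w} {u} {w} {v} e of λ
            { (inj₁ (_ , refl)) → All.lookup u∉ v∈ refl
            ; (inj₂ (refl , _)) → nf (proj₂ (fx (there v∈))) }) ∷ unique-idx us (fx ∘ there) q

    unique-column : ∀ {α} → α ∈ probes → Unique (column α)
    unique-column {α} α∈ = unique-idx frees free-label (unique-select isFree ℓ)
      where
        unique-idx : ∀ ws → (∀ {w} → w ∈ ws → lookup ℓ w ≡ free) → Unique ws → Unique (map (λ w → idx w α) ws)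
        unique-idx []       _  []       = []
        unique-idx (w ∷ ws) fr (w∉ ∷ q) = All.map⁺ (All.tabulate λ {v} v∈ e → case idx-pair {w} {α} {v} {α} e of λ
            { (inj₁ (refl , _)) → All.lookup w∉ v∈ refl
            ; (inj₂ (refl , _)) → case trans (symm (fr (here refl))) (probe-label α∈) of λ () })
          ∷ unique-idx ws (fr ∘ there) q

    hits-ignore-column : ∀ {α} ws → α ∈ probes → (∀ {w} → w ∈ ws → NotFixed w) →
                         Ignores (column α) (λ X → hits X ws)
    hits-ignore-column []       α∈ nf X t i∈ = refl
    hits-ignore-column (w ∷ ws) α∈ nf X t i∈ = cong₂ _∷_
      (cong (matches (row-types w)) (lookup-ignores _ (row w) (λ {c} {d} → column-row {w = w} α∈ (nf (here refl)) {c} {d}) X t i∈))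
      (hits-ignore-column ws α∈ (nf ∘ there) X t i∈)

    tail-weight : Vec (Fin p) E → ℕ → ℕ
    tail-weight X b = few (trues (hits X frees)) b * p ^ falses (hits X frees)

    -- Once the hits are known the columns of different probes are independent, and each is bad for
    -- `tail-weight` of its p^W words. `B` carries the factors of the probes that are integrated
    -- later.
    integrate-probes : ∀ b αs → Unique αs → (∀ {α} → α ∈ αs → α ∈ probes) → (B : Vec (Fin p) E → ℕ) →
      (∀ {α} → α ∈ αs → Ignores (column α) B) →
      (p ^ W) ^ length αs * ∑V E (λ X → B X * prodL (λ α → indicator (agreeing X α <ᵇ b)) αs)
        ≡ ∑V E (λ X → B X * tail-weight X b ^ length αs)
    integrate-probes b []       _        _  B ig = +-identityʳ _
    integrate-probes b (α ∷ αs) (α∉ ∷ u) pr B ig = begin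
      p ^ W * (p ^ W) ^ k * ∑V E (λ X → B X * (I X * P X))
        ≡⟨ cong₂ _*_ (cong (λ z → p ^ z * (p ^ W) ^ k) (symm len)) (∑V-cong E (λ X → symm (*-assoc (B X) (I X) (P X)))) ⟩
      p ^ W' * (p ^ W) ^ k * ∑V E (λ X → B X * I X * P X)
        ≡⟨ *-assoc (p ^ W') _ _ ⟩
      p ^ W' * ((p ^ W) ^ k * ∑V E (λ X → B X * I X * P X))
        ≡⟨ cong (p ^ W' *_) (integrate-probes b αs u (pr ∘ there) (λ X → B X * I X) ig') ⟩
      p ^ W' * ∑V E (λ X → B X * I X * T X ^ k)
        ≡⟨ integrate E (column α) (unique-column α∈) Ψ igΨ ⟩
      ∑V E (λ X → ∑L W' (λ z → B X * indicator (count (hits X frees) (column-types α) z <ᵇ b) * T X ^ k))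
        ≡⟨ ∑V-cong E (λ X → trans (∑L-cong W' (λ z → solve 3 (λ a i t → a :* i :* t := a :* t :* i) refl (B X) (indicator (count (hits X frees) (column-types α) z <ᵇ b)) (T X ^ k)))
             (trans (∑L-*ˡ W' (B X * T X ^ k) _) (cong (B X * T X ^ k *_) (tail X)))) ⟩
      ∑V E (λ X → B X * T X ^ k * T X)
        ≡⟨ ∑V-cong E (λ X → solve 3 (λ a t s → a :* t :* s := a :* (s :* t)) refl (B X) (T X ^ k) (T X)) ⟩
      ∑V E (λ X → B X * (T X * T X ^ k)) ∎
      where
        open ≡-Reasoning
        open +-*-Solver
        k = length αs
        W' = length (column α)
        len : W' ≡ W
        len = length-map (λ w → idx w α) frees
        α∈ = pr (here refl)
        I = λ X → indicator (agreeing X α <ᵇ b)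
        P = λ X → prodL (λ α → indicator (agreeing X α <ᵇ b)) αs
        T = λ X → tail-weight X b
        Ψ : Vec (Fin p) E → List (Fin p) → ℕ
        Ψ X z = B X * indicator (count (hits X frees) (column-types α) z <ᵇ b) * T X ^ k
        hits-ig : ∀ {β} → β ∈ probes → Ignores (column β) (λ X → hits X frees)
        hits-ig β∈ = hits-ignore-column frees β∈ free-notFixed
        igΨ : ∀ z → Ignores (column α) (λ X → Ψ X z)
        igΨ z X t i∈ = cong₂ (λ a hs → a * indicator (count hs (column-types α) z <ᵇ b) * (few (trues hs) b * p ^ falses hs) ^ k)
                             (ig (here refl) X t i∈) (hits-ig α∈ X t i∈)
        ig' : ∀ {β} → β ∈ αs → Ignores (column β) (λ X → B X * I X)
        ig' {β} β∈ X t i∈ = cong₂ _*_ (ig (there β∈) X t i∈)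
          (cong₂ (λ hs z → indicator (count hs (column-types α) z <ᵇ b)) (hits-ig (pr (there β∈)) X t i∈)
                 (lookup-ignores _ (column α) (column-column (λ { refl → All.lookup α∉ β∈ refl }) (pr (there β∈)) α∈) X t i∈))
        len-types : ∀ X → length (hits X frees) ≡ length (column-types α)
        len-types X = trans (length-map (hit X) frees) (symm (length-map (λ w → relative w α t₀) frees))
        tail : ∀ X → ∑L W' (λ z → indicator (count (hits X frees) (column-types α) z <ᵇ b)) ≡ T X
        tail X = trans (cong (λ w → ∑L w (λ z → indicator (count (hits X frees) (column-types α) z <ᵇ b)))
                   (trans len (symm (length-map (λ w → relative w α t₀) frees))))
                   (∑L-count (hits X frees) (column-types α) b (len-types X))

    weigh : Vec (Fin p) E → Fin M × ℕ × ℕ → ℕ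
    weigh X (w , U , D) = if hit X w then U else D

    row-sum : ℕ → ℕ → ℕ
    row-sum U D = (p ^ j ∸ 1) * D + U

    -- Rows of different vertices are disjoint, and of the p^j possible rows exactly one is a hit;
    -- so each vertex contributes `row-sum` independently.
    integrate-rows : (ws : List (Fin M × ℕ × ℕ)) → Unique (map proj₁ ws) → (∀ {w} → w ∈ map proj₁ ws → NotFixed w) →
      (p ^ j) ^ length ws * ∑V E (λ X → prodL (weigh X) ws) ≡ p ^ E * prodL (λ { (_ , U , D) → row-sum U D }) ws
    integrate-rows [] _ _ = trans (+-identityʳ _) (∑V-const E 1)
    integrate-rows ((w , U , D) ∷ ws) (w∉ ∷ u) nf = begin
      p ^ j * (p ^ j) ^ k * ∑V E (λ X → weigh X (w , U , D) * P X)
        ≡⟨ cong (λ z → p ^ z * (p ^ j) ^ k * ∑V E (λ X → weigh X (w , U , D) * P X)) (symm len) ⟩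
      p ^ j' * (p ^ j) ^ k * ∑V E (λ X → weigh X (w , U , D) * P X)
        ≡⟨ solve 3 (λ a b c → a :* b :* c := b :* (a :* c)) refl (p ^ j') ((p ^ j) ^ k) (∑V E (λ X → weigh X (w , U , D) * P X)) ⟩
      (p ^ j) ^ k * (p ^ j' * ∑V E (λ X → weigh X (w , U , D) * P X))
        ≡⟨ cong ((p ^ j) ^ k *_) (integrate E (row w) (unique-row (nf (here refl))) Ψ igΨ) ⟩
      (p ^ j) ^ k * ∑V E (λ X → ∑L j' (λ z → (if matches (row-types w) z then U else D) * P X))
        ≡⟨ cong ((p ^ j) ^ k *_) (∑V-cong E (λ X → trans (∑L-cong j' (λ z → *-comm _ (P X))) (trans (∑L-*ˡ j' (P X) _)
             (trans (*-comm (P X) _) (cong (_* P X) sum-row))))) ⟩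
      (p ^ j) ^ k * ∑V E (λ X → row-sum U D * P X)
        ≡⟨ cong ((p ^ j) ^ k *_) (∑V-*ˡ E (row-sum U D) P) ⟩
      (p ^ j) ^ k * (row-sum U D * ∑V E P)
        ≡⟨ solve 3 (λ a b c → a :* (b :* c) := b :* (a :* c)) refl ((p ^ j) ^ k) (row-sum U D) (∑V E P) ⟩
      row-sum U D * ((p ^ j) ^ k * ∑V E P)
        ≡⟨ cong (row-sum U D *_) (integrate-rows ws u (nf ∘ there)) ⟩
      row-sum U D * (p ^ E * prodL (λ { (_ , U , D) → row-sum U D }) ws)
        ≡⟨ solve 3 (λ a b c → a :* (b :* c) := b :* (a :* c)) refl (row-sum U D) (p ^ E) (prodL (λ { (_ , U , D) → row-sum U D }) ws) ⟩
      p ^ E * (row-sum U D * prodL (λ { (_ , U , D) → row-sum U D }) ws) ∎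
      where
        open ≡-Reasoning
        open +-*-Solver
        k = length ws
        P = λ X → prodL (weigh X) ws
        j' = length (row w)
        len : j' ≡ j
        len = length-map _ fixeds
        Ψ : Vec (Fin p) E → List (Fin p) → ℕ
        Ψ X z = (if matches (row-types w) z then U else D) * P X
        igΨ : ∀ z → Ignores (row w) (λ X → Ψ X z)
        igΨ z X t i∈ = cong ((if matches (row-types w) z then U else D) *_)
          (prodL-cong ws λ { {x , U' , D'} x∈ → cong (λ h → if h then U' else D')
            (cong (matches (row-types x)) (lookup-ignores _ (row x)
              (row-row (λ { refl → All.lookup w∉ (∈-map⁺ proj₁ x∈) refl }) (nf (here refl)) (nf (there (∈-map⁺ proj₁ x∈)))) X t i∈)) })
        1≤p^j : 1 ≤ p ^ j
        1≤p^j = pos fixeds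
          where
            pos : (xs : List (Fin M × Fin p)) → 1 ≤ p ^ length xs
            pos []            = ≤-refl
            pos ((_ , t) ∷ xs) = *-mono-≤ (nonempty t) (pos xs)
              where
                nonempty : ∀ {k} → Fin k → 1 ≤ k
                nonempty {suc k} _ = s≤s z≤n
        sum-row : ∑L j' (λ z → if matches (row-types w) z then U else D) ≡ row-sum U D
        sum-row = +-cancelʳ-≡ D _ _ (begin
          ∑L j' (λ z → if matches (row-types w) z then U else D) + D
            ≡⟨ cong (λ k → ∑L k (λ z → if matches (row-types w) z then U else D) + D) (trans len (symm (length-map _ fixeds))) ⟩
          ∑L (length (row-types w)) (λ z → if matches (row-types w) z then U else D) + D
            ≡⟨ ∑L-matches (row-types w) U D ⟩
          p ^ length (row-types w) * D + U
            ≡⟨ cong (λ k → p ^ k * D + U) (length-map _ fixeds) ⟩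
          p ^ j * D + U ≡⟨ cong (λ z → z * D + U) (m∸n+n≡m 1≤p^j) ⟨
          (p ^ j ∸ 1 + 1) * D + U ≡⟨ solve 3 (λ q d u → (q :+ con 1) :* d :+ u := q :* d :+ u :+ d) refl (p ^ j ∸ 1) D U ⟩
          (p ^ j ∸ 1) * D + U + D ∎)

    prodL-hits : ∀ X U D ws → prodL (λ w → if hit X w then U else D) ws ≡ U ^ trues (hits X ws) * D ^ falses (hits X ws)
    prodL-hits X U D []       = refl
    prodL-hits X U D (w ∷ ws) with hit X w
    ... | true  = trans (cong (U *_) (prodL-hits X U D ws)) (symm (*-assoc U _ _))
    ... | false = trans (cong (D *_) (prodL-hits X U D ws))
                    (solve 3 (λ d a b → d :* (a :* b) := a :* (d :* b)) refl D (U ^ trues (hits X ws)) (D ^ falses (hits X ws)))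
      where open +-*-Solver

    trues+falses : ∀ hs → trues hs + falses hs ≡ length hs
    trues+falses []           = refl
    trues+falses (true ∷ hs)  = cong suc (trues+falses hs)
    trues+falses (false ∷ hs) = trans (+-suc (trues hs) _) (cong suc (trues+falses hs))

    event : (ℕ → ℕ → Bool) → ℕ → Vec (Fin p) E → ℕ
    event good b X = indicator (good (trues (hits X frees)) (trues (hits X probes)))
                     * prodL (λ α → indicator (agreeing X α <ᵇ b)) probes

    -- A Chernoff bound: on the event, the product of the weights of the vertices is at least θ / C.
    expectation : ∀ good b θ C U D U' D' →
      (∀ h f a a' → good h a ≡ true → h + f ≡ W → a + a' ≡ r →
         θ * (few h b * p ^ f) ^ r ≤ C * ((U ^ h * D ^ f) * (U' ^ a * D' ^ a'))) →
      (p ^ W) ^ r * (p ^ j) ^ (W + r) * (θ * ∑V E (event good b))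
        ≤ C * (p ^ E * (row-sum U D ^ W * row-sum U' D' ^ r))
    expectation good b θ C U D U' D' hyp = begin
      (p ^ W) ^ r * Q * (θ * ∑V E (event good b))
        ≡⟨ solve 4 (λ a q t s → a :* q :* (t :* s) := q :* (t :* (a :* s))) refl ((p ^ W) ^ r) Q θ (∑V E (event good b)) ⟩
      Q * (θ * ((p ^ W) ^ r * ∑V E (event good b)))
        ≡⟨ cong (λ z → Q * (θ * z)) (integrate-probes b probes (unique-select isProbe ℓ) id G igG) ⟩
      Q * (θ * ∑V E (λ X → G X * tail-weight X b ^ r))
        ≡⟨ cong (Q *_) (∑V-*ˡ E θ _) ⟨
      Q * ∑V E (λ X → θ * (G X * tail-weight X b ^ r))
        ≤⟨ *-monoʳ-≤ Q (∑V-mono E pointwise) ⟩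
      Q * ∑V E (λ X → C * prodL (weigh X) ws)
        ≡⟨ cong (Q *_) (∑V-*ˡ E C _) ⟩
      Q * (C * ∑V E (λ X → prodL (weigh X) ws))
        ≡⟨ solve 3 (λ q c s → q :* (c :* s) := c :* (q :* s)) refl Q C (∑V E (λ X → prodL (weigh X) ws)) ⟩
      C * (Q * ∑V E (λ X → prodL (weigh X) ws))
        ≡⟨ cong (λ z → C * ((p ^ j) ^ z * ∑V E (λ X → prodL (weigh X) ws))) len-ws ⟨
      C * ((p ^ j) ^ length ws * ∑V E (λ X → prodL (weigh X) ws))
        ≡⟨ cong (C *_) (integrate-rows ws unique-ws nf) ⟩
      C * (p ^ E * prodL (λ { (_ , U , D) → row-sum U D }) ws)
        ≡⟨ cong (λ z → C * (p ^ E * z)) (trans (prodL-++ _ (map tag frees) (map tag' probes))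
             (cong₂ _*_ (trans (prodL-map _ tag frees) (prodL-const (row-sum U D) frees))
                        (trans (prodL-map _ tag' probes) (prodL-const (row-sum U' D') probes)))) ⟩
      C * (p ^ E * (row-sum U D ^ W * row-sum U' D' ^ r)) ∎
      where
        open ≤-Reasoning
        open +-*-Solver
        Q = (p ^ j) ^ (W + r)
        G = λ X → indicator (good (trues (hits X frees)) (trues (hits X probes)))
        tag tag' : Fin M → Fin M × ℕ × ℕ
        tag  w = w , U , D
        tag' w = w , U' , D'
        ws = map tag frees ++ map tag' probes
        len-ws : length ws ≡ W + r
        len-ws = trans (length-++ (map tag frees)) (cong₂ _+_ (length-map tag frees) (length-map tag' probes))
        untag : ∀ xs ys → map proj₁ (map tag xs ++ map tag' ys) ≡ xs ++ ys
        untag (x ∷ xs) ys       = cong (x ∷_) (untag xs ys)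
        untag []       (y ∷ ys) = cong (y ∷_) (untag [] ys)
        untag []       []       = refl
        unique-ws : Unique (map proj₁ ws)
        unique-ws = subst Unique (symm (untag frees probes))
          (Unique.++⁺ (unique-select isFree ℓ) (unique-select isProbe ℓ)
            (λ { (a , b) → case trans (symm (free-label a)) (probe-label b) of λ () }))
        nf : ∀ {w} → w ∈ map proj₁ ws → NotFixed w
        nf w∈ with ∈-++⁻ frees (subst (_ ∈_) (untag frees probes) w∈)
        ... | inj₁ q = free-notFixed q
        ... | inj₂ q = probe-notFixed q
        igG : ∀ {α} → α ∈ probes → Ignores (column α) G
        igG α∈ X t i∈ = cong₂ (λ hs hs' → indicator (good (trues hs) (trues hs')))
          (hits-ignore-column frees α∈ free-notFixed X t i∈)
          (hits-ignore-column probes α∈ probe-notFixed X t i∈)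
        pointwise : ∀ X → θ * (G X * tail-weight X b ^ r) ≤ C * prodL (weigh X) ws
        pointwise X with good (trues (hits X frees)) (trues (hits X probes)) in eq
        ... | false = ≤-trans (≤-reflexive (*-zeroʳ θ)) z≤n
        ... | true  = begin
            θ * (tail-weight X b ^ r + 0) ≡⟨ cong (θ *_) (+-identityʳ _) ⟩
            θ * tail-weight X b ^ r
              ≤⟨ hyp (trues (hits X frees)) (falses (hits X frees)) (trues (hits X probes)) (falses (hits X probes)) eq
                   (trans (trues+falses (hits X frees)) (length-map (hit X) frees))
                   (trans (trues+falses (hits X probes)) (length-map (hit X) probes)) ⟩
            C * (U ^ trues (hits X frees) * D ^ falses (hits X frees) * (U' ^ trues (hits X probes) * D' ^ falses (hits X probes)))
              ≡⟨ cong (C *_) (cong₂ _*_ (prodL-hits X U D frees) (prodL-hits X U' D' probes)) ⟨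
            C * (prodL (λ w → if hit X w then U else D) frees * prodL (λ w → if hit X w then U' else D') probes)
              ≡⟨ cong (C *_) (cong₂ _*_ (prodL-map (weigh X) tag frees) (prodL-map (weigh X) tag' probes)) ⟨
            C * (prodL (weigh X) (map tag frees) * prodL (weigh X) (map tag' probes))
              ≡⟨ cong (C *_) (prodL-++ (weigh X) (map tag frees) (map tag' probes)) ⟨
            C * prodL (weigh X) ws ∎

-- The union bound.

∑Lab-zero : ∀ {p M} (ℓ : Vec (Label p) M) F {j r} → selected isFixed ℓ ≡ j → selected isProbe ℓ ≡ r →
            ∑Lab M j r F ≡ 0 → F ℓ ≡ 0
∑Lab-zero ℓ F refl refl e = n≤0⇒n≡0 (subst (F ℓ ≤_) e (≤-∑Lab ℓ F))

<ᵇ-true : ∀ {a b} → a < b → (a <ᵇ b) ≡ true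
<ᵇ-true {a} {b} lt with a <ᵇ b | <⇒<ᵇ lt
... | true | _ = refl

module Existence (m n M base : ℕ) where
  open Random m n M
  open Sums p

  -- A class of bad configurations with a certificate that their expected number is at most `φ` /
  -- `base`. `k` is the number of types tried between probes and solutions, `weights` is the
  -- pointwise hypothesis of the Chernoff bound, and `rare` multiplies its conclusion by the number
  -- of configurations, with all denominators cleared.
  record Family : Set where
    field
      j r b k          : ℕ
      good             : ℕ → ℕ → Bool
      τ                : Fin k → Fin p
      θ C U D U' D' φ  : ℕ
    W = M ∸ (j + r)
    rows : ℕ → ℕ → ℕ
    rows U D = (p ^ j ∸ 1) * D + U
    normaliser = (p ^ W) ^ r * (p ^ j) ^ (W + r) * θ
    field
      weights : ∀ h f a a' → good h a ≡ true → h + f ≡ W → a + a' ≡ r →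
                θ * (few h b * p ^ f) ^ r ≤ C * ((U ^ h * D ^ f) * (U' ^ a * D' ^ a'))
      positive : 0 < normaliser
      rare    : k * (p ^ j * M ^ (j + r)) * (C * (rows U D ^ W * rows U' D' ^ r)) * base
                ≤ φ * ((j ! * r !) * normaliser)

    total : Vec (Fin p) E → ℕ
    total X = ∑ k (λ i → ∑Lab M j r (λ ℓ → Configuration.event ℓ (τ i) good b X))

    event-bound : ∀ ℓ t → selected isFixed ℓ ≡ j → selected isProbe ℓ ≡ r →
      normaliser * ∑V E (Configuration.event ℓ t good b) ≤ C * (p ^ E * (rows U D ^ W * rows U' D' ^ r))
    event-bound ℓ t ej er = subst₂ _≤_ lhs rhs (expectation good b θ C U D U' D'
        (λ h f a a' g e e' → subst (λ z → θ * (few h b * p ^ f) ^ z ≤ C * ((U ^ h * D ^ f) * (U' ^ a * D' ^ a'))) (symm r≡)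
          (weights h f a a' g (trans e W≡) (trans e' r≡))))
      where
        open Configuration ℓ t using (expectation; frees; probes; fixeds; row-sum)
        r≡ : length probes ≡ r
        r≡ = trans (length-map proj₁ (select isProbe ℓ)) (trans (length-select isProbe ℓ) er)
        j≡ : length fixeds ≡ j
        j≡ = trans (length-select isFixed ℓ) ej
        W≡ : length frees ≡ W
        W≡ = trans (length-map proj₁ (select isFree ℓ)) (trans (length-select isFree ℓ)
              (trans (symm (m+n∸n≡m (selected isFree ℓ) (j + r)))
                (cong (_∸ (j + r)) (trans (cong₂ (λ x y → selected isFree ℓ + (x + y)) (symm ej) (symm er)) (label-count ℓ)))))
        I = ∑V E (Configuration.event ℓ t good b)
        lhs : (p ^ length frees) ^ length probes * (p ^ length fixeds) ^ (length frees + length probes) * (θ * I) ≡ normaliser * I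
        lhs rewrite r≡ | j≡ | W≡ = symm (*-assoc ((p ^ W) ^ r * (p ^ j) ^ (W + r)) θ I)
        rhs : C * (p ^ E * (row-sum U D ^ length frees * row-sum U' D' ^ length probes)) ≡ C * (p ^ E * (rows U D ^ W * rows U' D' ^ r))
        rhs rewrite r≡ | j≡ | W≡ = refl

    total-bound : base * ∑V E total ≤ φ * p ^ E
    total-bound = *-cancelˡ-≤ Z (begin
      Z * (base * ∑V E total)
        ≡⟨ solve 4 (λ f n s o → f :* n :* (o :* s) := f :* (n :* s) :* o) refl (j ! * r !) normaliser (∑V E total) base ⟩
      (j ! * r !) * (normaliser * ∑V E total) * base
        ≡⟨ cong (λ z → (j ! * r !) * (normaliser * z) * base)
             (trans (∑V-∑ E k _) (∑-cong k (λ i → ∑V-∑Lab E M j r (λ ℓ → Configuration.event ℓ (τ i) good b)))) ⟩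
      (j ! * r !) * (normaliser * ∑ k (λ i → ∑Lab M j r (λ ℓ → ∑V E (Configuration.event ℓ (τ i) good b)))) * base
        ≡⟨ cong (λ z → (j ! * r !) * z * base) (trans (symm (∑-*ˡ k normaliser _))
             (∑-cong k (λ i → ∑Lab-*ˡ normaliser M j r (λ ℓ → ∑V E (Configuration.event ℓ (τ i) good b))))) ⟩
      (j ! * r !) * ∑ k (λ i → ∑Lab M j r (λ ℓ → normaliser * ∑V E (Configuration.event ℓ (τ i) good b))) * base
        ≤⟨ *-monoˡ-≤ base (*-monoʳ-≤ (j ! * r !) (∑-mono k (λ i → ∑Lab-bound M j r _ B (λ ℓ → event-bound ℓ (τ i))))) ⟩
      (j ! * r !) * ∑ k (λ i → labellings {p} M j r * B) * base
        ≡⟨ cong (λ z → (j ! * r !) * z * base) (∑-const k (labellings {p} M j r * B)) ⟩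
      (j ! * r !) * (k * (labellings {p} M j r * B)) * base
        ≡⟨ solve 5 (λ f k l b o → f :* (k :* (l :* b)) :* o := k :* (l :* f) :* b :* o) refl (j ! * r !) k (labellings {p} M j r) B base ⟩
      k * (labellings {p} M j r * (j ! * r !)) * B * base
        ≤⟨ *-monoˡ-≤ base (*-monoˡ-≤ B (*-monoʳ-≤ k (labellings-bound M j r))) ⟩
      k * (p ^ j * M ^ (j + r)) * (C * (p ^ E * R)) * base
        ≡⟨ solve 5 (λ a c e r o → a :* (c :* (e :* r)) :* o := a :* (c :* r) :* o :* e) refl (k * (p ^ j * M ^ (j + r))) C (p ^ E) R base ⟩
      k * (p ^ j * M ^ (j + r)) * (C * R) * base * p ^ E
        ≤⟨ *-monoˡ-≤ (p ^ E) rare ⟩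
      φ * Z * p ^ E
        ≡⟨ solve 3 (λ a z e → a :* z :* e := z :* (a :* e)) refl φ Z (p ^ E) ⟩
      Z * (φ * p ^ E) ∎)
      where
        open ≤-Reasoning
        open +-*-Solver
        Z = (j ! * r !) * normaliser
        R = rows U D ^ W * rows U' D' ^ r
        B = C * (p ^ E * R)
        instance
          Z≢0 : NonZero Z
          Z≢0 = m*n≢0 (j ! * r !) normaliser {{m*n≢0 (j !) (r !) {{j !≢0}} {{r !≢0}}}} {{>-nonZero positive}}
        ∑Lab-*ˡ : ∀ c M j r (F : Vec (Label p) M → ℕ) → c * ∑Lab M j r F ≡ ∑Lab M j r (λ ℓ → c * F ℓ)
        ∑Lab-*ˡ c zero zero zero    F = refl
        ∑Lab-*ˡ c zero zero (suc r) F = *-zeroʳ c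
        ∑Lab-*ˡ c zero (suc j) r    F = *-zeroʳ c
        ∑Lab-*ˡ c (suc M) j r F = trans (*-distribˡ-+ c (∑Lab M j r (λ ℓ → F (free ∷ ℓ))) _) (cong₂ _+_ (∑Lab-*ˡ c M j r _)
            (trans (*-distribˡ-+ c (∑fixed M j r F) _) (cong₂ _+_ (fixed≡ j) (probe≡ r))))
          where
            fixed≡ : ∀ j → c * ∑fixed M j r F ≡ ∑fixed M j r (λ ℓ → c * F ℓ)
            fixed≡ zero    = *-zeroʳ c
            fixed≡ (suc j) = trans (symm (∑-*ˡ p c _)) (∑-cong p (λ t → ∑Lab-*ˡ c M j r _))
            probe≡ : ∀ r → c * ∑probe M j r F ≡ ∑probe M j r (λ ℓ → c * F ℓ)
            probe≡ zero    = *-zeroʳ c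
            probe≡ (suc r) = ∑Lab-*ˡ c M j r _

  open Family

  Avoids : Vec (Fin p) E → Family → Set
  Avoids X f = ∀ i ℓ → selected isFixed ℓ ≡ j f → selected isProbe ℓ ≡ r f →
               Configuration.event ℓ (τ f i) (good f) (b f) X ≡ 0

  share : List Family → ℕ
  share []       = 0
  share (f ∷ fs) = φ f + share fs

  private
    totals : List Family → Vec (Fin p) E → ℕ
    totals []       X = 0
    -- Each bad configuration weighs `base`, so a total below `base` means that there is none.
    totals (f ∷ fs) X = base * total f X + totals fs X

    totals-bound : ∀ fs → ∑V E (totals fs) ≤ share fs * p ^ E
    totals-bound []       = ≤-reflexive (trans (∑V-const E 0) (*-zeroʳ (p ^ E)))
    totals-bound (f ∷ fs) = ≤-trans (≤-reflexive (trans (∑V-+ E _ _) (cong (_+ ∑V E (totals fs)) (∑V-*ˡ E base (total f)))))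
      (≤-trans (+-mono-≤ (total-bound f) (totals-bound fs)) (≤-reflexive (symm (*-distribʳ-+ (p ^ E) (φ f) (share fs)))))

    ∑-zero : ∀ k (f : Fin k → ℕ) → ∑ k f ≡ 0 → ∀ i → f i ≡ 0
    ∑-zero k f e i = n≤0⇒n≡0 (subst (f i ≤_) e (≤-∑ k f i))

    total-zero : ∀ f X → total f X ≡ 0 → Avoids X f
    total-zero f X e i ℓ ej er = ∑Lab-zero ℓ (λ ℓ → Configuration.event ℓ (τ f i) (good f) (b f) X) ej er (∑-zero (k f) _ e i)

    totals-zero : ∀ fs X → totals fs X < base → All (Avoids X) fs
    totals-zero []       X lt = []
    totals-zero (f ∷ fs) X lt = total-zero f X zero-total ∷ totals-zero fs X (≤-<-trans (m≤n+m _ (base * total f X)) lt)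
      where
        zero-total : total f X ≡ 0
        zero-total with total f X
        ... | zero  = refl
        ... | suc t = contradiction lt (≤⇒≯ (≤-trans (m≤m*n base (suc t)) (m≤m+n (base * suc t) (totals fs X))))

  -- First moment method: the expected number of bad configurations is at most `share fs` / `base`,
  -- which is below 1.
  exists : 0 < p → ∀ fs → share fs < base → ∃ λ X → All (Avoids X) fs
  exists 0<p fs lt with ∑V-<⇒∃ E base (totals fs) (≤-<-trans (totals-bound fs)
         (<-≤-trans (*-monoˡ-< (p ^ E) {{m^n≢0 p E {{>-nonZero 0<p}}}} lt) (≤-reflexive (*-comm base (p ^ E)))))
  ... | X , q = X , totals-zero fs X q

-- From excluded configurations to a random target.

module Candidates (m n M : ℕ) where
  open Random m n M
  open Sums p
  open DecMembership (Fin._≟_ {M}) using (_∈?_)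

  Typed : Set
  Typed = List (Fin M × Fin p)

  images : Typed → List (Fin M)
  images = map proj₁

  Fits : Vec (Fin p) E → Typed → Fin M → Set
  Fits X L w = All (λ { (u , t) → w ≢ u × lookup X (idx w u) ≡ relative w u t }) L

  fits? : ∀ X L w → Dec (Fits X L w)
  fits? X L w = All.all? (λ { (u , t) → ¬? (w Fin.≟ u) ×-dec (lookup X (idx w u) Fin.≟ relative w u t) }) L

  candidates : Vec (Fin p) E → Typed → List (Fin M)
  candidates X L = filter (fits? X L) (allFin M)

  find-type : Typed → Fin M → Maybe (Fin p)
  find-type []            w = nothing
  find-type ((u , t) ∷ L) w with w Fin.≟ u
  ... | yes _ = just t
  ... | no _  = find-type L w

  find-type⁺ : ∀ L {u t} → Unique (images L) → (u , t) ∈ L → find-type L u ≡ just t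
  find-type⁺ ((v , _) ∷ L) {u} (v∉ ∷ q) (here refl) with u Fin.≟ u
  ... | yes _ = refl
  ... | no ¬e = contradiction refl ¬e
  find-type⁺ ((v , _) ∷ L) {u} (v∉ ∷ q) (there p) with u Fin.≟ v
  ... | yes refl = contradiction refl (All.lookup v∉ (∈-map⁺ proj₁ p))
  ... | no _     = find-type⁺ L q p

  find-type⁻ : ∀ L {u t} → find-type L u ≡ just t → (u , t) ∈ L
  find-type⁻ ((v , _) ∷ L) {u} e with u Fin.≟ v
  find-type⁻ ((v , _) ∷ L) {u} refl | yes refl = here refl
  find-type⁻ ((v , _) ∷ L) {u} e    | no _ = there (find-type⁻ L e)

  find-type-∉ : ∀ L {u} → u ∉ images L → find-type L u ≡ nothing
  find-type-∉ []            u∉ = refl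
  find-type-∉ ((v , _) ∷ L) {u} u∉ with u Fin.≟ v
  ... | yes refl = contradiction (here refl) u∉
  ... | no _     = find-type-∉ L (u∉ ∘ there)

  module Labelling (L : Typed) (αs : List (Fin M)) (uniq : Unique (images L)) (uniqα : Unique αs)
                   (disjoint : ∀ {α} → α ∈ αs → α ∉ images L) where

    other : Fin M → Label p
    other w with w ∈? αs
    ... | yes _ = probe
    ... | no _  = free

    label : Fin M → Label p
    label w with find-type L w
    ... | just t  = fixed t
    ... | nothing = other w

    ℓ : Vec (Label p) M
    ℓ = tabulate label

    label-fixed : ∀ {u t} → (u , t) ∈ L → lookup ℓ u ≡ fixed t
    label-fixed {u} u∈ = trans (Vec.lookup∘tabulate label u) lemma
      where
        lemma : label u ≡ fixed _
        lemma rewrite find-type⁺ L uniq u∈ = refl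

    label-other : ∀ {w} → w ∉ images L → lookup ℓ w ≡ other w
    label-other {w} w∉ = trans (Vec.lookup∘tabulate label w) lemma
      where
        lemma : label w ≡ other w
        lemma rewrite find-type-∉ L w∉ = refl

    label-probe : ∀ {α} → α ∈ αs → lookup ℓ α ≡ probe
    label-probe {α} α∈ = trans (label-other (disjoint α∈)) lemma
      where
        lemma : other α ≡ probe
        lemma with α ∈? αs
        ... | yes _ = refl
        ... | no ¬p = contradiction α∈ ¬p

    fixed-inv : ∀ {u t} → lookup ℓ u ≡ fixed t → (u , t) ∈ L
    fixed-inv {u} e = lemma (trans (symm (Vec.lookup∘tabulate label u)) e)
      where
        lemma : ∀ {t} → label u ≡ fixed t → (u , t) ∈ L
        lemma e with find-type L u in eq
        lemma refl | just _ = find-type⁻ L eq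
        lemma e    | nothing with u ∈? αs
        lemma ()   | nothing | yes _
        lemma ()   | nothing | no _

    probe-inv : ∀ {u} → lookup ℓ u ≡ probe → u ∈ αs
    probe-inv {u} e = lemma (trans (symm (Vec.lookup∘tabulate label u)) e)
      where
        lemma : label u ≡ probe → u ∈ αs
        lemma e with find-type L u
        lemma ()   | just _
        lemma e    | nothing with u ∈? αs
        lemma e    | nothing | yes q = q
        lemma ()   | nothing | no _

    module C (t₀ : Fin p) where
      open Configuration ℓ t₀ public

      fixeds⇔ : ∀ {u t} → (u , t) ∈ L → (u , t) ∈ fixeds
      fixeds⇔ {u} q = ∈-select⁺ isFixed ℓ u (cong isFixed (label-fixed q))

      count-fixed : selected isFixed ℓ ≡ length L
      count-fixed = trans (symm (length-select isFixed ℓ)) (subst₂ _≡_ (length-map proj₁ fixeds) (length-map proj₁ L)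
        (≤-antisym (unique-⊆⇒length≤ _ _ (unique-select isFixed ℓ) to) (unique-⊆⇒length≤ _ _ uniq from)))
        where
          to : ∀ {u} → u ∈ map proj₁ fixeds → u ∈ images L
          to u∈ with ∈-map⁻ proj₁ u∈
          ... | (u , t) , q , refl = ∈-map⁺ proj₁ (fixed-inv (fixed-label q))
          from : ∀ {u} → u ∈ images L → u ∈ map proj₁ fixeds
          from u∈ with ∈-map⁻ proj₁ u∈
          ... | (u , t) , q , refl = ∈-map⁺ proj₁ (fixeds⇔ q)

      ∈-probes : ∀ {α} → α ∈ αs → α ∈ probes
      ∈-probes {α} q = ∈-map⁺ proj₁ (∈-select⁺ isProbe ℓ α (cong isProbe (label-probe q)))

      count-probe : selected isProbe ℓ ≡ length αs
      count-probe = trans (symm (length-select isProbe ℓ)) (trans (symm (length-map proj₁ (select isProbe ℓ)))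
        (≤-antisym (unique-⊆⇒length≤ _ _ (unique-select isProbe ℓ) (probe-inv ∘ probe-label))
                   (unique-⊆⇒length≤ _ _ uniqα ∈-probes)))

      free-∉ : ∀ {w} → NotFixed w → w ∉ images L
      free-∉ nf w∈ with ∈-map⁻ proj₁ w∈
      ... | (u , t) , q , refl = nf (label-fixed q)

      hit⇒fits : ∀ X {w} → NotFixed w → hit X w ≡ true → Fits X L w
      hit⇒fits X {w} nf e = All.tabulate λ { {u , t} q →
          (λ { refl → free-∉ nf (∈-map⁺ proj₁ q) }) , all fixeds e (fixeds⇔ q) }
        where
          all : ∀ fx → matches (map (λ { (u , t) → relative w u t }) fx) (map (lookup X) (map (λ { (u , _) → idx w u }) fx)) ≡ true →
                ∀ {u t} → (u , t) ∈ fx → lookup X (idx w u) ≡ relative w u t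
          all ((v , s) ∷ fx) e q with lookup X (idx w v) Fin.≟ relative w v s
          all ((v , s) ∷ fx) e (here refl) | yes a = a
          all ((v , s) ∷ fx) e (there q)   | yes a = all fx e q
          all ((v , s) ∷ fx) () q          | no _

      fits⇒hit : ∀ X {w} → Fits X L w → hit X w ≡ true
      fits⇒hit X {w} fit = all fixeds (λ q → proj₂ (All.lookup fit (fixed-inv (fixed-label q))))
        where
          all : ∀ fx → (∀ {u t} → (u , t) ∈ fx → lookup X (idx w u) ≡ relative w u t) →
                matches (map (λ { (u , t) → relative w u t }) fx) (map (lookup X) (map (λ { (u , _) → idx w u }) fx)) ≡ true
          all []             h = refl
          all ((v , s) ∷ fx) h with lookup X (idx w v) Fin.≟ relative w v s
          ... | yes _ = all fx (h ∘ there)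
          ... | no ¬a = contradiction (h (here refl)) ¬a

      hit? : ∀ X w → Dec (hit X w ≡ true)
      hit? X w = hit X w Bool.≟ true

      trues-filter : ∀ X ws → length (filter (hit? X) ws) ≡ trues (hits X ws)
      trues-filter X []       = refl
      trues-filter X (w ∷ ws) with hit X w
      ... | true  = cong suc (trues-filter X ws)
      ... | false = trues-filter X ws

      few-hits⇒ : ∀ X → trues (hits X frees) ≤ length (candidates X L)
      few-hits⇒ X = subst (_≤ length (candidates X L)) (trues-filter X frees)
        (unique-⊆⇒length≤ _ _ (Unique.filter⁺ (hit? X) (unique-select isFree ℓ)) λ {w} w∈ →
          let (w∈' , e) = ∈-filter⁻ (hit? X) {xs = frees} w∈ in
          ∈-filter⁺ (fits? X L) (∈-allFin w) (hit⇒fits X (free-notFixed w∈') e))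

      -- A probe may itself be a solution, so hits among the probes have to be added; a fixed vertex
      -- cannot be, since it is not joined to itself. This is why the conditions `good` look at both
      -- counts.
      many-hits⇒ : ∀ X → length (candidates X L) ≤ trues (hits X frees) + trues (hits X probes)
      many-hits⇒ X = subst (length (candidates X L) ≤_)
        (trans (length-++ (filter (hit? X) frees)) (cong₂ _+_ (trues-filter X frees) (trues-filter X probes)))
        (unique-⊆⇒length≤ _ _ (Unique.filter⁺ (fits? X L) (Unique.allFin⁺ M)) λ {w} w∈ →
          place w (proj₂ (∈-filter⁻ (fits? X L) {xs = allFin M} w∈)))
        where
          place : ∀ w → Fits X L w → w ∈ filter (hit? X) frees ++ filter (hit? X) probes
          place w fit with lookup ℓ w in eq
          ... | free    = ∈-++⁺ˡ (∈-filter⁺ (hit? X) (∈-map⁺ proj₁ (∈-select⁺ isFree ℓ w (cong isFree eq))) (fits⇒hit X fit))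
          ... | probe   = ∈-++⁺ʳ (filter (hit? X) frees) (∈-filter⁺ (hit? X) (∈-map⁺ proj₁ (∈-select⁺ isProbe ℓ w (cong isProbe eq))) (fits⇒hit X fit))
          ... | fixed t = contradiction refl (proj₁ (All.lookup fit (fixed-inv eq)))

      Agrees : Vec (Fin p) E → Fin M → Fin M → Set
      Agrees X α w = hit X w ≡ true × lookup X (idx w α) ≡ relative w α t₀

      agrees? : ∀ X α w → Dec (Agrees X α w)
      agrees? X α w = hit? X w ×-dec (lookup X (idx w α) Fin.≟ relative w α t₀)

      agreeing⇒ : ∀ X {α} → α ∈ αs → agreeing X α ≤ length (candidates X ((α , t₀) ∷ L))
      agreeing⇒ X {α} α∈ = subst (_≤ length (candidates X ((α , t₀) ∷ L))) (counts frees)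
        (unique-⊆⇒length≤ _ _ (Unique.filter⁺ (agrees? X α) (unique-select isFree ℓ)) λ {w} w∈ →
          let (w∈' , e , e') = ∈-filter⁻ (agrees? X α) {xs = frees} w∈ in
          ∈-filter⁺ (fits? X ((α , t₀) ∷ L)) (∈-allFin w)
            (((λ { refl → case trans (symm (free-label w∈')) (label-probe α∈) of λ () }) , e')
              ∷ hit⇒fits X (free-notFixed w∈') e))
        where
          counts : ∀ ws → length (filter (agrees? X α) ws)
                   ≡ count (hits X ws) (map (λ w → relative w α t₀) ws) (map (lookup X) (map (λ w → idx w α) ws))
          counts []       = refl
          counts (w ∷ ws) with hit X w
          ... | false = counts ws
          ... | true with lookup X (idx w α) Fin.≟ relative w α t₀
          ...   | yes _ = cong suc (counts ws)
          ...   | no _  = counts ws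

module RandomTarget (m n M base : ℕ) where
  open Random m n M
  open Sums p
  open Existence m n M base
  open Candidates m n M
  open Family
  open DecMembership (Fin._≟_ {M}) using (_∈?_)

  few-one : ∀ h → few h 1 ≡ (p ∸ 1) ^ h
  few-one zero    = refl
  few-one (suc h) = cong ((p ∸ 1) *_) (few-one h)

  -- Some vertex list with j prescribed types has fewer than k candidates.
  scarce : (j k y φ : ℕ) → Fin p → 0 < y → 0 < p →
    1 * (p ^ j * M ^ (j + 0)) * (y ^ (k ∸ 1) * (((p ^ j ∸ 1) * y + 1) ^ (M ∸ (j + 0)) * 1)) * base
      ≤ φ * ((j ! * 1) * (1 * (p ^ j) ^ (M ∸ (j + 0) + 0) * y ^ (M ∸ (j + 0)))) → Family
  scarce j k y φ t 0<y 0<p num = record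
    { j = j ; r = 0 ; b = 0 ; k = 1 ; good = λ h a → h <ᵇ k ; τ = λ _ → t
    ; θ = y ^ (M ∸ (j + 0)) ; C = y ^ (k ∸ 1) ; U = 1 ; D = y ; U' = 1 ; D' = 1 ; φ = φ
    ; weights = w ; positive = pos ; rare = num }
    where
      instance
        y≢0 : NonZero y
        y≢0 = >-nonZero 0<y
        p≢0 : NonZero p
        p≢0 = >-nonZero 0<p
      pos : 0 < 1 * (p ^ j) ^ (M ∸ (j + 0) + 0) * y ^ (M ∸ (j + 0))
      pos = *-mono-≤ (≤-trans (m^n>0 (p ^ j) {{m^n≢0 p j}} (M ∸ (j + 0) + 0)) (m≤m+n _ 0)) (m^n>0 y (M ∸ (j + 0)))
      -- Free solutions weigh 1 and the other free vertices `y`; with fewer than k solutions the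
      -- product is at least y^W / y^(k - 1).
      w : ∀ h f a a' → (h <ᵇ k) ≡ true → h + f ≡ M ∸ (j + 0) → a + a' ≡ 0 →
          y ^ (M ∸ (j + 0)) * (few h 0 * p ^ f) ^ 0 ≤ y ^ (k ∸ 1) * ((1 ^ h * y ^ f) * (1 ^ a * 1 ^ a'))
      w h f zero zero g e refl = begin
        y ^ (M ∸ (j + 0)) * 1 ≡⟨ *-identityʳ _ ⟩
        y ^ (M ∸ (j + 0))     ≡⟨ cong (y ^_) e ⟨
        y ^ (h + f)           ≤⟨ ^-monoʳ-≤ y (+-monoˡ-≤ f (h≤ k (<ᵇ⇒< h k (subst Data.Bool.T (symm g) tt)))) ⟩
        y ^ (k ∸ 1 + f)       ≡⟨ ^-distribˡ-+-* y (k ∸ 1) f ⟩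
        y ^ (k ∸ 1) * y ^ f   ≡⟨ cong (y ^ (k ∸ 1) *_) (trans (*-identityʳ (1 ^ h * y ^ f)) (trans (cong (_* y ^ f) (^-zeroˡ h)) (+-identityʳ (y ^ f)))) ⟨
        y ^ (k ∸ 1) * ((1 ^ h * y ^ f) * (1 * 1)) ∎
        where
          open ≤-Reasoning
          h≤ : ∀ k → h < k → h ≤ k ∸ 1
          h≤ (suc k) (s≤s le) = le

  -- Some vertex list with j prescribed types, together with r further vertices none of which is
  -- joined by type t to a candidate.
  separated : (j r φ : ℕ) → 0 < p →
    p * (p ^ j * M ^ (j + r)) * (1 * (((p ^ j ∸ 1) * p ^ r + (p ∸ 1) ^ r) ^ (M ∸ (j + r)) * ((p ^ j ∸ 1) * 1 + 1) ^ r)) * base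
      ≤ φ * ((j ! * r !) * ((p ^ (M ∸ (j + r))) ^ r * (p ^ j) ^ (M ∸ (j + r) + r) * 1)) → Family
  separated j r φ 0<p num = record
    -- The condition `good` always holds; it is phrased as a lower bound so that `avoid-separated`
    -- applies with `mm` = 0.
    { j = j ; r = r ; b = 1 ; k = p ; good = λ h a → 0 ≤ᵇ (h + a) ; τ = id
    ; θ = 1 ; C = 1 ; U = (p ∸ 1) ^ r ; D = p ^ r ; U' = 1 ; D' = 1 ; φ = φ
    ; weights = w ; positive = pos ; rare = num }
    where
      instance
        p≢0 : NonZero p
        p≢0 = >-nonZero 0<p
      pos : 0 < (p ^ (M ∸ (j + r))) ^ r * (p ^ j) ^ (M ∸ (j + r) + r) * 1
      pos = *-mono-≤ (*-mono-≤ (m^n>0 (p ^ (M ∸ (j + r))) {{m^n≢0 p (M ∸ (j + r))}} r) (m^n>0 (p ^ j) {{m^n≢0 p j}} (M ∸ (j + r) + r))) ≤-refl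
      swap-^ : ∀ a h r → (a ^ h) ^ r ≡ (a ^ r) ^ h
      swap-^ a h r = trans (^-*-assoc a h r) (trans (cong (a ^_) (*-comm h r)) (symm (^-*-assoc a r h)))
      w : ∀ h f a a' → (0 ≤ᵇ (h + a)) ≡ true → h + f ≡ M ∸ (j + r) → a + a' ≡ r →
          1 * (few h 1 * p ^ f) ^ r ≤ 1 * ((((p ∸ 1) ^ r) ^ h * (p ^ r) ^ f) * (1 ^ a * 1 ^ a'))
      w h f a a' _ _ _ = ≤-reflexive (cong (1 *_) (begin
        (few h 1 * p ^ f) ^ r                   ≡⟨ ^-distribʳ-* r (few h 1) (p ^ f) ⟩
        few h 1 ^ r * (p ^ f) ^ r               ≡⟨ cong₂ _*_ (trans (cong (_^ r) (few-one h)) (swap-^ (p ∸ 1) h r)) (swap-^ p f r) ⟩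
        ((p ∸ 1) ^ r) ^ h * (p ^ r) ^ f         ≡⟨ *-identityʳ _ ⟨
        ((p ∸ 1) ^ r) ^ h * (p ^ r) ^ f * 1     ≡⟨ cong ((((p ∸ 1) ^ r) ^ h * (p ^ r) ^ f) *_) (cong₂ _*_ (^-zeroˡ a) (^-zeroˡ a')) ⟨
        ((p ∸ 1) ^ r) ^ h * (p ^ r) ^ f * (1 ^ a * 1 ^ a') ∎))
        where open ≡-Reasoning

  avoid-scarce : ∀ X f {k} → (∀ h a → good f h a ≡ (h <ᵇ k)) → r f ≡ 0 → Fin (Family.k f) → Avoids X f →
                 ∀ L → Unique (images L) → length L ≡ j f → k ≤ length (candidates X L)
  avoid-scarce X f {k} g≡ r≡0 i av L u len = ≤-trans (≮⇒≥ ¬lt) (few-hits⇒ X)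
    where
      open Labelling L [] u [] (λ ())
      open C (τ f i)
      ¬lt : ¬ trues (hits X frees) < k
      ¬lt lt = case trans (symm (av i ℓ (trans count-fixed len) (trans count-probe (symm r≡0)))) value of λ ()
        where
          no-probes : probes ≡ []
          no-probes with probes | trans (length-map proj₁ (select isProbe ℓ)) (trans (length-select isProbe ℓ) count-probe)
          ... | [] | _ = refl
          value : event (good f) (b f) X ≡ 1
          value rewrite no-probes | g≡ (trues (hits X frees)) 0 | <ᵇ-true lt = refl

  avoid-separated : ∀ X f {mm} → (∀ h a → good f h a ≡ (mm ≤ᵇ (h + a))) → (i : Fin (Family.k f)) → Avoids X f →
                    ∀ L αs → Unique (images L) → Unique αs → (∀ {α} → α ∈ αs → α ∉ images L) →
                    length L ≡ j f → length αs ≡ r f → mm ≤ length (candidates X L) →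
                    ¬ All (λ α → length (candidates X ((α , τ f i) ∷ L)) < b f) αs
  avoid-separated X f {mm} g≡ i av L αs u uα dis len lenα mm≤ all =
    case trans (symm (av i ℓ (trans count-fixed len) (trans count-probe lenα))) value of λ ()
    where
      open Labelling L αs u uα dis
      open C (τ f i)
      ≤ᵇ-true : ∀ {a b} → a ≤ b → (a ≤ᵇ b) ≡ true
      ≤ᵇ-true {a} {b} le with a ≤ᵇ b | ≤⇒≤ᵇ le
      ... | true | _ = refl
      ones : ∀ βs → (∀ {β} → β ∈ βs → β ∈ αs) → prodL (λ α → indicator (agreeing X α <ᵇ b f)) βs ≡ 1
      ones []       _   = refl
      ones (β ∷ βs) sub rewrite <ᵇ-true (≤-<-trans (agreeing⇒ X (sub (here refl))) (All.lookup all (sub (here refl)))) =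
        trans (+-identityʳ _) (ones βs (sub ∘ there))
      value : event (good f) (b f) X ≡ 1
      value rewrite g≡ (trues (hits X frees)) (trues (hits X probes)) | ≤ᵇ-true (≤-trans mm≤ (many-hits⇒ X))
                  | ones probes (probe-inv ∘ probe-label) = refl

  fits⇒sat : ∀ X L {w} → Fits X L w → Sat (graph X) w (map (λ { (u , t) → u , decode t }) L)
  fits⇒sat X []      []               = []
  fits⇒sat X (_ ∷ L) ((w≢u , e) ∷ ps) = connection⁺ X w≢u e ∷ fits⇒sat X L ps

  -- s = s' + 1.  Fewer than r + 1 vertices leave a list of s' constraints with fewer than b₁ candidates,
  -- and fewer than k are separated from the candidates of a list of s constraints.
  module _ (X : Vec (Fin p) E) (s' r k b₁ : ℕ) (2≤p : 2 ≤ p)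
    (crowd : ∀ L t αs → Unique (images L) → Unique αs → (∀ {α} → α ∈ αs → α ∉ images L) → length L ≡ s' → length αs ≡ suc r →
             ¬ All (λ α → length (candidates X ((α , t) ∷ L)) < b₁) αs)
    (joined : ∀ L t αs → Unique (images L) → Unique αs → (∀ {α} → α ∈ αs → α ∉ images L) → length L ≡ suc s' → length αs ≡ k →
             b₁ ≤ length (candidates X L) → ¬ All (λ α → length (candidates X ((α , t) ∷ L)) < 1) αs)
    (b₁-big : suc (s' + r) ≤ b₁) (k-small : suc s' + k ≤ b₁) (M-big : (s' + r) + (s' + r) < M) where

    private
      untype : Fin M × Fin p → Constraint m n M
      untype (u , t) = u , decode t

      -- Shorter lists need only distinct vertices. A full list must in addition keep `b₁`
      -- candidates; the few last vertices that would violate this are forbidden rather than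
      -- excluded from the graph.
      Ok : List (Constraint m n M) → Set
      Ok L = Σ Typed λ L' → L ≡ map untype L' × Unique (images L') ×
             (length L' ≡ suc s' → b₁ ≤ length (candidates X L'))

      length-untype : ∀ {L} (L' : Typed) → L ≡ map untype L' → length L' ≡ length L
      length-untype L' refl = symm (length-map untype L')

      unique-candidates : ∀ L → Unique (candidates X L)
      unique-candidates L = Unique.filter⁺ (fits? X L) (Unique.allFin⁺ M)

      length-take : ∀ {A : Set} k (xs : List A) → k ≤ length xs → length (take k xs) ≡ k
      length-take zero    xs       le       = refl
      length-take (suc k) (x ∷ xs) (s≤s le) = cong suc (length-take k xs le)

      ∈-take : ∀ {A : Set} k {xs : List A} {x} → x ∈ take k xs → x ∈ xs
      ∈-take (suc k) {_ ∷ _} (here e)  = here e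
      ∈-take (suc k) {_ ∷ _} (there p) = there (∈-take k p)

      Low : Typed → Fin p → Fin M → Set
      Low L t α = α ∉ images L × length (candidates X ((α , t) ∷ L)) < b₁

      low? : ∀ L t α → Dec (Low L t α)
      low? L t α = ¬? (α ∈? images L) ×-dec (length (candidates X ((α , t) ∷ L)) <? b₁)

      lows : Typed → Fin p → List (Fin M)
      lows L t = filter (low? L t) (allFin M)

      few-lows : ∀ L t → Unique (images L) → length L ≡ s' → length (lows L t) ≤ r
      few-lows L t u len with length (lows L t) ≤? r
      ... | yes le = le
      ... | no ¬le = contradiction
            (All.tabulate λ α∈ → proj₂ (low (∈-take (suc r) α∈)))
            (crowd L t (take (suc r) (lows L t)) u
              (Unique.take⁺ (suc r) (Unique.filter⁺ (low? L t) (Unique.allFin⁺ M)))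
              (λ α∈ → proj₁ (low (∈-take (suc r) α∈))) len (length-take (suc r) (lows L t) (≰⇒> ¬le)))
        where
          low : ∀ {α} → α ∈ lows L t → Low L t α
          low α∈ = proj₂ (∈-filter⁻ (low? L t) {xs = allFin M} α∈)

      forbidden : ∀ L c → Ok L → length L < suc s' → present c ≡ true →
        Σ (List (Fin M)) λ bad → length bad ≤ s' + r × (∀ y → y ∉ bad → Ok ((y , c) ∷ L))
      forbidden L c (L' , refl , u , _) len pr with length L' <? s'
      ... | yes lt = images L' , ≤-trans (≤-reflexive (length-map proj₁ L')) (≤-trans (<⇒≤ lt) (m≤m+n s' r)) ,
            λ y y∉ → (y , encode c pr) ∷ L' , cong (λ d → (y , d) ∷ map untype L') (symm (decode-encode c pr)) ,
              All.¬Any⇒All¬ _ y∉ ∷ u , λ e → contradiction (suc-injective e) (<⇒≢ lt)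
      ... | no ¬lt = images L' ++ lows L' (encode c pr) ,
            ≤-trans (≤-reflexive (length-++ (images L')))
              (+-mono-≤ (≤-reflexive (trans (length-map proj₁ L') len')) (few-lows L' (encode c pr) u len')) ,
            λ y y∉ → (y , encode c pr) ∷ L' , cong (λ d → (y , d) ∷ map untype L') (symm (decode-encode c pr)) ,
              All.¬Any⇒All¬ _ (y∉ ∘ ∈-++⁺ˡ) ∷ u , λ _ → ≮⇒≥ λ lt → y∉ (∈-++⁺ʳ (images L')
                (∈-filter⁺ (low? L' (encode c pr)) (∈-allFin y) (y∉ ∘ ∈-++⁺ˡ , lt)))
        where
          len' : length L' ≡ s'
          len' = ≤-antisym (≤-pred (subst (_< suc s') (length-map untype L') len)) (≮⇒≥ ¬lt)

      full : ∀ L → Ok L → length L ≡ suc s' → AtLeast (suc (s' + r)) (λ y → Sat (graph X) y L)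
      full L (L' , refl , u , many) len = candidates X L' , unique-candidates L' ,
        All.tabulate (λ w∈ → fits⇒sat X L' (proj₂ (∈-filter⁻ (fits? X L') {xs = allFin M} w∈))) ,
        ≤-trans b₁-big (many (trans (length-untype L' refl) len))

      pair : ∀ L L' c → Ok L → Ok L' → length L ≡ suc s' → length L' ≡ suc s' → present c ≡ true →
             ∃ λ α → ∃ λ ω → Sat (graph X) α L × Sat (graph X) ω L' × conn (graph X) α ω ≡ c
      pair _ _ c (A , refl , uA , manyA) (B , refl , uB , manyB) lenA lenB pr = search
        where
          lenA' = trans (length-untype A refl) lenA
          lenB' = trans (length-untype B refl) lenB
          pr' : present (flipC c) ≡ true
          pr' = trans (present-flipC c) pr
          -- The type is prescribed as seen from ω, while c is the connection seen from α.
          t = encode (flipC c) pr'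
          outside? : ∀ α → Dec (α ∉ images B)
          outside? α = ¬? (α ∈? images B)
          -- Probes must not be among the fixed vertices of B. Removing these s vertices from at
          -- least `b₁` candidates leaves k of them, by `k-small`.
          Aout = filter outside? (candidates X A)
          k≤ : k ≤ length Aout
          k≤ = +-cancelˡ-≤ (suc s') k (length Aout) (begin
            suc s' + k                      ≤⟨ k-small ⟩
            b₁                              ≤⟨ manyA lenA' ⟩
            length (candidates X A)         ≤⟨ unique-⊆⇒length≤ _ (images B ++ Aout) (unique-candidates A) split ⟩
            length (images B ++ Aout)       ≡⟨ length-++ (images B) ⟩
            length (images B) + length Aout ≡⟨ cong (_+ length Aout) (trans (length-map proj₁ B) lenB') ⟩
            suc s' + length Aout            ∎)
            where
              open ≤-Reasoning
              split : ∀ {α} → α ∈ candidates X A → α ∈ images B ++ Aout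
              split {α} α∈ with α ∈? images B
              ... | yes q = ∈-++⁺ˡ q
              ... | no q  = ∈-++⁺ʳ (images B) (∈-filter⁺ outside? α∈ q)
          αs = take k Aout
          inA : ∀ {α} → α ∈ αs → Fits X A α × α ∉ images B
          inA α∈ = let (q , o) = ∈-filter⁻ outside? {xs = candidates X A} (∈-take k α∈) in
                   proj₂ (∈-filter⁻ (fits? X A) {xs = allFin M} q) , o
          not-all = joined B t αs uB (Unique.take⁺ k (Unique.filter⁺ outside? (unique-candidates A)))
                      (proj₂ ∘ inA) lenB' (length-take k Aout k≤) (manyB lenB')
          search : ∃ λ α → ∃ λ ω → Sat (graph X) α (map untype A) × Sat (graph X) ω (map untype B) × connection X α ω ≡ c
          search with find (All.¬All⇒Any¬ (λ α → length (candidates X ((α , t) ∷ B)) <? 1) αs not-all)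
            where
              find : ∀ {αs} → Any (λ α → ¬ length (candidates X ((α , t) ∷ B)) < 1) αs →
                     ∃ λ α → α ∈ αs × ¬ length (candidates X ((α , t) ∷ B)) < 1
              find (here q)  = _ , here refl , q
              find (there a) = let (α , α∈ , q) = find a in α , there α∈ , q
          ... | α , α∈ , ¬none with candidates X ((α , t) ∷ B) in eq
          ...   | []    = contradiction (s≤s z≤n) ¬none
          ...   | ω ∷ _ with proj₂ (∈-filter⁻ (fits? X ((α , t) ∷ B)) {xs = allFin M} (subst (ω ∈_) (symm eq) (here refl)))
          ...     | (ω≢α , e) ∷ rest = α , ω , fits⇒sat X A (proj₁ (inA α∈)) , fits⇒sat X B rest , (begin
                      connection X α ω         ≡⟨ connection-flip X ω α ⟩
                      flipC (connection X ω α) ≡⟨ cong flipC (trans (connection⁺ X ω≢α e) (decode-encode (flipC c) pr')) ⟩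
                      flipC (flipC c)          ≡⟨ flipC-involutive c ⟩
                      c                        ∎)
            where open ≡-Reasoning

      t₁ t₂ : Fin p
      t₁ = fromℕ< (≤-trans (s≤s z≤n) 2≤p)
      t₂ = fromℕ< 2≤p

      t₁≢t₂ : t₁ ≢ t₂
      t₁≢t₂ e = case trans (symm (Fin.toℕ-fromℕ< (≤-trans (s≤s z≤n) 2≤p))) (trans (cong toℕ e) (Fin.toℕ-fromℕ< 2≤p)) of λ ()

    random-target : Target (graph X) (suc s')
    random-target = FromCells.target (graph X) (s' + r) M-big (decode t₁) (decode t₂)
      (decode-present {m} {n} t₁) (decode-present {m} {n} t₂) (t₁≢t₂ ∘ decode-injective {m} {n})
      Ok ([] , refl , [] , λ ()) forbidden full pair

-- Exponential decay without exponentials, and a numerical criterion.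

-- With N = A + c this says (1 - c/N)^h ≤ 1 / (1 + h c/N), cleared of denominators.
bernoulli : ∀ A c h → A ^ h * (A + c + h * c) ≤ (A + c) ^ h * (A + c)
bernoulli A c zero    = ≤-reflexive (cong (1 *_) (+-identityʳ (A + c)))
bernoulli A c (suc h) = begin
  A * A ^ h * (A + c + (c + h * c))
    ≤⟨ m≤m+n _ (A ^ h * (c * c + h * (c * c))) ⟩
  A * A ^ h * (A + c + (c + h * c)) + A ^ h * (c * c + h * (c * c))
    ≡⟨ solve 4 (λ a x c h → a :* x :* (a :+ c :+ (c :+ h :* c)) :+ x :* (c :* c :+ h :* (c :* c)) := (a :+ c) :* (x :* (a :+ c :+ h :* c))) refl A (A ^ h) c h ⟩
  (A + c) * (A ^ h * (A + c + h * c))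
    ≤⟨ *-monoʳ-≤ (A + c) (bernoulli A c h) ⟩
  (A + c) * ((A + c) ^ h * (A + c))
    ≡⟨ *-assoc (A + c) ((A + c) ^ h) (A + c) ⟨
  (A + c) * (A + c) ^ h * (A + c) ∎
  where open ≤-Reasoning
        open +-*-Solver

-- (1 - c/(A+c))^W ≤ (z/(z+x))^e whenever x/z ≤ c h/(A+c) and h e ≤ W.
decay : ∀ A c h z x e W .{{_ : NonZero (A + c)}} → x * (A + c) ≤ c * h * z → h * e ≤ W →
        A ^ W * (z + x) ^ e ≤ (A + c) ^ W * z ^ e
decay A c h z x e W xN≤ he≤W = begin
  A ^ W * (z + x) ^ e                     ≡⟨ cong (λ w → A ^ w * (z + x) ^ e) (m+[n∸m]≡n he≤W) ⟨
  A ^ (h * e + d) * (z + x) ^ e           ≡⟨ cong (_* (z + x) ^ e) (^-distribˡ-+-* A (h * e) d) ⟩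
  A ^ (h * e) * A ^ d * (z + x) ^ e       ≡⟨ cong (λ w → w * A ^ d * (z + x) ^ e) (^-*-assoc A h e) ⟨
  (A ^ h) ^ e * A ^ d * (z + x) ^ e       ≡⟨ solve 3 (λ a b c → a :* b :* c := a :* c :* b) refl ((A ^ h) ^ e) (A ^ d) ((z + x) ^ e) ⟩
  (A ^ h) ^ e * (z + x) ^ e * A ^ d       ≡⟨ cong (_* A ^ d) (^-distribʳ-* e (A ^ h) (z + x)) ⟨
  (A ^ h * (z + x)) ^ e * A ^ d           ≤⟨ *-mono-≤ (^-monoˡ-≤ e piece) (^-monoˡ-≤ d (m≤m+n A c)) ⟩
  ((A + c) ^ h * z) ^ e * (A + c) ^ d     ≡⟨ cong (_* (A + c) ^ d) (^-distribʳ-* e ((A + c) ^ h) z) ⟩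
  ((A + c) ^ h) ^ e * z ^ e * (A + c) ^ d ≡⟨ solve 3 (λ a b c → a :* b :* c := a :* c :* b) refl (((A + c) ^ h) ^ e) (z ^ e) ((A + c) ^ d) ⟩
  ((A + c) ^ h) ^ e * (A + c) ^ d * z ^ e ≡⟨ cong (λ w → w * (A + c) ^ d * z ^ e) (^-*-assoc (A + c) h e) ⟩
  (A + c) ^ (h * e) * (A + c) ^ d * z ^ e ≡⟨ cong (_* z ^ e) (^-distribˡ-+-* (A + c) (h * e) d) ⟨
  (A + c) ^ (h * e + d) * z ^ e           ≡⟨ cong (λ w → (A + c) ^ w * z ^ e) (m+[n∸m]≡n he≤W) ⟩
  (A + c) ^ W * z ^ e                     ∎
  where
    open ≤-Reasoning
    open +-*-Solver
    d = W ∸ h * e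
    piece : A ^ h * (z + x) ≤ (A + c) ^ h * z
    piece = *-cancelʳ-≤ _ _ (A + c) (begin
      A ^ h * (z + x) * (A + c)           ≡⟨ solve 4 (λ a z x n → a :* (z :+ x) :* n := a :* (z :* n :+ x :* n)) refl (A ^ h) z x (A + c) ⟩
      A ^ h * (z * (A + c) + x * (A + c)) ≤⟨ *-monoʳ-≤ (A ^ h) (+-monoʳ-≤ (z * (A + c)) xN≤) ⟩
      A ^ h * (z * (A + c) + c * h * z)   ≡⟨ solve 5 (λ a z n c h → a :* (z :* n :+ c :* h :* z) := a :* (n :+ h :* c) :* z) refl (A ^ h) z (A + c) c h ⟩
      A ^ h * (A + c + h * c) * z         ≤⟨ *-monoˡ-≤ z (bernoulli A c h) ⟩
      (A + c) ^ h * (A + c) * z           ≡⟨ solve 3 (λ a n z → a :* n :* z := a :* z :* n) refl ((A + c) ^ h) (A + c) z ⟩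
      (A + c) ^ h * z * (A + c)           ∎)

Receiver : ℕ → ℕ → ℕ → ℕ → Set₁
Receiver m n s K = Σ (MixedGraph m n K) λ H → Target H s

private
  combine-rates : ∀ T A B G L φ → 0 < G → A * G ≤ B * L → T * L ≤ φ * G → T * A ≤ φ * B
  combine-rates T A B G L φ 0<G AG TL = *-cancelʳ-≤ (T * A) (φ * B) G {{>-nonZero 0<G}} (begin
    T * A * G   ≡⟨ *-assoc T A G ⟩
    T * (A * G) ≤⟨ *-monoʳ-≤ T AG ⟩
    T * (B * L) ≡⟨ solve 3 (λ t b l → t :* (b :* l) := t :* l :* b) refl T B L ⟩
    T * L * B   ≤⟨ *-monoˡ-≤ B TL ⟩
    φ * G * B   ≡⟨ solve 3 (λ f g b → f :* g :* b := f :* b :* g) refl φ G B ⟩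
    φ * B * G   ∎)
    where open ≤-Reasoning
          open +-*-Solver

  rearrange-scarce : ∀ p j M y k base φ → 
    (p * M) ^ j * y ^ k * base * ((p ^ j ∸ 1) * y + 1) ^ (M ∸ j) ≤ φ * j ! * (p ^ j * y) ^ (M ∸ j) →
    1 * (p ^ j * M ^ (j + 0)) * (y ^ k * (((p ^ j ∸ 1) * y + 1) ^ (M ∸ (j + 0)) * 1)) * base
      ≤ φ * ((j ! * 1) * (1 * (p ^ j) ^ (M ∸ (j + 0) + 0) * y ^ (M ∸ (j + 0))))
  rearrange-scarce p j M y k base φ hyp rewrite +-identityʳ j | +-identityʳ (M ∸ j) = begin
    1 * (p ^ j * M ^ j) * (y ^ k * (R * 1)) * base
      ≡⟨ solve 5 (λ a b c d e → con 1 :* (a :* b) :* (c :* (d :* con 1)) :* e := a :* b :* c :* e :* d) refl (p ^ j) (M ^ j) (y ^ k) R base ⟩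
    p ^ j * M ^ j * y ^ k * base * R
      ≡⟨ cong (λ z → z * y ^ k * base * R) (^-distribʳ-* j p M) ⟨
    (p * M) ^ j * y ^ k * base * R ≤⟨ hyp ⟩
    φ * j ! * (p ^ j * y) ^ W ≡⟨ cong (φ * j ! *_) (^-distribʳ-* W (p ^ j) y) ⟩
    φ * j ! * ((p ^ j) ^ W * y ^ W)
      ≡⟨ solve 4 (λ f a b c → f :* a :* (b :* c) := f :* ((a :* con 1) :* (con 1 :* b :* c))) refl φ (j !) ((p ^ j) ^ W) (y ^ W) ⟩
    φ * (j ! * 1 * (1 * (p ^ j) ^ W * y ^ W)) ∎
    where
      open ≤-Reasoning
      open +-*-Solver
      W = M ∸ j
      R = ((p ^ j ∸ 1) * y + 1) ^ W

  rearrange-separated : ∀ p j r M base φ → 0 < p →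
    p * ((p * M) ^ j * M ^ r) * base * ((p ^ j ∸ 1) * p ^ r + (p ∸ 1) ^ r) ^ (M ∸ (j + r)) ≤ φ * (j ! * r !) * (p ^ j * p ^ r) ^ (M ∸ (j + r)) →
    p * (p ^ j * M ^ (j + r)) * (1 * (((p ^ j ∸ 1) * p ^ r + (p ∸ 1) ^ r) ^ (M ∸ (j + r)) * ((p ^ j ∸ 1) * 1 + 1) ^ r)) * base
      ≤ φ * ((j ! * r !) * ((p ^ (M ∸ (j + r))) ^ r * (p ^ j) ^ (M ∸ (j + r) + r) * 1))
  rearrange-separated p j r M base φ 0<p hyp = begin
    p * (p ^ j * M ^ (j + r)) * (1 * (R * ((p ^ j ∸ 1) * 1 + 1) ^ r)) * base
      ≡⟨ cong₂ (λ a b → p * (p ^ j * a) * (1 * (R * b ^ r)) * base) (^-distribˡ-+-* M j r)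
           (trans (cong (_+ 1) (*-identityʳ (p ^ j ∸ 1))) (m∸n+n≡m (m^n>0 p {{>-nonZero 0<p}} j))) ⟩
    p * (p ^ j * (M ^ j * M ^ r)) * (1 * (R * (p ^ j) ^ r)) * base
      ≡⟨ solve 7 (λ p a b c d e f → p :* (a :* (b :* c)) :* (con 1 :* (d :* e)) :* f := p :* (a :* b :* c) :* f :* d :* e) refl p (p ^ j) (M ^ j) (M ^ r) R ((p ^ j) ^ r) base ⟩
    p * (p ^ j * M ^ j * M ^ r) * base * R * (p ^ j) ^ r
      ≡⟨ cong (λ z → p * (z * M ^ r) * base * R * (p ^ j) ^ r) (^-distribʳ-* j p M) ⟨
    p * ((p * M) ^ j * M ^ r) * base * R * (p ^ j) ^ r ≤⟨ *-monoˡ-≤ ((p ^ j) ^ r) hyp ⟩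
    φ * (j ! * r !) * (p ^ j * p ^ r) ^ W * (p ^ j) ^ r
      ≡⟨ cong (λ z → φ * (j ! * r !) * z * (p ^ j) ^ r) (trans (^-distribʳ-* W (p ^ j) (p ^ r)) (cong ((p ^ j) ^ W *_)
           (trans (^-*-assoc p r W) (trans (cong (p ^_) (*-comm r W)) (symm (^-*-assoc p W r)))))) ⟩
    φ * (j ! * r !) * ((p ^ j) ^ W * (p ^ W) ^ r) * (p ^ j) ^ r
      ≡⟨ solve 5 (λ f g a b c → f :* g :* (a :* b) :* c := f :* (g :* (b :* (a :* c) :* con 1))) refl φ (j ! * r !) ((p ^ j) ^ W) ((p ^ W) ^ r) ((p ^ j) ^ r) ⟩
    φ * ((j ! * r !) * ((p ^ W) ^ r * ((p ^ j) ^ W * (p ^ j) ^ r) * 1))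
      ≡⟨ cong (λ z → φ * ((j ! * r !) * ((p ^ W) ^ r * z * 1))) (^-distribˡ-+-* (p ^ j) W r) ⟨
    φ * ((j ! * r !) * ((p ^ W) ^ r * (p ^ j) ^ (W + r) * 1)) ∎
    where
      open ≤-Reasoning
      open +-*-Solver
      W = M ∸ (j + r)
      R = ((p ^ j ∸ 1) * p ^ r + (p ∸ 1) ^ r) ^ W

-- G/L measures by how much the expected number of bad configurations decays.
two-families : ∀ m n s' M k y base φ₁ φ₂ G₁ L₁ G₂ L₂ → let p = Types m n ; s = suc s' in
  2 ≤ p → 0 < y → 0 < k → φ₁ + (φ₂ + 0) < base → s' + s' < M → 0 < G₁ → 0 < G₂ →
  ((p ^ s ∸ 1) * y + 1) ^ (M ∸ s) * G₁ ≤ (p ^ s * y) ^ (M ∸ s) * L₁ →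
  (p * M) ^ s * y ^ (s + k ∸ 1) * base * L₁ ≤ φ₁ * s ! * G₁ →
  ((p ^ s ∸ 1) * p ^ k + (p ∸ 1) ^ k) ^ (M ∸ (s + k)) * G₂ ≤ (p ^ s * p ^ k) ^ (M ∸ (s + k)) * L₂ →
  p * ((p * M) ^ s * M ^ k) * base * L₂ ≤ φ₂ * (s ! * k !) * G₂ →
  Receiver m n s M
two-families m n s' M k y base φ₁ φ₂ G₁ L₁ G₂ L₂ 2≤p 0<y 0<k share< 2s'<M 0<G₁ 0<G₂ decay₁ rate₁ decay₂ rate₂ =
  -- No exceptional vertices are allowed (r = 0), and s + k is the least number of candidates from
  -- which k probes can be taken.
  graph X , random-target X s' 0 k (s + k) 2≤p crowd joined
    (s≤s (+-monoʳ-≤ s' z≤n)) ≤-refl (subst (_< M) (cong₂ _+_ (symm (+-identityʳ s')) (symm (+-identityʳ s'))) 2s'<M)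
  where
    p = Types m n
    s = suc s'
    0<p : 0 < p
    0<p = ≤-trans (s≤s z≤n) 2≤p
    open Random m n M using (graph)
    open Existence m n M base
    open RandomTarget m n M base
    open Candidates m n M
    t₁ : Fin p
    t₁ = fromℕ< 0<p
    fam₁ fam₂ : Family
    fam₁ = scarce s (s + k) y φ₁ t₁ 0<y 0<p (rearrange-scarce p s M y (s + k ∸ 1) base φ₁
             (combine-rates ((p * M) ^ s * y ^ (s + k ∸ 1) * base) _ _ G₁ L₁ (φ₁ * s !) 0<G₁ decay₁ rate₁))
    fam₂ = separated s k φ₂ 0<p (rearrange-separated p s k M base φ₂ 0<p
             (combine-rates (p * ((p * M) ^ s * M ^ k) * base) _ _ G₂ L₂ (φ₂ * (s ! * k !)) 0<G₂ decay₂ rate₂))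
    found = exists 0<p (fam₁ ∷ fam₂ ∷ []) share<
    X = proj₁ found
    plenty : ∀ L → Unique (images L) → length L ≡ s → s + k ≤ length (candidates X L)
    plenty = avoid-scarce X fam₁ (λ _ _ → refl) refl zero (All.head (proj₂ found))
    crowd : ∀ L t αs → Unique (images L) → Unique αs → (∀ {α} → α ∈ αs → α ∉ images L) → length L ≡ s' → length αs ≡ 1 →
            ¬ All (λ α → length (candidates X ((α , t) ∷ L)) < s + k) αs
    crowd L t (α ∷ []) u _ dis len _ (lt ∷ []) =
      contradiction (plenty ((α , t) ∷ L) (All.¬Any⇒All¬ _ (dis (here refl)) ∷ u) (cong suc len)) (<⇒≱ lt)
    joined : ∀ L t αs → Unique (images L) → Unique αs → (∀ {α} → α ∈ αs → α ∉ images L) → length L ≡ s → length αs ≡ k →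
             s + k ≤ length (candidates X L) → ¬ All (λ α → length (candidates X ((α , t) ∷ L)) < 1) αs
    joined L t αs u uα dis len lenα _ = avoid-separated X fam₂ (λ _ _ → refl) t (All.head (All.tail (proj₂ found)))
      L αs u uα dis len lenα z≤n

-- Both decay hypotheses are instances of `decay`. With Q = p^s, a free vertex has total weight Q y,
-- less y - 1 for solutions, in the scarce family, and Q p^k, less p^k - (p - 1)^k, in the separated
-- one.
two-families′ : ∀ m n s' M k y base φ₁ φ₂ h₁ z₁ x₁ e₁ h₂ z₂ x₂ e₂ → let p = Types m n ; s = suc s' in
  2 ≤ p → 0 < y → 0 < k → φ₁ + (φ₂ + 0) < base → s' + s' < M → 0 < z₁ → 0 < z₂ →
  x₁ * (p ^ s * y) ≤ (y ∸ 1) * h₁ * z₁ → h₁ * e₁ ≤ M ∸ s →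
  (p * M) ^ s * y ^ (s + k ∸ 1) * base * z₁ ^ e₁ ≤ φ₁ * s ! * (z₁ + x₁) ^ e₁ →
  x₂ * (p ^ s * p ^ k) ≤ (p ^ k ∸ (p ∸ 1) ^ k) * h₂ * z₂ → h₂ * e₂ ≤ M ∸ (s + k) →
  p * ((p * M) ^ s * M ^ k) * base * z₂ ^ e₂ ≤ φ₂ * (s ! * k !) * (z₂ + x₂) ^ e₂ →
  Receiver m n s M
two-families′ m n s' M k y base φ₁ φ₂ h₁ z₁ x₁ e₁ h₂ z₂ x₂ e₂ 2≤p 0<y 0<k share< big 0<z₁ 0<z₂ c₁ he₁ r₁ c₂ he₂ r₂ =
  two-families m n s' M k y base φ₁ φ₂ ((z₁ + x₁) ^ e₁) (z₁ ^ e₁) ((z₂ + x₂) ^ e₂) (z₂ ^ e₂)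
    2≤p 0<y 0<k share< big (pow-pos z₁ x₁ e₁ 0<z₁) (pow-pos z₂ x₂ e₂ 0<z₂) d₁ r₁ d₂ r₂
  where
    p = Types m n
    s = suc s'
    Q = p ^ s
    instance
      p≢0 : NonZero p
      p≢0 = >-nonZero (≤-trans (s≤s z≤n) 2≤p)
    pow-pos : ∀ z x e → 0 < z → 0 < (z + x) ^ e
    pow-pos z x e 0<z = m^n>0 (z + x) {{>-nonZero (≤-trans 0<z (m≤m+n z x))}} e
    1≤Q : 1 ≤ Q
    1≤Q = m^n>0 p s
    top : ∀ a b → b ≤ a → (Q ∸ 1) * a + b + (a ∸ b) ≡ Q * a
    top a b b≤a = begin
      (Q ∸ 1) * a + b + (a ∸ b)   ≡⟨ +-assoc ((Q ∸ 1) * a) b (a ∸ b) ⟩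
      (Q ∸ 1) * a + (b + (a ∸ b)) ≡⟨ cong ((Q ∸ 1) * a +_) (m+[n∸m]≡n b≤a) ⟩
      (Q ∸ 1) * a + a             ≡⟨ +-comm _ a ⟩
      suc (Q ∸ 1) * a             ≡⟨ cong (_* a) (m+[n∸m]≡n 1≤Q) ⟩
      Q * a                       ∎
      where open ≡-Reasoning
    general : ∀ a b h z x e W → 0 < a → b ≤ a → x * (Q * a) ≤ (a ∸ b) * h * z → h * e ≤ W →
              ((Q ∸ 1) * a + b) ^ W * (z + x) ^ e ≤ (Q * a) ^ W * z ^ e
    general a b h z x e W 0<a b≤a xc he = subst (λ N → A ^ W * (z + x) ^ e ≤ N ^ W * z ^ e) (top a b b≤a)
      (decay A (a ∸ b) h z x e W {{>-nonZero (subst (0 <_) (symm (top a b b≤a)) (*-mono-≤ 1≤Q 0<a))}}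
        (subst (λ N → x * N ≤ (a ∸ b) * h * z) (symm (top a b b≤a)) xc) he)
      where A = (Q ∸ 1) * a + b
    d₁ = general y 1 h₁ z₁ x₁ e₁ (M ∸ s) 0<y 0<y c₁ he₁
    d₂ = general (p ^ k) ((p ∸ 1) ^ k) h₂ z₂ x₂ e₂ (M ∸ (s + k)) (m^n>0 p k) (^-monoˡ-≤ k (m∸n≤m p 1)) c₂ he₂

n<2^n : ∀ n → n < 2 ^ n
n<2^n zero    = s≤s z≤n
n<2^n (suc n) = begin
  suc (suc n)     ≤⟨ s≤s (n<2^n n) ⟩
  suc (2 ^ n)     ≤⟨ +-monoˡ-≤ (2 ^ n) (m^n>0 2 n) ⟩
  2 ^ n + 2 ^ n   ≡⟨ cong (2 ^ n +_) (+-identityʳ (2 ^ n)) ⟨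
  2 * 2 ^ n       ∎
  where open ≤-Reasoning

-- Random targets for at least four types.

private
  size : ℕ → ℕ → ℕ
  size p s = 2 * s ^ p * p ^ s

  -- One probe suffices when p ≥ 3; B bounds log₂ (p M).
  one-probe : ∀ m n s' B → let p = Types m n ; s = suc s' in 2 ≤ p →
    p * size p s ≤ 2 ^ B → s * B + s + 3 ≤ s ^ p → p * (suc s * B + 3) ≤ 2 * s ^ p →
    Receiver m n s (size p s)
  one-probe m n s' B 2≤p pM≤ c₁ c₂ =
    -- With y = 2 and a single probe, blocks of 2 Q and of p Q vertices gain a factor 2 each. `e₁`
    -- and `e₂` count the doublings needed against 4 · 2^s · (p M)^s and 4 · (p M)^(s + 1).
    two-families′ m n s' M 1 2 4 1 1 (Q * 2) 1 1 e₁ (Q * p) 1 1 e₂ 2≤p (s≤s z≤n) (s≤s z≤n) (s≤s (s≤s (s≤s z≤n)))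
      s'+s'<M (s≤s z≤n) (s≤s z≤n)
      (≤-reflexive (solve 1 (λ q → con 1 :* (q :* con 2) := con 1 :* (q :* con 2) :* con 1) refl Q))
      he₁ rate₁
      (≤-reflexive (trans (solve 2 (λ q p → con 1 :* (q :* (p :* con 1)) := con 1 :* (q :* p) :* con 1) refl Q p)
        (cong (λ z → z * (Q * p) * 1) (symm step))))
      he₂ rate₂
    where
      open +-*-Solver
      p = Types m n
      s = suc s'
      Q = p ^ s
      M = size p s
      e₁ = s * B + s + 2
      e₂ = suc s * B + 2
      instance
        p≢0 : NonZero p
        p≢0 = >-nonZero (≤-trans (s≤s z≤n) 2≤p)
      step : p ^ 1 ∸ (p ∸ 1) ^ 1 ≡ 1
      step = trans (cong₂ _∸_ (*-identityʳ p) (*-identityʳ (p ∸ 1))) (m∸[m∸n]≡n (≤-trans (s≤s z≤n) 2≤p))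
      s<Q : s < Q
      s<Q = <-≤-trans (n<2^n s) (^-monoˡ-≤ s 2≤p)
      bound : ∀ N e → N * suc e ≤ M → ∀ d → d ≤ N → N * e ≤ M ∸ d
      bound N e le d d≤N = ≤-trans (≤-reflexive (symm (m+n∸m≡n N (N * e))))
        (≤-trans (∸-monoˡ-≤ N (≤-trans (≤-reflexive (symm (*-suc N e))) le)) (∸-monoʳ-≤ M d≤N))
      he₁ : Q * 2 * e₁ ≤ M ∸ s
      he₁ = bound (Q * 2) e₁ (begin
        Q * 2 * suc e₁       ≡⟨ cong (Q * 2 *_) (symm (+-suc (s * B + s) 2)) ⟩
        Q * 2 * (s * B + s + 3) ≤⟨ *-monoʳ-≤ (Q * 2) c₁ ⟩
        Q * 2 * s ^ p        ≡⟨ solve 2 (λ q t → q :* con 2 :* t := con 2 :* t :* q) refl Q (s ^ p) ⟩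
        M                    ∎) s (≤-trans (<⇒≤ s<Q) (m≤m*n Q 2))
        where open ≤-Reasoning
      he₂ : Q * p * e₂ ≤ M ∸ (s + 1)
      he₂ = bound (Q * p) e₂ (begin
        Q * p * suc e₂       ≡⟨ cong (Q * p *_) (symm (+-suc (suc s * B) 2)) ⟩
        Q * p * (suc s * B + 3) ≡⟨ *-assoc Q p _ ⟩
        Q * (p * (suc s * B + 3)) ≤⟨ *-monoʳ-≤ Q c₂ ⟩
        Q * (2 * s ^ p)      ≡⟨ *-comm Q _ ⟩
        M                    ∎) (s + 1) (≤-trans (≤-reflexive (+-comm s 1)) (≤-trans s<Q (m≤m*n Q p)))
        where open ≤-Reasoning
      s'+s'<M : s' + s' < M
      s'+s'<M = begin-strict
        s' + s' <⟨ +-mono-<-≤ (n<1+n s') (n≤1+n s') ⟩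
        s + s   ≤⟨ +-mono-≤ (<⇒≤ s<Q) (<⇒≤ s<Q) ⟩
        Q + Q   ≡⟨ solve 1 (λ q → q :+ q := con 2 :* con 1 :* q) refl Q ⟩
        2 * 1 * Q ≤⟨ *-monoˡ-≤ Q (*-monoʳ-≤ 2 (m^n>0 s p)) ⟩
        M       ∎
        where open ≤-Reasoning
      rate₁ : (p * M) ^ s * 2 ^ (s + 1 ∸ 1) * 4 * 1 ^ e₁ ≤ 1 * s ! * 2 ^ e₁
      rate₁ = begin
        (p * M) ^ s * 2 ^ (s + 1 ∸ 1) * 4 * 1 ^ e₁ ≡⟨ cong₂ (λ a b → (p * M) ^ s * 2 ^ a * 4 * b) (m+n∸n≡m s 1) (^-zeroˡ e₁) ⟩
        (p * M) ^ s * 2 ^ s * 4 * 1  ≡⟨ *-identityʳ _ ⟩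
        (p * M) ^ s * 2 ^ s * 4      ≤⟨ *-monoˡ-≤ 4 (*-monoˡ-≤ (2 ^ s) (^-monoˡ-≤ s pM≤)) ⟩
        (2 ^ B) ^ s * 2 ^ s * 2 ^ 2  ≡⟨ cong (λ z → z * 2 ^ s * 2 ^ 2) (trans (^-*-assoc 2 B s) (cong (2 ^_) (*-comm B s))) ⟩
        2 ^ (s * B) * 2 ^ s * 2 ^ 2  ≡⟨ cong (_* 2 ^ 2) (^-distribˡ-+-* 2 (s * B) s) ⟨
        2 ^ (s * B + s) * 2 ^ 2      ≡⟨ ^-distribˡ-+-* 2 (s * B + s) 2 ⟨
        2 ^ e₁                       ≡⟨ *-identityˡ _ ⟨
        1 * 2 ^ e₁                   ≤⟨ *-monoˡ-≤ (2 ^ e₁) (≤-trans (1≤n! s) (≤-reflexive (symm (*-identityˡ (s !))))) ⟩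
        1 * s ! * 2 ^ e₁             ∎
        where open ≤-Reasoning
      rate₂ : p * ((p * M) ^ s * M ^ 1) * 4 * 1 ^ e₂ ≤ 1 * (s ! * 1 !) * 2 ^ e₂
      rate₂ = begin
        p * ((p * M) ^ s * M ^ 1) * 4 * 1 ^ e₂ ≡⟨ cong (p * ((p * M) ^ s * M ^ 1) * 4 *_) (^-zeroˡ e₂) ⟩
        p * ((p * M) ^ s * (M * 1)) * 4 * 1 ≡⟨ solve 3 (λ p a m → p :* (a :* (m :* con 1)) :* con 4 :* con 1 := p :* m :* a :* con 4) refl p ((p * M) ^ s) M ⟩
        (p * M) ^ suc s * 4          ≤⟨ *-monoˡ-≤ 4 (^-monoˡ-≤ (suc s) pM≤) ⟩
        (2 ^ B) ^ suc s * 2 ^ 2      ≡⟨ cong (_* 2 ^ 2) (trans (^-*-assoc 2 B (suc s)) (cong (2 ^_) (*-comm B (suc s)))) ⟩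
        2 ^ (suc s * B) * 2 ^ 2      ≡⟨ ^-distribˡ-+-* 2 (suc s * B) 2 ⟨
        2 ^ e₂                       ≡⟨ *-identityˡ _ ⟨
        1 * 2 ^ e₂                   ≤⟨ *-monoˡ-≤ (2 ^ e₂) (≤-trans (*-mono-≤ (1≤n! s) (1≤n! 1)) (≤-reflexive (symm (*-identityˡ (s ! * 1 !))))) ⟩
        1 * (s ! * 1 !) * 2 ^ e₂     ∎
        where open ≤-Reasoning

  4+n≤2^[2+n] : ∀ n → 4 + n ≤ 2 ^ (2 + n)
  4+n≤2^[2+n] zero    = ≤-refl
  4+n≤2^[2+n] (suc n) = begin
    suc (4 + n)           ≤⟨ s≤s (4+n≤2^[2+n] n) ⟩
    suc (2 ^ (2 + n))     ≤⟨ +-monoˡ-≤ (2 ^ (2 + n)) (m^n>0 2 (2 + n)) ⟩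
    2 ^ (2 + n) + 2 ^ (2 + n) ≡⟨ cong (2 ^ (2 + n) +_) (+-identityʳ (2 ^ (2 + n))) ⟨
    2 * 2 ^ (2 + n)       ∎
    where open ≤-Reasoning

  -- The exponent that results from 2 s^p p^(s + 1) when s = 4 + a and p = 4 + c are replaced by the
  -- powers 2^(2 + a) and 2^(2 + c).
  logarithm : ℕ → ℕ → ℕ
  logarithm a c = 1 + (4 + c) * (2 + a) + (5 + a) * (2 + c)

  logarithm-bound : ∀ a c → let s = 4 + a ; p = 4 + c in p * size p s ≤ 2 ^ logarithm a c
  logarithm-bound a c = begin
    p * (2 * s ^ p * p ^ s)  ≡⟨ solve 3 (λ p x y → p :* (con 2 :* x :* y) := con 2 :* x :* (p :* y)) refl p (s ^ p) (p ^ s) ⟩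
    2 * s ^ p * p ^ suc s    ≤⟨ *-mono-≤ (*-monoʳ-≤ 2 (^-monoˡ-≤ p (4+n≤2^[2+n] a))) (^-monoˡ-≤ (suc s) (4+n≤2^[2+n] c)) ⟩
    2 * (2 ^ (2 + a)) ^ p * (2 ^ (2 + c)) ^ suc s
      ≡⟨ cong₂ (λ x y → 2 * x * y) (trans (^-*-assoc 2 (2 + a) p) (cong (2 ^_) (*-comm (2 + a) p)))
                                   (trans (^-*-assoc 2 (2 + c) (suc s)) (cong (2 ^_) (*-comm (2 + c) (suc s)))) ⟩
    2 ^ (1 + p * (2 + a)) * 2 ^ (suc s * (2 + c)) ≡⟨ ^-distribˡ-+-* 2 (1 + p * (2 + a)) (suc s * (2 + c)) ⟨
    2 ^ logarithm a c ∎
    where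
      open ≤-Reasoning
      open +-*-Solver
      s = 4 + a
      p = 4 + c

  -- Induction on the number of types: one more type at most doubles both p and the second factor,
  -- and the right side gains the factor s ≥ 4. For p = 4 the difference of the two sides is a
  -- polynomial in `a` with nonnegative coefficients.
  exponents : ∀ a c → let s = 4 + a ; p = 4 + c in p * (suc s * logarithm a c + 3) ≤ 2 * s ^ p
  exponents a zero = begin
    4 * (suc s * logarithm a 0 + 3) ≤⟨ m≤m+n _ (2 * (a * a * a * a + 16 * (a * a * a) + 84 * (a * a) + 158 * a + 60)) ⟩
    4 * (suc s * logarithm a 0 + 3) + 2 * (a * a * a * a + 16 * (a * a * a) + 84 * (a * a) + 158 * a + 60)
      ≡⟨ solve 1 (λ a → con 4 :* ((con 5 :+ a) :* (con 1 :+ con 4 :* (con 2 :+ a) :+ (con 5 :+ a) :* con 2) :+ con 3) :+ con 2 :* (a :* a :* a :* a :+ con 16 :* (a :* a :* a) :+ con 84 :* (a :* a) :+ con 158 :* a :+ con 60) := con 2 :* ((con 4 :+ a) :* ((con 4 :+ a) :* ((con 4 :+ a) :* ((con 4 :+ a) :* con 1))))) refl a ⟩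
    2 * s ^ 4 ∎
    where
      open ≤-Reasoning
      open +-*-Solver
      s = 4 + a
  exponents a (suc c) = begin
    (5 + c) * (suc s * logarithm a (suc c) + 3)
      ≤⟨ *-mono-≤ {5 + c} {2 * (4 + c)} {suc s * logarithm a (suc c) + 3} 5+c≤ (≤-trans (m≤m+n _ slack) (≤-reflexive doubled)) ⟩
    (2 * (4 + c)) * (2 * (suc s * logarithm a c + 3))
      ≡⟨ solve 2 (λ x y → (con 2 :* x) :* (con 2 :* y) := con 4 :* (x :* y)) refl (4 + c) (suc s * logarithm a c + 3) ⟩
    4 * ((4 + c) * (suc s * logarithm a c + 3)) ≤⟨ *-monoʳ-≤ 4 (exponents a c) ⟩
    4 * (2 * s ^ (4 + c)) ≤⟨ *-monoˡ-≤ (2 * s ^ (4 + c)) (m≤m+n 4 a) ⟩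
    s * (2 * s ^ (4 + c)) ≡⟨ solve 2 (λ s x → s :* (con 2 :* x) := con 2 :* (s :* x)) refl s (s ^ (4 + c)) ⟩
    2 * s ^ (5 + c) ∎
    where
      open ≤-Reasoning
      open +-*-Solver
      s = 4 + a
      5+c≤ : 5 + c ≤ 2 * (4 + c)
      5+c≤ = ≤-trans (m≤m+n (5 + c) (3 + c)) (≤-reflexive (solve 1 (λ c → con 5 :+ c :+ (con 3 :+ c) := con 2 :* (con 4 :+ c)) refl c))
      -- 2 log(a,c) - log(a,c+1) = 1 + (3 + c)(2 + a) + (5 + a)(1 + c)
      slack = suc s * (1 + (3 + c) * (2 + a) + (5 + a) * (1 + c)) + 3
      doubled : suc s * logarithm a (suc c) + 3 + slack ≡ 2 * (suc s * logarithm a c + 3)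
      doubled = solve 2 (λ a c → (con 5 :+ a) :* (con 1 :+ (con 5 :+ c) :* (con 2 :+ a) :+ (con 5 :+ a) :* (con 3 :+ c)) :+ con 3 :+ ((con 5 :+ a) :* (con 1 :+ (con 3 :+ c) :* (con 2 :+ a) :+ (con 5 :+ a) :* (con 1 :+ c)) :+ con 3) := con 2 :* ((con 5 :+ a) :* (con 1 :+ (con 4 :+ c) :* (con 2 :+ a) :+ (con 5 :+ a) :* (con 2 :+ c)) :+ con 3)) refl a c

receiver-p≥4 : ∀ m n a → 4 ≤ Types m n → Receiver m n (4 + a) (2 * (4 + a) ^ Types m n * Types m n ^ (4 + a))
receiver-p≥4 m n a 4≤p = one-probe m n (3 + a) (logarithm a c) (≤-trans (s≤s (s≤s z≤n)) 4≤p)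
    (subst (λ q → q * size q s ≤ 2 ^ B) p≡ (logarithm-bound a c))
    (≤-trans (first (logarithm a c) (s≤logarithm a c)) (*-cancelˡ-≤ 2 (subst (λ q → 2 * (2 * (suc s * B + 3)) ≤ 2 * s ^ q) p≡
      (≤-trans (≤-reflexive (symm (*-assoc 2 2 (suc s * B + 3)))) (≤-trans (*-monoˡ-≤ (suc s * B + 3) (m≤m+n 4 c)) (exponents a c))))))
    (subst (λ q → q * (suc s * B + 3) ≤ 2 * s ^ q) p≡ (exponents a c))
  where
    c = Types m n ∸ 4
    s = 4 + a
    B = logarithm a c
    p≡ : 4 + c ≡ Types m n
    p≡ = m+[n∸m]≡n 4≤p
    s≤logarithm : ∀ a c → 4 + a ≤ logarithm a c
    s≤logarithm a c = ≤-trans (m≤m+n (4 + a) (15 + 5 * a + 7 * c + 2 * (a * c)))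
      (≤-reflexive (solve 2 (λ a c → con 4 :+ a :+ (con 15 :+ con 5 :* a :+ con 7 :* c :+ con 2 :* (a :* c)) := con 1 :+ (con 4 :+ c) :* (con 2 :+ a) :+ (con 5 :+ a) :* (con 2 :+ c)) refl a c))
      where open +-*-Solver
    first : ∀ L → s ≤ L → s * L + s + 3 ≤ 2 * (suc s * L + 3)
    first L s≤L = begin
      s * L + s + 3   ≤⟨ +-monoˡ-≤ 3 (+-monoʳ-≤ (s * L) s≤L) ⟩
      s * L + L + 3   ≡⟨ cong (_+ 3) (+-comm (s * L) L) ⟩
      suc s * L + 3   ≤⟨ m≤m+n _ _ ⟩
      2 * (suc s * L + 3) ∎
      where open ≤-Reasoning

-- Explicit parameters, and random targets for three types.

^-cancelˡ-≤ : ∀ k .{{_ : NonZero k}} {a b} → a ^ k ≤ b ^ k → a ≤ b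
^-cancelˡ-≤ k {a} {b} le with a ≤? b
... | yes q = q
... | no ¬q = contradiction le (<⇒≱ (^-monoˡ-< k (≰⇒> ¬q)))

-- The parameters of the random construction, for p types and lists of at most s constraints:
-- the numbers of vertices and of probes, the tilt y of the Chernoff bound, and the number of factors
-- (z + x) / z gained from blocks of h vertices.
record Parameters (p s' : ℕ) : Set where
  field
    M k y h₁ z₁ x₁ e₁ h₂ z₂ x₂ e₂ : ℕ
    y-pos     : 0 < y
    k-pos     : 0 < k
    M-big     : s' + s' < M
    z₁-pos    : 0 < z₁
    z₂-pos    : 0 < z₂
    gain₁     : x₁ * (p ^ suc s' * y) ≤ (y ∸ 1) * h₁ * z₁
    blocks₁   : h₁ * e₁ ≤ M ∸ suc s'
    rate₁     : (p * M) ^ suc s' * y ^ (suc s' + k ∸ 1) * 4 * z₁ ^ e₁ ≤ 1 * suc s' ! * (z₁ + x₁) ^ e₁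
    gain₂     : x₂ * (p ^ suc s' * p ^ k) ≤ (p ^ k ∸ (p ∸ 1) ^ k) * h₂ * z₂
    blocks₂   : h₂ * e₂ ≤ M ∸ (suc s' + k)
    rate₂     : p * ((p * M) ^ suc s' * M ^ k) * 4 * z₂ ^ e₂ ≤ 1 * (suc s' ! * k !) * (z₂ + x₂) ^ e₂

from-parameters : ∀ m n s' p → p ≡ Types m n → 2 ≤ p → (P : Parameters p s') → Receiver m n (suc s') (Parameters.M P)
from-parameters m n s' _ refl 2≤p P = two-families′ m n s' M k y 4 1 1 h₁ z₁ x₁ e₁ h₂ z₂ x₂ e₂ 2≤p
    y-pos k-pos (s≤s (s≤s (s≤s z≤n))) M-big z₁-pos z₂-pos gain₁ blocks₁ rate₁ gain₂ blocks₂ rate₂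
  where open Parameters P

private
  by-evaluation : ∀ {a b} → Data.Bool.T (a ≤ᵇ b) → a ≤ b
  by-evaluation {a} {b} = ≤ᵇ⇒≤ a b

  -- With y = 4, `h₁` = 81 · 4/3 = 108 is the least block that gains a factor 2, and 95 such blocks
  -- fit. For the separated family four blocks' worth of gain is split finer, into factors 5/4.
  parameters-3-4 : Parameters 3 3
  parameters-3-4 = record
    { M = 2 * 4 ^ 3 * 3 ^ 4 ; k = 2 ; y = 4 ; h₁ = 108 ; z₁ = 1 ; x₁ = 1 ; e₁ = 95 ; h₂ = 37 ; z₂ = 4 ; x₂ = 1 ; e₂ = 280
    ; y-pos = by-evaluation tt ; k-pos = by-evaluation tt ; M-big = by-evaluation tt ; z₁-pos = by-evaluation tt ; z₂-pos = by-evaluation tt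
    ; gain₁ = by-evaluation tt ; blocks₁ = by-evaluation tt ; rate₁ = by-evaluation tt
    ; gain₂ = by-evaluation tt ; blocks₂ = by-evaluation tt ; rate₂ = by-evaluation tt }

  parameters-3-5 : Parameters 3 4
  parameters-3-5 = record
    { M = 2 * 5 ^ 3 * 3 ^ 5 ; k = 2 ; y = 4 ; h₁ = 324 ; z₁ = 1 ; x₁ = 1 ; e₁ = 187 ; h₂ = 438 ; z₂ = 1 ; x₂ = 1 ; e₂ = 138
    ; y-pos = by-evaluation tt ; k-pos = by-evaluation tt ; M-big = by-evaluation tt ; z₁-pos = by-evaluation tt ; z₂-pos = by-evaluation tt
    ; gain₁ = by-evaluation tt ; blocks₁ = by-evaluation tt ; rate₁ = by-evaluation tt
    ; gain₂ = by-evaluation tt ; blocks₂ = by-evaluation tt ; rate₂ = by-evaluation tt }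

  parameters-3-6 : Parameters 3 5
  parameters-3-6 = record
    { M = 2 * 6 ^ 3 * 3 ^ 6 ; k = 2 ; y = 4 ; h₁ = 972 ; z₁ = 1 ; x₁ = 1 ; e₁ = 323 ; h₂ = 1313 ; z₂ = 1 ; x₂ = 1 ; e₂ = 239
    ; y-pos = by-evaluation tt ; k-pos = by-evaluation tt ; M-big = by-evaluation tt ; z₁-pos = by-evaluation tt ; z₂-pos = by-evaluation tt
    ; gain₁ = by-evaluation tt ; blocks₁ = by-evaluation tt ; rate₁ = by-evaluation tt
    ; gain₂ = by-evaluation tt ; blocks₂ = by-evaluation tt ; rate₂ = by-evaluation tt }

  -- Blocks of four vertices with gain 519/512 lose much less against the true exponential than
  -- blocks that gain a factor 2. Further probes raise the exponent from 1/2 to 1 - 2^(-k) per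
  -- expected solution, at a cost of M each in the union bound.
  parameters-2-8 : Parameters 2 7
  parameters-2-8 = record
    { M = 2 * 8 ^ 2 * 2 ^ 8 ; k = 3 ; y = 8 ; h₁ = 4 ; z₁ = 512 ; x₁ = 7 ; e₁ = 8189 ; h₂ = 4 ; z₂ = 512 ; x₂ = 7 ; e₂ = 8189
    ; y-pos = by-evaluation tt ; k-pos = by-evaluation tt ; M-big = by-evaluation tt ; z₁-pos = by-evaluation tt ; z₂-pos = by-evaluation tt
    ; gain₁ = by-evaluation tt ; blocks₁ = by-evaluation tt ; rate₁ = by-evaluation tt
    ; gain₂ = by-evaluation tt ; blocks₂ = by-evaluation tt ; rate₂ = by-evaluation tt }

  parameters-2-9 : Parameters 2 8
  parameters-2-9 = record
    { M = 2 * 9 ^ 2 * 2 ^ 9 ; k = 4 ; y = 8 ; h₁ = 64 ; z₁ = 64 ; x₁ = 7 ; e₁ = 1295 ; h₂ = 64 ; z₂ = 128 ; x₂ = 15 ; e₂ = 1295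
    ; y-pos = by-evaluation tt ; k-pos = by-evaluation tt ; M-big = by-evaluation tt ; z₁-pos = by-evaluation tt ; z₂-pos = by-evaluation tt
    ; gain₁ = by-evaluation tt ; blocks₁ = by-evaluation tt ; rate₁ = by-evaluation tt
    ; gain₂ = by-evaluation tt ; blocks₂ = by-evaluation tt ; rate₂ = by-evaluation tt }

  parameters-2-10 : Parameters 2 9
  parameters-2-10 = record
    { M = 2 * 10 ^ 2 * 2 ^ 10 ; k = 4 ; y = 8 ; h₁ = 128 ; z₁ = 64 ; x₁ = 7 ; e₁ = 1599 ; h₂ = 128 ; z₂ = 128 ; x₂ = 15 ; e₂ = 1599
    ; y-pos = by-evaluation tt ; k-pos = by-evaluation tt ; M-big = by-evaluation tt ; z₁-pos = by-evaluation tt ; z₂-pos = by-evaluation tt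
    ; gain₁ = by-evaluation tt ; blocks₁ = by-evaluation tt ; rate₁ = by-evaluation tt
    ; gain₂ = by-evaluation tt ; blocks₂ = by-evaluation tt ; rate₂ = by-evaluation tt }

  parameters-2-11 : Parameters 2 10
  parameters-2-11 = record
    { M = 2 * 11 ^ 2 * 2 ^ 11 ; k = 4 ; y = 8 ; h₁ = 256 ; z₁ = 64 ; x₁ = 7 ; e₁ = 1935 ; h₂ = 256 ; z₂ = 128 ; x₂ = 15 ; e₂ = 1935
    ; y-pos = by-evaluation tt ; k-pos = by-evaluation tt ; M-big = by-evaluation tt ; z₁-pos = by-evaluation tt ; z₂-pos = by-evaluation tt
    ; gain₁ = by-evaluation tt ; blocks₁ = by-evaluation tt ; rate₁ = by-evaluation tt
    ; gain₂ = by-evaluation tt ; blocks₂ = by-evaluation tt ; rate₂ = by-evaluation tt }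

  one-probe-at : ∀ m n s' B p → p ≡ Types m n → let s = suc s' in 2 ≤ p →
    p * size p s ≤ 2 ^ B → s * B + s + 3 ≤ s ^ p → p * (suc s * B + 3) ≤ 2 * s ^ p → Receiver m n s (size p s)
  one-probe-at m n s' B _ refl = one-probe m n s' B

  -- For p = 3 and s ≥ 7: s³ ≤ 2^(s+2), and log₂ (3 M) ≤ 3 s + 5.
  cube≤ : ∀ a → (7 + a) ^ 3 ≤ 2 ^ (9 + a)
  cube≤ zero    = by-evaluation tt
  cube≤ (suc a) = begin
    (8 + a) ^ 3 ≤⟨ m≤m+n _ (a * (a * a) + 18 * (a * a) + 102 * a + 174) ⟩
    (8 + a) ^ 3 + (a * (a * a) + 18 * (a * a) + 102 * a + 174)
      ≡⟨ solve 1 (λ a → (con 8 :+ a) :* ((con 8 :+ a) :* ((con 8 :+ a) :* con 1)) :+ (a :* (a :* a) :+ con 18 :* (a :* a) :+ con 102 :* a :+ con 174) := con 2 :* ((con 7 :+ a) :* ((con 7 :+ a) :* ((con 7 :+ a) :* con 1)))) refl a ⟩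
    2 * (7 + a) ^ 3 ≤⟨ *-monoʳ-≤ 2 (cube≤ a) ⟩
    2 ^ (10 + a) ∎
    where open ≤-Reasoning
          open +-*-Solver

  receiver-p=3-big : ∀ m n a → 3 ≡ Types m n → Receiver m n (7 + a) (size 3 (7 + a))
  receiver-p=3-big m n a p≡ = one-probe-at m n (6 + a) (3 * s + 5) 3 p≡ (s≤s (s≤s z≤n)) log-bound c₁ c₂
    where
      open ≤-Reasoning
      open +-*-Solver
      s = 7 + a
      log-bound : 3 * size 3 s ≤ 2 ^ (3 * s + 5)
      log-bound = begin
        3 * (2 * s ^ 3 * 3 ^ s) ≤⟨ *-mono-≤ {3} {4} (by-evaluation tt) (*-mono-≤ (*-monoʳ-≤ 2 (cube≤ a)) (^-monoˡ-≤ s {3} {4} (by-evaluation tt))) ⟩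
        4 * (2 * 2 ^ (9 + a) * (2 ^ 2) ^ s) ≡⟨ cong (λ z → 4 * (2 * 2 ^ (9 + a) * z)) (^-*-assoc 2 2 s) ⟩
        4 * (2 * 2 ^ (9 + a) * 2 ^ (2 * s)) ≡⟨ solve 2 (λ x y → con 4 :* (con 2 :* x :* y) := con 2 :* (con 2 :* (con 2 :* x)) :* y) refl (2 ^ (9 + a)) (2 ^ (2 * s)) ⟩
        2 ^ (12 + a) * 2 ^ (2 * s) ≡⟨ ^-distribˡ-+-* 2 (12 + a) (2 * s) ⟨
        2 ^ (12 + a + 2 * s) ≡⟨ cong (2 ^_) (solve 1 (λ a → con 12 :+ a :+ con 2 :* (con 7 :+ a) := con 3 :* (con 7 :+ a) :+ con 5) refl a) ⟩
        2 ^ (3 * s + 5) ∎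
      c₁ : s * (3 * s + 5) + s + 3 ≤ s ^ 3
      c₁ = begin
        s * (3 * s + 5) + s + 3 ≤⟨ m≤m+n _ (a * (a * a) + 18 * (a * a) + 99 * a + 151) ⟩
        s * (3 * s + 5) + s + 3 + (a * (a * a) + 18 * (a * a) + 99 * a + 151)
          ≡⟨ solve 1 (λ a → (con 7 :+ a) :* (con 3 :* (con 7 :+ a) :+ con 5) :+ (con 7 :+ a) :+ con 3 :+ (a :* (a :* a) :+ con 18 :* (a :* a) :+ con 99 :* a :+ con 151) := (con 7 :+ a) :* ((con 7 :+ a) :* ((con 7 :+ a) :* con 1))) refl a ⟩
        s ^ 3 ∎
      c₂ : 3 * (suc s * (3 * s + 5) + 3) ≤ 2 * s ^ 3
      c₂ = begin
        3 * (suc s * (3 * s + 5) + 3) ≤⟨ m≤m+n _ (2 * (a * (a * a)) + 33 * (a * a) + 144 * a + 53) ⟩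
        3 * (suc s * (3 * s + 5) + 3) + (2 * (a * (a * a)) + 33 * (a * a) + 144 * a + 53)
          ≡⟨ solve 1 (λ a → con 3 :* ((con 8 :+ a) :* (con 3 :* (con 7 :+ a) :+ con 5) :+ con 3) :+ (con 2 :* (a :* (a :* a)) :+ con 33 :* (a :* a) :+ con 144 :* a :+ con 53) := con 2 :* ((con 7 :+ a) :* ((con 7 :+ a) :* ((con 7 :+ a) :* con 1)))) refl a ⟩
        2 * s ^ 3 ∎

receiver-p=3 : ∀ m n a → 3 ≡ Types m n → Receiver m n (4 + a) (2 * (4 + a) ^ 3 * 3 ^ (4 + a))
receiver-p=3 m n 0 p≡ = from-parameters m n 3 3 p≡ (by-evaluation tt) parameters-3-4
receiver-p=3 m n 1 p≡ = from-parameters m n 4 3 p≡ (by-evaluation tt) parameters-3-5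
receiver-p=3 m n 2 p≡ = from-parameters m n 5 3 p≡ (by-evaluation tt) parameters-3-6
receiver-p=3 m n (suc (suc (suc a))) p≡ = receiver-p=3-big m n a p≡

-- Random targets for two types and s ≥ 8.

private
  -- Comparing twelfth powers keeps all the exponents integral.
  compare-powers : ∀ X R d z w → X ^ 12 ≤ 2 ^ (3 * d * R) → 2 ^ d * z ^ 64 ≤ w ^ 64 → X * z ^ (16 * R) ≤ w ^ (16 * R)
  compare-powers X R d z w X≤ zw = ^-cancelˡ-≤ 12 (begin
    (X * z ^ (16 * R)) ^ 12            ≡⟨ ^-distribʳ-* 12 X (z ^ (16 * R)) ⟩
    X ^ 12 * (z ^ (16 * R)) ^ 12       ≤⟨ *-monoˡ-≤ _ X≤ ⟩
    2 ^ (3 * d * R) * (z ^ (16 * R)) ^ 12 ≡⟨ cong₂ _*_ (trans (cong (2 ^_) (solve 2 (λ d r → con 3 :* d :* r := d :* (con 3 :* r)) refl d R)) (symm (^-*-assoc 2 d (3 * R)))) (regroup z) ⟩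
    (2 ^ d) ^ (3 * R) * (z ^ 64) ^ (3 * R) ≡⟨ ^-distribʳ-* (3 * R) (2 ^ d) (z ^ 64) ⟨
    (2 ^ d * z ^ 64) ^ (3 * R)         ≤⟨ ^-monoˡ-≤ (3 * R) zw ⟩
    (w ^ 64) ^ (3 * R)                 ≡⟨ regroup w ⟨
    (w ^ (16 * R)) ^ 12                ∎)
    where
      open ≤-Reasoning
      open +-*-Solver
      regroup : ∀ z → (z ^ (16 * R)) ^ 12 ≡ (z ^ 64) ^ (3 * R)
      regroup z = trans (^-*-assoc z (16 * R) 12)
        (trans (cong (z ^_) (solve 1 (λ r → con 16 :* r :* con 12 := con 64 :* (con 3 :* r)) refl R)) (symm (^-*-assoc z 64 (3 * R))))

  cube≤2^ : ∀ a → (10 + a) ^ 3 ≤ 2 ^ (10 + a)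
  cube≤2^ zero    = by-evaluation tt
  cube≤2^ (suc a) = begin
    (11 + a) ^ 3 ≤⟨ m≤m+n _ (a * (a * a) + 27 * (a * a) + 237 * a + 669) ⟩
    (11 + a) ^ 3 + (a * (a * a) + 27 * (a * a) + 237 * a + 669)
      ≡⟨ solve 1 (λ a → (con 11 :+ a) :* ((con 11 :+ a) :* ((con 11 :+ a) :* con 1)) :+ (a :* (a :* a) :+ con 27 :* (a :* a) :+ con 237 :* a :+ con 669) := con 2 :* ((con 10 :+ a) :* ((con 10 :+ a) :* ((con 10 :+ a) :* con 1)))) refl a ⟩
    2 * (10 + a) ^ 3 ≤⟨ *-monoʳ-≤ 2 (cube≤2^ a) ⟩
    2 ^ (11 + a) ∎
    where open ≤-Reasoning
          open +-*-Solver

  -- Here h = 2^(s - 3) and R = s² - 1, so M = 16 h (R + 1). The 16 R blocks of h vertices leave 16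
  -- h vertices over, enough for the s fixed vertices and the four probes.
  module Large (s' h R : ℕ) (Q≡ : 2 ^ suc s' ≡ 8 * h) (square : suc s' * suc s' ≡ suc R)
               (12≤s : 12 ≤ suc s') (s+4≤16h : suc s' + 4 ≤ 16 * h) (cube : suc s' ^ 3 ≤ 2 ^ suc s') where
    open ≤-Reasoning
    open +-*-Solver
    s = suc s'
    Q = 2 ^ s
    M = size 2 s

    M≡ : M ≡ 16 * h * suc R
    M≡ = trans (cong (2 * s ^ 2 *_) Q≡)
           (trans (solve 2 (λ s h → con 2 :* (s :* (s :* con 1)) :* (con 8 :* h) := con 16 :* h :* (s :* s)) refl s h)
               (cong (16 * h *_) square))

    blocks : ∀ d → d ≤ s + 4 → h * (16 * R) ≤ M ∸ d
    blocks d d≤ = begin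
      h * (16 * R)                   ≡⟨ m+n∸m≡n (16 * h) (h * (16 * R)) ⟨
      16 * h + h * (16 * R) ∸ 16 * h ≡⟨ cong (_∸ 16 * h) (solve 2 (λ h r → con 16 :* h :+ h :* (con 16 :* r) := con 16 :* h :* (con 1 :+ r)) refl h R) ⟩
      16 * h * suc R ∸ 16 * h        ≡⟨ cong (_∸ 16 * h) M≡ ⟨
      M ∸ 16 * h                     ≤⟨ ∸-monoʳ-≤ M (≤-trans d≤ s+4≤16h) ⟩
      M ∸ d                          ∎

    12s≤s² : 12 * s ≤ s * s
    12s≤s² = *-monoˡ-≤ s 12≤s

    s⁶≤ : s ^ 3 * s ^ 3 ≤ 2 ^ s * 2 ^ s
    s⁶≤ = *-mono-≤ cube cube

    -- The estimate s³ ≤ 2^s bounds s² by 2^(2s/3); cubing makes the exponent integral.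
    M³≤ : M ^ 3 ≤ 2 ^ (3 + 5 * s)
    M³≤ = begin
      M ^ 3 ≡⟨ solve 2 (λ s t → (con 2 :* (s :* (s :* con 1)) :* t) :* ((con 2 :* (s :* (s :* con 1)) :* t) :* ((con 2 :* (s :* (s :* con 1)) :* t) :* con 1)) := con 8 :* (s :* (s :* (s :* con 1)) :* (s :* (s :* (s :* con 1)))) :* (t :* (t :* t))) refl s (2 ^ s) ⟩
      8 * (s ^ 3 * s ^ 3) * (2 ^ s * (2 ^ s * 2 ^ s)) ≤⟨ *-monoˡ-≤ (2 ^ s * (2 ^ s * 2 ^ s)) (*-monoʳ-≤ 8 s⁶≤) ⟩
      8 * (2 ^ s * 2 ^ s) * (2 ^ s * (2 ^ s * 2 ^ s)) ≡⟨ solve 1 (λ t → con 8 :* (t :* t) :* (t :* (t :* t)) := con 8 :* (t :* (t :* (t :* (t :* (t :* con 1)))))) refl (2 ^ s) ⟩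
      2 ^ 3 * (2 ^ s) ^ 5 ≡⟨ cong (2 ^ 3 *_) (trans (^-*-assoc 2 s 5) (cong (2 ^_) (*-comm s 5))) ⟩
      2 ^ 3 * 2 ^ (5 * s) ≡⟨ ^-distribˡ-+-* 2 3 (5 * s) ⟨
      2 ^ (3 + 5 * s) ∎

    2M³≤ : (2 * M) ^ 3 ≤ 2 ^ (6 + 5 * s)
    2M³≤ = begin
      (2 * M) ^ 3 ≡⟨ ^-distribʳ-* 3 2 M ⟩
      2 ^ 3 * M ^ 3 ≤⟨ *-monoʳ-≤ (2 ^ 3) M³≤ ⟩
      2 ^ 3 * 2 ^ (3 + 5 * s) ≡⟨ ^-distribˡ-+-* 2 3 (3 + 5 * s) ⟨
      2 ^ (6 + 5 * s) ∎

    swap-^ : ∀ x b c → (x ^ b) ^ c ≡ (x ^ c) ^ b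
    swap-^ x b c = trans (^-*-assoc x b c) (trans (cong (x ^_) (*-comm b c)) (symm (^-*-assoc x c b)))

    2Mˢ≤ : ((2 * M) ^ s) ^ 3 ≤ 2 ^ ((6 + 5 * s) * s)
    2Mˢ≤ = begin
      ((2 * M) ^ s) ^ 3 ≡⟨ swap-^ (2 * M) s 3 ⟩
      ((2 * M) ^ 3) ^ s ≤⟨ ^-monoˡ-≤ s 2M³≤ ⟩
      (2 ^ (6 + 5 * s)) ^ s ≡⟨ ^-*-assoc 2 (6 + 5 * s) s ⟩
      2 ^ ((6 + 5 * s) * s) ∎

    twelfth : ∀ X c d → X ^ 3 ≤ 2 ^ c → c * 4 ≤ 3 * d * R → X ^ 12 ≤ 2 ^ (3 * d * R)
    twelfth X c d X³≤ le = begin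
      X ^ 12      ≡⟨ ^-*-assoc X 3 4 ⟨
      (X ^ 3) ^ 4 ≤⟨ ^-monoˡ-≤ 4 X³≤ ⟩
      (2 ^ c) ^ 4 ≡⟨ ^-*-assoc 2 c 4 ⟩
      2 ^ (c * 4) ≤⟨ ^-monoʳ-≤ 2 le ⟩
      2 ^ (3 * d * R) ∎

    -- Sixty-four blocks gain (71/64)^64 ≥ 2^9. What is left to prove is 20 s² + 60 s + 159 ≤ 27 s²,
    -- where 159 ≤ 24 s and 84 s ≤ 7 s²: this is where s ≥ 12 enters. In `rate₂` the gain is
    -- (143/128)^64 ≥ 2^10 and the final step 120 s ≤ 10 s² needs the same bound.
    rate₁ : (2 * M) ^ s * 8 ^ (s + 4 ∸ 1) * 4 * 64 ^ (16 * R) ≤ 1 * s ! * 71 ^ (16 * R)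
    rate₁ = ≤-trans (compare-powers X R 9 64 71 (twelfth X c 9 X³≤ c≤) (by-evaluation tt))
              (≤-trans (≤-reflexive (symm (*-identityˡ (71 ^ (16 * R))))) (*-monoˡ-≤ (71 ^ (16 * R)) (≤-trans (1≤n! s) (≤-reflexive (symm (*-identityˡ (s !)))))))
      where
        X = (2 * M) ^ s * 8 ^ (s + 4 ∸ 1) * 4
        c = (6 + 5 * s) * s + 9 * (s + 3) + 6
        X³≤ : X ^ 3 ≤ 2 ^ c
        X³≤ = begin
          X ^ 3 ≡⟨ trans (^-distribʳ-* 3 ((2 * M) ^ s * 8 ^ (s + 4 ∸ 1)) 4) (cong (_* 4 ^ 3) (^-distribʳ-* 3 ((2 * M) ^ s) (8 ^ (s + 4 ∸ 1)))) ⟩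
          ((2 * M) ^ s) ^ 3 * (8 ^ (s + 4 ∸ 1)) ^ 3 * 4 ^ 3
            ≡⟨ cong (λ z → ((2 * M) ^ s) ^ 3 * z * 4 ^ 3) (trans (cong (λ k → (8 ^ k) ^ 3) (solve 1 (λ s → s :+ con 4 := con 1 :+ s :+ con 3) refl s')) (trans (swap-^ 8 (s + 3) 3) (^-*-assoc 2 9 (s + 3)))) ⟩
          ((2 * M) ^ s) ^ 3 * 2 ^ (9 * (s + 3)) * 2 ^ 6 ≤⟨ *-monoˡ-≤ (2 ^ 6) (*-monoˡ-≤ (2 ^ (9 * (s + 3))) 2Mˢ≤) ⟩
          2 ^ ((6 + 5 * s) * s) * 2 ^ (9 * (s + 3)) * 2 ^ 6 ≡⟨ cong (_* 2 ^ 6) (^-distribˡ-+-* 2 ((6 + 5 * s) * s) (9 * (s + 3))) ⟨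
          2 ^ ((6 + 5 * s) * s + 9 * (s + 3)) * 2 ^ 6 ≡⟨ ^-distribˡ-+-* 2 ((6 + 5 * s) * s + 9 * (s + 3)) 6 ⟨
          2 ^ c ∎
        c≤ : c * 4 ≤ 3 * 9 * R
        c≤ = +-cancelʳ-≤ 27 (c * 4) (27 * R) (begin
          c * 4 + 27 ≡⟨ solve 1 (λ s → ((con 6 :+ con 5 :* s) :* s :+ con 9 :* (s :+ con 3) :+ con 6) :* con 4 :+ con 27 := con 20 :* (s :* s) :+ (con 60 :* s :+ con 159)) refl s ⟩
          20 * (s * s) + (60 * s + 159) ≤⟨ +-monoʳ-≤ (20 * (s * s)) (+-monoʳ-≤ (60 * s) (≤-trans {159} {288} (by-evaluation tt) (*-monoʳ-≤ 24 12≤s))) ⟩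
          20 * (s * s) + (60 * s + 24 * s) ≡⟨ solve 1 (λ s → con 20 :* (s :* s) :+ (con 60 :* s :+ con 24 :* s) := con 20 :* (s :* s) :+ con 7 :* (con 12 :* s)) refl s ⟩
          20 * (s * s) + 7 * (12 * s) ≤⟨ +-monoʳ-≤ (20 * (s * s)) (*-monoʳ-≤ 7 12s≤s²) ⟩
          20 * (s * s) + 7 * (s * s) ≡⟨ *-distribʳ-+ (s * s) 20 7 ⟨
          27 * (s * s) ≡⟨ cong (27 *_) square ⟩
          27 * suc R ≡⟨ solve 1 (λ r → con 27 :* (con 1 :+ r) := con 27 :* r :+ con 27) refl R ⟩
          27 * R + 27 ∎)

    rate₂ : 2 * ((2 * M) ^ s * M ^ 4) * 4 * 128 ^ (16 * R) ≤ 1 * (s ! * 4 !) * 143 ^ (16 * R)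
    rate₂ = ≤-trans (compare-powers X R 10 128 143 (twelfth X c 10 X³≤ c≤) (by-evaluation tt))
              (≤-trans (≤-reflexive (symm (*-identityˡ (143 ^ (16 * R))))) (*-monoˡ-≤ (143 ^ (16 * R)) (≤-trans (*-mono-≤ (1≤n! s) (1≤n! 4)) (≤-reflexive (symm (*-identityˡ (s ! * 4 !)))))))
      where
        X = 2 * ((2 * M) ^ s * M ^ 4) * 4
        c = (6 + 5 * s) * s + (3 + 5 * s) * 4 + 9
        X³≤ : X ^ 3 ≤ 2 ^ c
        X³≤ = begin
          X ^ 3 ≡⟨ solve 2 (λ x y → (con 2 :* (x :* y) :* con 4) :* ((con 2 :* (x :* y) :* con 4) :* ((con 2 :* (x :* y) :* con 4) :* con 1)) := x :* (x :* (x :* con 1)) :* (y :* (y :* (y :* con 1))) :* con 512) refl ((2 * M) ^ s) (M ^ 4) ⟩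
          ((2 * M) ^ s) ^ 3 * (M ^ 4) ^ 3 * 2 ^ 9 ≡⟨ cong (λ z → ((2 * M) ^ s) ^ 3 * z * 2 ^ 9) (swap-^ M 4 3) ⟩
          ((2 * M) ^ s) ^ 3 * (M ^ 3) ^ 4 * 2 ^ 9 ≤⟨ *-monoˡ-≤ (2 ^ 9) (*-mono-≤ 2Mˢ≤ (^-monoˡ-≤ 4 M³≤)) ⟩
          2 ^ ((6 + 5 * s) * s) * (2 ^ (3 + 5 * s)) ^ 4 * 2 ^ 9 ≡⟨ cong (λ z → 2 ^ ((6 + 5 * s) * s) * z * 2 ^ 9) (^-*-assoc 2 (3 + 5 * s) 4) ⟩
          2 ^ ((6 + 5 * s) * s) * 2 ^ ((3 + 5 * s) * 4) * 2 ^ 9 ≡⟨ cong (_* 2 ^ 9) (^-distribˡ-+-* 2 ((6 + 5 * s) * s) ((3 + 5 * s) * 4)) ⟨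
          2 ^ ((6 + 5 * s) * s + (3 + 5 * s) * 4) * 2 ^ 9 ≡⟨ ^-distribˡ-+-* 2 ((6 + 5 * s) * s + (3 + 5 * s) * 4) 9 ⟨
          2 ^ c ∎
        c≤ : c * 4 ≤ 3 * 10 * R
        c≤ = +-cancelʳ-≤ 30 (c * 4) (30 * R) (begin
          c * 4 + 30 ≡⟨ solve 1 (λ s → ((con 6 :+ con 5 :* s) :* s :+ (con 3 :+ con 5 :* s) :* con 4 :+ con 9) :* con 4 :+ con 30 := con 20 :* (s :* s) :+ (con 104 :* s :+ con 114)) refl s ⟩
          20 * (s * s) + (104 * s + 114) ≤⟨ +-monoʳ-≤ (20 * (s * s)) (+-monoʳ-≤ (104 * s) (≤-trans {114} {192} (by-evaluation tt) (*-monoʳ-≤ 16 12≤s))) ⟩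
          20 * (s * s) + (104 * s + 16 * s) ≡⟨ solve 1 (λ s → con 20 :* (s :* s) :+ (con 104 :* s :+ con 16 :* s) := con 20 :* (s :* s) :+ con 10 :* (con 12 :* s)) refl s ⟩
          20 * (s * s) + 10 * (12 * s) ≤⟨ +-monoʳ-≤ (20 * (s * s)) (*-monoʳ-≤ 10 12s≤s²) ⟩
          20 * (s * s) + 10 * (s * s) ≡⟨ *-distribʳ-+ (s * s) 20 10 ⟨
          30 * (s * s) ≡⟨ cong (30 *_) square ⟩
          30 * suc R ≡⟨ solve 1 (λ r → con 30 :* (con 1 :+ r) := con 30 :* r :+ con 30) refl R ⟩
          30 * R + 30 ∎)

    parameters : Parameters 2 s'
    parameters = record
      { M = M ; k = 4 ; y = 8 ; h₁ = h ; z₁ = 64 ; x₁ = 7 ; e₁ = 16 * R ; h₂ = h ; z₂ = 128 ; x₂ = 15 ; e₂ = 16 * R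
      ; y-pos = by-evaluation tt ; k-pos = by-evaluation tt ; M-big = M-big ; z₁-pos = by-evaluation tt ; z₂-pos = by-evaluation tt
      ; gain₁ = ≤-reflexive (trans (cong (λ q → 7 * (q * 8)) Q≡) (solve 1 (λ h → con 7 :* (con 8 :* h :* con 8) := con 7 :* h :* con 64) refl h))
      ; blocks₁ = blocks s (m≤m+n s 4) ; rate₁ = rate₁
      ; gain₂ = ≤-reflexive (trans (cong (λ q → 15 * (q * 16)) Q≡) (solve 1 (λ h → con 15 :* (con 8 :* h :* con 16) := con 15 :* h :* con 128) refl h))
      ; blocks₂ = blocks (s + 4) ≤-refl ; rate₂ = rate₂ }
      where
        M-big : s' + s' < M
        M-big = begin-strict
          s' + s'           <⟨ +-mono-< (n<1+n s') (n<1+n s') ⟩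
          s + s             ≤⟨ +-mono-≤ (≤-trans (m≤m+n s 4) s+4≤16h) (≤-trans (m≤m+n s 4) s+4≤16h) ⟩
          16 * h + 16 * h   ≡⟨ solve 1 (λ h → con 16 :* h :+ con 16 :* h := con 16 :* h :* con 2) refl h ⟩
          16 * h * 2        ≤⟨ *-monoʳ-≤ (16 * h) (≤-trans (≤-trans {2} {144} (by-evaluation tt) (*-mono-≤ 12≤s 12≤s)) (≤-reflexive square)) ⟩
          16 * h * suc R    ≡⟨ M≡ ⟨
          M                 ∎

private
  large-parameters : ∀ a s' → s' ≡ 11 + a → Σ (Parameters 2 s') λ P → Parameters.M P ≡ size 2 (suc s')
  large-parameters a s' eq = Large.parameters s' h R Q≡ square 12≤s s+4≤ cube , refl
    where
      s = suc s'
      h = 2 ^ (s' ∸ 2)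
      R = s * s ∸ 1
      2≤s' : 2 ≤ s'
      2≤s' = subst (2 ≤_) (symm eq) (s≤s (s≤s z≤n))
      Q≡ : 2 ^ suc s' ≡ 8 * h
      Q≡ = trans (cong (λ k → 2 ^ suc k) (symm (m+[n∸m]≡n 2≤s'))) (^-distribˡ-+-* 2 3 (s' ∸ 2))
      square : s * s ≡ suc R
      square = refl
      12≤s : 12 ≤ s
      12≤s = s≤s (subst (11 ≤_) (symm eq) (m≤m+n 11 a))
      cube : s ^ 3 ≤ 2 ^ s
      cube = subst (λ k → suc k ^ 3 ≤ 2 ^ suc k) (symm eq) (cube≤2^ (2 + a))
      s+4≤ : s + 4 ≤ 16 * h
      s+4≤ = begin
        s + 4         ≤⟨ +-monoʳ-≤ s (≤-trans {4} {12} (by-evaluation tt) 12≤s) ⟩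
        s + s         ≤⟨ +-mono-≤ (<⇒≤ (n<2^n s)) (<⇒≤ (n<2^n s)) ⟩
        2 ^ s + 2 ^ s ≡⟨ cong₂ _+_ Q≡ Q≡ ⟩
        8 * h + 8 * h ≡⟨ *-distribʳ-+ h 8 8 ⟨
        16 * h        ∎
        where open ≤-Reasoning

receiver-p=2-big : ∀ m n a → 2 ≡ Types m n → Receiver m n (8 + a) (2 * (8 + a) ^ 2 * 2 ^ (8 + a))
receiver-p=2-big m n 0 p≡ = from-parameters m n 7 2 p≡ (by-evaluation tt) parameters-2-8
receiver-p=2-big m n 1 p≡ = from-parameters m n 8 2 p≡ (by-evaluation tt) parameters-2-9
receiver-p=2-big m n 2 p≡ = from-parameters m n 9 2 p≡ (by-evaluation tt) parameters-2-10
receiver-p=2-big m n 3 p≡ = from-parameters m n 10 2 p≡ (by-evaluation tt) parameters-2-11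
receiver-p=2-big m n (suc (suc (suc (suc a)))) p≡ = from-parameters m n (11 + a) 2 p≡ (by-evaluation tt) (proj₁ (large-parameters a (11 + a) refl))

-- Two types with s = 6 and s = 7: tolerating exceptional vertices.

module CrowdedFamily (m n M base : ℕ) where
  open Random m n M
  open Sums p
  open Existence m n M base

  -- Some list with j prescribed types has at least mm candidates, but for each of r further vertices fewer
  -- than b of them are joined to it by type t.  The number of words with fewer than b occurrences is
  -- bounded by a geometric progression through its value at mm.
  crowded : (j r b mm Y N₀ num den φ : ℕ) → 0 < Y → 0 < num → 0 < den → 0 < p →
    (∀ h → few h b * (den ^ h * num ^ mm) ≤ N₀ * (den ^ mm * num ^ h)) →
    p * (p ^ j * M ^ (j + r)) * ((N₀ * den ^ mm) ^ r * (((p ^ j ∸ 1) * (p * den) ^ r + num ^ r * Y) ^ (M ∸ (j + r)) * ((p ^ j ∸ 1) * 1 + Y) ^ r)) * base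
      ≤ φ * ((j ! * r !) * ((p ^ (M ∸ (j + r))) ^ r * (p ^ j) ^ (M ∸ (j + r) + r) * (Y ^ mm * (den ^ (M ∸ (j + r)) * num ^ mm) ^ r))) → Family
  crowded j r b mm Y N₀ num den φ 0<Y 0<num 0<den 0<p tangent num≤ = record
    { j = j ; r = r ; b = b ; k = p ; good = λ h a → mm ≤ᵇ (h + a) ; τ = id
    -- These constants clear the denominators of `few h b` ≤ N₀ (num/den)^(h - mm), taken once for
    -- every probe, and of the tilt Y^(h + a - mm) ≥ 1 that holds when there are at least mm
    -- candidates.
    ; θ = Y ^ mm * (den ^ W * num ^ mm) ^ r ; C = (N₀ * den ^ mm) ^ r
    ; U = num ^ r * Y ; D = (p * den) ^ r ; U' = Y ; D' = 1 ; φ = φ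
    ; weights = w ; positive = pos ; rare = num≤ }
    where
      W = M ∸ (j + r)
      instance
        p≢0 : NonZero p
        p≢0 = >-nonZero 0<p
        Y≢0 : NonZero Y
        Y≢0 = >-nonZero 0<Y
        num≢0 : NonZero num
        num≢0 = >-nonZero 0<num
        den≢0 : NonZero den
        den≢0 = >-nonZero 0<den
      pos : 0 < (p ^ W) ^ r * (p ^ j) ^ (W + r) * (Y ^ mm * (den ^ W * num ^ mm) ^ r)
      pos = *-mono-≤ (*-mono-≤ (m^n>0 (p ^ W) {{m^n≢0 p W}} r) (m^n>0 (p ^ j) {{m^n≢0 p j}} (W + r)))
              (*-mono-≤ (m^n>0 Y mm) (m^n>0 (den ^ W * num ^ mm) {{m*n≢0 (den ^ W) (num ^ mm) {{m^n≢0 den W}} {{m^n≢0 num mm}}}} r))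
      w : ∀ h f a a' → (mm ≤ᵇ (h + a)) ≡ true → h + f ≡ W → a + a' ≡ r →
          Y ^ mm * (den ^ W * num ^ mm) ^ r * (few h b * p ^ f) ^ r
            ≤ (N₀ * den ^ mm) ^ r * (((num ^ r * Y) ^ h * ((p * den) ^ r) ^ f) * (Y ^ a * 1 ^ a'))
      w h f a a' g e _ = begin
        Y ^ mm * (den ^ W * num ^ mm) ^ r * (few h b * p ^ f) ^ r
          ≡⟨ *-assoc (Y ^ mm) _ _ ⟩
        Y ^ mm * ((den ^ W * num ^ mm) ^ r * (few h b * p ^ f) ^ r)
          ≡⟨ cong (Y ^ mm *_) (^-distribʳ-* r (den ^ W * num ^ mm) (few h b * p ^ f)) ⟨
        Y ^ mm * (den ^ W * num ^ mm * (few h b * p ^ f)) ^ r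
          ≤⟨ *-mono-≤ (^-monoʳ-≤ Y (≤ᵇ⇒≤ mm (h + a) (subst Data.Bool.T (symm g) tt))) (^-monoˡ-≤ r inner) ⟩
        Y ^ (h + a) * (N₀ * den ^ mm * (num ^ h * (p * den) ^ f)) ^ r
          ≡⟨ cong₂ _*_ (^-distribˡ-+-* Y h a) (trans (^-distribʳ-* r (N₀ * den ^ mm) (num ^ h * (p * den) ^ f)) (cong ((N₀ * den ^ mm) ^ r *_) (^-distribʳ-* r (num ^ h) ((p * den) ^ f)))) ⟩
        Y ^ h * Y ^ a * ((N₀ * den ^ mm) ^ r * ((num ^ h) ^ r * ((p * den) ^ f) ^ r))
          ≡⟨ solve 5 (λ x y c u d → x :* y :* (c :* (u :* d)) := c :* (u :* x :* d :* (y :* con 1))) refl (Y ^ h) (Y ^ a) ((N₀ * den ^ mm) ^ r) ((num ^ h) ^ r) (((p * den) ^ f) ^ r) ⟩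
        (N₀ * den ^ mm) ^ r * ((num ^ h) ^ r * Y ^ h * ((p * den) ^ f) ^ r * (Y ^ a * 1))
          ≡⟨ cong (λ z → (N₀ * den ^ mm) ^ r * z) (cong₂ _*_ (cong₂ _*_ (trans (cong (_* Y ^ h) (swap-^ num h r)) (symm (^-distribʳ-* h (num ^ r) Y))) (swap-^ (p * den) f r)) (cong (Y ^ a *_) (symm (^-zeroˡ a')))) ⟩
        (N₀ * den ^ mm) ^ r * ((num ^ r * Y) ^ h * ((p * den) ^ r) ^ f * (Y ^ a * 1 ^ a')) ∎
        where
          open ≤-Reasoning
          open +-*-Solver
          swap-^ : ∀ x b c → (x ^ b) ^ c ≡ (x ^ c) ^ b
          swap-^ x b c = trans (^-*-assoc x b c) (trans (cong (x ^_) (*-comm b c)) (symm (^-*-assoc x c b)))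
          inner : den ^ W * num ^ mm * (few h b * p ^ f) ≤ N₀ * den ^ mm * (num ^ h * (p * den) ^ f)
          inner = begin
            den ^ W * num ^ mm * (few h b * p ^ f)
              ≡⟨ cong (λ z → z * num ^ mm * (few h b * p ^ f)) (trans (cong (den ^_) (symm e)) (^-distribˡ-+-* den h f)) ⟩
            den ^ h * den ^ f * num ^ mm * (few h b * p ^ f)
              ≡⟨ solve 5 (λ x y z u v → x :* y :* z :* (u :* v) := u :* (x :* z) :* (v :* y)) refl (den ^ h) (den ^ f) (num ^ mm) (few h b) (p ^ f) ⟩
            few h b * (den ^ h * num ^ mm) * (p ^ f * den ^ f)
              ≤⟨ *-monoˡ-≤ (p ^ f * den ^ f) (tangent h) ⟩
            N₀ * (den ^ mm * num ^ h) * (p ^ f * den ^ f)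
              ≡⟨ cong (N₀ * (den ^ mm * num ^ h) *_) (^-distribʳ-* f p den) ⟨
            N₀ * (den ^ mm * num ^ h) * (p * den) ^ f
              ≡⟨ solve 4 (λ n x y z → n :* (x :* y) :* z := n :* x :* (y :* z)) refl N₀ (den ^ mm) (num ^ h) ((p * den) ^ f) ⟩
            N₀ * den ^ mm * (num ^ h * (p * den) ^ f) ∎

CrowdedRate : (p M j r mm Y N₀ num den base φ : ℕ) → Set
CrowdedRate p M j r mm Y N₀ num den base φ =
  p * (p ^ j * M ^ (j + r)) * ((N₀ * den ^ mm) ^ r * (((p ^ j ∸ 1) * (p * den) ^ r + num ^ r * Y) ^ (M ∸ (j + r)) * ((p ^ j ∸ 1) * 1 + Y) ^ r)) * base
    ≤ φ * ((j ! * r !) * ((p ^ (M ∸ (j + r))) ^ r * (p ^ j) ^ (M ∸ (j + r) + r) * (Y ^ mm * (den ^ (M ∸ (j + r)) * num ^ mm) ^ r)))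

Tangent : (p b mm N₀ num den : ℕ) → Set
Tangent p b mm N₀ num den = ∀ h → Sums.few p h b * (den ^ h * num ^ mm) ≤ N₀ * (den ^ mm * num ^ h)

-- Separated probes are rare enough only next to lists with many candidates, and asking for b₁
-- candidates after every list of s constraints is too much for the union bound. So lists of s'
-- constraints are shown to have at least mm candidates, each of them admits at most r last vertices
-- of a given type that leave fewer than b₁, and separation is considered for lists with at least b₁
-- candidates only.
three-families : ∀ m n s' p → p ≡ Types m n → (M r k mm b₁ y Y₁ Y₂ N₀ num den base φ₀ φ₁ φ₂ : ℕ) →
  2 ≤ p → 0 < y → 0 < Y₁ → 0 < Y₂ → 0 < num → 0 < den →
  suc (s' + r) ≤ b₁ → suc s' + k ≤ b₁ → (s' + r) + (s' + r) < M → φ₀ + (φ₁ + (φ₂ + 0)) < base →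
  Tangent p b₁ mm N₀ num den →
  1 * (p ^ s' * M ^ (s' + 0)) * (y ^ (mm ∸ 1) * (((p ^ s' ∸ 1) * y + 1) ^ (M ∸ (s' + 0)) * 1)) * base
      ≤ φ₀ * ((s' ! * 1) * (1 * (p ^ s') ^ (M ∸ (s' + 0) + 0) * y ^ (M ∸ (s' + 0)))) →
  CrowdedRate p M s' (suc r) mm Y₁ N₀ num den base φ₁ →
  CrowdedRate p M (suc s') k b₁ Y₂ ((p ∸ 1) ^ b₁) (p ∸ 1) 1 base φ₂ →
  Receiver m n (suc s') M
three-families m n s' p refl M r k mm b₁ y Y₁ Y₂ N₀ num den base φ₀ φ₁ φ₂ 2≤p 0<y 0<Y₁ 0<Y₂ 0<num 0<den b₁-big k-small M-big share<
  tangent rate₀ rate₁ rate₂ = graph X , random-target X s' r k b₁ 2≤p crowd joined b₁-big k-small M-big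
  where
    0<p : 0 < p
    0<p = ≤-trans (s≤s z≤n) 2≤p
    open Random m n M using (graph)
    open Existence m n M base
    open RandomTarget m n M base
    open CrowdedFamily m n M base
    open Candidates m n M
    fam₀ fam₁ fam₂ : Family
    fam₀ = scarce s' mm y φ₀ (fromℕ< 0<p) 0<y 0<p rate₀
    fam₁ = crowded s' (suc r) b₁ mm Y₁ N₀ num den φ₁ 0<Y₁ 0<num 0<den 0<p tangent rate₁
    fam₂ = crowded (suc s') k 1 b₁ Y₂ ((p ∸ 1) ^ b₁) (p ∸ 1) 1 φ₂ 0<Y₂ (m<n⇒0<n∸m 2≤p) (s≤s z≤n) 0<p
             (λ h → ≤-reflexive (trans (cong₂ (λ x y → x * (y * (p ∸ 1) ^ b₁)) (few-one h) (^-zeroˡ h))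
               (trans (cong ((p ∸ 1) ^ h *_) (+-identityʳ _)) (trans (*-comm ((p ∸ 1) ^ h) _)
                 (cong ((p ∸ 1) ^ b₁ *_) (trans (symm (+-identityʳ _)) (cong (_* (p ∸ 1) ^ h) (symm (^-zeroˡ b₁))))))))) rate₂
    found = exists 0<p (fam₀ ∷ fam₁ ∷ fam₂ ∷ []) share<
    X = proj₁ found
    avoid₁ = All.head (All.tail (proj₂ found))
    avoid₂ = All.head (All.tail (All.tail (proj₂ found)))
    crowd : ∀ L t αs → Unique (images L) → Unique αs → (∀ {α} → α ∈ αs → α ∉ images L) → length L ≡ s' → length αs ≡ suc r →
            ¬ All (λ α → length (candidates X ((α , t) ∷ L)) < b₁) αs
    crowd L t αs u uα dis len lenα = avoid-separated X fam₁ {mm} (λ _ _ → refl) t avoid₁ L αs u uα dis len lenα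
      (avoid-scarce X fam₀ {mm} (λ _ _ → refl) refl zero (All.head (proj₂ found)) L u len)
    joined : ∀ L t αs → Unique (images L) → Unique αs → (∀ {α} → α ∈ αs → α ∉ images L) → length L ≡ suc s' → length αs ≡ k →
             b₁ ≤ length (candidates X L) → ¬ All (λ α → length (candidates X ((α , t) ∷ L)) < 1) αs
    joined L t = avoid-separated X fam₂ {b₁} (λ _ _ → refl) t avoid₂ L

-- Words over two letters, computed row by row.
private
  open Sums 2 using (few)

  pascal : ℕ → List ℕ → List ℕ
  pascal c []       = []
  pascal c (x ∷ xs) = (c + x) ∷ pascal x xs

  few-row : ℕ → ℕ → ℕ → List ℕ
  few-row h k zero    = []
  few-row h k (suc l) = few h (suc k) ∷ few-row h (suc k) l

  pascal-row : ∀ h k l → pascal (few h k) (few-row h k l) ≡ few-row (suc h) k l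
  pascal-row h k zero    = refl
  pascal-row h k (suc l) = cong₂ _∷_ (cong (few h k +_) (symm (+-identityʳ (few h (suc k))))) (pascal-row h (suc k) l)

  last : ℕ → List ℕ → ℕ
  last c []       = c
  last c (x ∷ xs) = last x xs

  last-row : ∀ h k l → last (few h k) (few-row h k l) ≡ few h (k + l)
  last-row h k zero    = cong (few h) (symm (+-identityʳ k))
  last-row h k (suc l) = trans (last-row h (suc k) l) (cong (few h) (symm (+-suc k l)))

  -- Consecutive entries have ratio at most 1/3; this is inherited by the following rows.
  steep : ℕ → List ℕ → Bool
  steep c []       = true
  steep c (x ∷ xs) = (3 * c ≤ᵇ x) ∧ steep x xs

  ∧-split : ∀ {a b} → a ∧ b ≡ true → a ≡ true × b ≡ true
  ∧-split {true} {true} _ = refl , refl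

  ≤ᵇ-sound : ∀ a b → (a ≤ᵇ b) ≡ true → a ≤ b
  ≤ᵇ-sound a b e = ≤ᵇ⇒≤ a b (subst Data.Bool.T (symm e) tt)

  steep-row : ∀ h k l → steep (few h k) (few-row h k l) ≡ true → ∀ i → i < l → 3 * few h (k + i) ≤ few h (suc (k + i))
  steep-row h k (suc l) e zero    _         rewrite +-identityʳ k = ≤ᵇ-sound (3 * few h k) (few h (suc k)) (proj₁ (∧-split e))
  steep-row h k (suc l) e (suc i) (s≤s i<l) rewrite +-suc k i = steep-row h (suc k) l (proj₂ (∧-split e)) i i<l

  Steep : ℕ → ℕ → Set
  Steep h b = ∀ k → k < b → 3 * few h k ≤ few h (suc k)

  steep-step : ∀ h b → Steep h b → Steep (suc h) b
  steep-step h b st zero    lt = z≤n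
  steep-step h b st (suc k) lt = begin
    3 * (few h k + 1 * few h (suc k))         ≡⟨ solve 2 (λ x y → con 3 :* (x :+ con 1 :* y) := con 3 :* x :+ con 1 :* (con 3 :* y)) refl (few h k) (few h (suc k)) ⟩
    3 * few h k + 1 * (3 * few h (suc k))     ≤⟨ +-mono-≤ (st k (<-trans (n<1+n k) lt)) (*-monoʳ-≤ 1 (st (suc k) lt)) ⟩
    few h (suc k) + 1 * few h (suc (suc k))   ∎
    where open ≤-Reasoning
          open +-*-Solver

  -- Row h of the table is below the progression with ratio 4/3 through N₀ in row mm.
  below : ℕ → List ℕ → ℕ → ℕ → Bool
  below zero    xs lo hi = true
  below (suc n) xs lo hi = (last 0 xs * lo ≤ᵇ hi) ∧ below n (pascal 0 xs) (3 * lo) (4 * hi)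

  rows : ℕ → List ℕ → List ℕ
  rows zero    xs = xs
  rows (suc h) xs = rows h (pascal 0 xs)

  rows-row : ∀ b n h → rows n (few-row h 0 b) ≡ few-row (n + h) 0 b
  rows-row b zero    h = refl
  rows-row b (suc n) h = trans (cong (rows n) (pascal-row h 0 b)) (trans (rows-row b n (suc h)) (cong (λ z → few-row z 0 b) (+-suc n h)))

  below-sound : ∀ b n h lo hi → below n (few-row h 0 b) lo hi ≡ true → ∀ i → i < n → few (h + i) b * (3 ^ i * lo) ≤ 4 ^ i * hi
  below-sound b (suc n) h lo hi e zero _ rewrite +-identityʳ h = begin
    few h b * (1 * lo) ≡⟨ cong₂ _*_ (symm (last-row h 0 b)) (*-identityˡ lo) ⟩
    last 0 (few-row h 0 b) * lo ≤⟨ ≤ᵇ-sound _ _ (proj₁ (∧-split e)) ⟩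
    hi ≡⟨ *-identityˡ hi ⟨
    1 * hi ∎
    where open ≤-Reasoning
  below-sound b (suc n) h lo hi e (suc i) (s≤s i<n) rewrite +-suc h i = subst₂ _≤_
      (cong (few (suc h + i) b *_) (trans (symm (*-assoc (3 ^ i) 3 lo)) (cong (_* lo) (*-comm (3 ^ i) 3))))
      (trans (symm (*-assoc (4 ^ i) 4 hi)) (cong (_* hi) (*-comm (4 ^ i) 4)))
      (below-sound b n (suc h) (3 * lo) (4 * hi) (subst (λ z → below n z (3 * lo) (4 * hi) ≡ true) (pascal-row h 0 b) (proj₂ (∧-split e))) i i<n)

  few-row-zero : ∀ b k → few-row 0 k b ≡ replicate b 1
  few-row-zero zero    k = refl
  few-row-zero (suc b) k = cong (1 ∷_) (few-row-zero b (suc k))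

  -- Up to row mm the rows are compared one by one. Beyond it, steepness says that the entry before
  -- the last is at most a third of the last, so the recurrence multiplies the last entry by at most
  -- 4/3, the ratio of the progression.
  tangent-by-table : ∀ b mm N₀ → let b' = suc b in
    below mm (replicate b' 1) (4 ^ mm) (N₀ * 3 ^ mm) ≡ true →
    (last 0 (rows mm (replicate b' 1)) ≤ᵇ N₀) ≡ true → steep 0 (rows mm (replicate b' 1)) ≡ true →
    Tangent 2 b' mm N₀ 4 3
  tangent-by-table b mm N₀ below≡ last≡ steep≡ h with h <? mm
  ... | yes h<mm = subst₂ _≤_ refl (solve 3 (λ x n y → x :* (n :* y) := n :* (y :* x)) refl (4 ^ h) N₀ (3 ^ mm))
          (below-sound b' mm 0 (4 ^ mm) (N₀ * 3 ^ mm) (subst (λ z → below mm z (4 ^ mm) (N₀ * 3 ^ mm) ≡ true) (symm (few-row-zero b' 0)) below≡) h h<mm)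
    where b' = suc b
          open +-*-Solver
  ... | no h≮mm = subst (λ z → few z b' * (3 ^ z * 4 ^ mm) ≤ N₀ * (3 ^ mm * 4 ^ z)) (m+[n∸m]≡n (≮⇒≥ h≮mm)) (proj₁ (climb (h ∸ mm)))
    where
      open ≤-Reasoning
      open +-*-Solver
      b' = suc b
      row≡ : rows mm (replicate b' 1) ≡ few-row mm 0 b'
      row≡ = trans (cong (rows mm) (symm (few-row-zero b' 0))) (trans (rows-row b' mm 0) (cong (λ z → few-row z 0 b') (+-identityʳ mm)))
      climb : ∀ d → few (mm + d) b' * (3 ^ (mm + d) * 4 ^ mm) ≤ N₀ * (3 ^ mm * 4 ^ (mm + d)) × Steep (mm + d) b'
      climb zero rewrite +-identityʳ mm =
        *-monoˡ-≤ (3 ^ mm * 4 ^ mm) (≤-trans (≤-reflexive (symm (trans (cong (last 0) row≡) (last-row mm 0 b')))) (≤ᵇ-sound _ _ last≡)) ,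
        λ k lt → steep-row mm 0 b' (subst (λ z → steep 0 z ≡ true) row≡ steep≡) k lt
      climb (suc d) with climb d
      ... | le , st rewrite +-suc mm d = (begin
          few (suc H) b' * (3 * 3 ^ H * 4 ^ mm) ≡⟨ solve 4 (λ x y z w → (x :+ con 1 :* y) :* (con 3 :* z :* w) := (con 3 :* x :+ con 3 :* y) :* (z :* w)) refl (few H b) (few H b') (3 ^ H) (4 ^ mm) ⟩
          (3 * few H b + 3 * few H b') * (3 ^ H * 4 ^ mm) ≤⟨ *-monoˡ-≤ (3 ^ H * 4 ^ mm) (+-monoˡ-≤ (3 * few H b') (st b ≤-refl)) ⟩
          (few H b' + 3 * few H b') * (3 ^ H * 4 ^ mm) ≡⟨ solve 2 (λ x y → (x :+ con 3 :* x) :* y := con 4 :* (x :* y)) refl (few H b') (3 ^ H * 4 ^ mm) ⟩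
          4 * (few H b' * (3 ^ H * 4 ^ mm)) ≤⟨ *-monoʳ-≤ 4 le ⟩
          4 * (N₀ * (3 ^ mm * 4 ^ H)) ≡⟨ solve 3 (λ n x y → con 4 :* (n :* (x :* y)) := n :* (x :* (con 4 :* y))) refl N₀ (3 ^ mm) (4 ^ H) ⟩
          N₀ * (3 ^ mm * (4 * 4 ^ H)) ∎) , steep-step H b' st
        where H = mm + d

receiver-p=2-s=6 : ∀ m n → 2 ≡ Types m n → Receiver m n 6 4610
-- 4610 = 2 · 6² · 2^6 + 2 uses the whole bound, summand 2 included. The large constant is
-- `few 50 14`, the sum of the binomial coefficients of 50 below 14. The three failure probabilities
-- are 2/10, 1/10 and 1/10.
receiver-p=2-s=6 m n p≡ = three-families m n 5 2 p≡ 4610 8 8 50 14 3 13 39 527046644056 4 3 10 2 1 1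
  (by-evaluation tt) (by-evaluation tt) (by-evaluation tt) (by-evaluation tt) (by-evaluation tt) (by-evaluation tt)
  (by-evaluation tt) (by-evaluation tt) (by-evaluation tt) (by-evaluation tt)
  (tangent-by-table 13 50 527046644056 refl refl refl) (by-evaluation tt) (by-evaluation tt) (by-evaluation tt)

receiver-p=2-s=7 : ∀ m n → 2 ≡ Types m n → Receiver m n 7 12546
receiver-p=2-s=7 m n p≡ = three-families m n 6 2 p≡ 12546 7 9 58 16 4 7 67 44235726874816 4 3 10 2 1 1
  (by-evaluation tt) (by-evaluation tt) (by-evaluation tt) (by-evaluation tt) (by-evaluation tt) (by-evaluation tt)
  (by-evaluation tt) (by-evaluation tt) (by-evaluation tt) (by-evaluation tt)
  (tangent-by-table 15 58 44235726874816 refl refl refl) (by-evaluation tt) (by-evaluation tt) (by-evaluation tt)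

open import Data.Integer using (ℤ; +_; -[1+_]; 0ℤ; 1ℤ; -1ℤ; ∣_∣) renaming (_+_ to _+ᶻ_; _*_ to _*ᶻ_; -_ to -ᶻ_; _-_ to _-ᶻ_; _^_ to _^ᶻ_; _≤_ to _≤ᶻ_)
open import Data.Integer.DivMod using (_%ℕ_; _/ℕ_; n%ℕd<d; a≡a%ℕn+[a/ℕn]*n)
import Data.Integer.Properties as ℤ
import Data.Integer.Solver as ℤ-Solver
open import Data.Nat using (_≡ᵇ_; _%_; _/_)
open import Data.Nat.DivMod using (m≡m%n+[m/n]*n)
open import Data.Fin.Permutation using (Permutation; permutation)
open import Algebra.Properties.CommutativeMonoid.Sum ℤ.+-0-commutativeMonoid using (sum-permute) renaming (sum to sumF)
open import Data.Bool using (_∨_)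
open import Data.List.Membership.Propositional using (find; lose)
open import Data.List.Properties using (map-tabulate; map-++; length-take)
open import Data.Nat.ListAction.Properties using (sum-++)
import Data.List.Relation.Unary.Any as Any

-- Quadratic characters modulo q.

data Sign : Set where
  neg zer pos : Sign

val : Sign → ℤ
val neg = -1ℤ
val zer = 0ℤ
val pos = 1ℤ

infixl 7 _·_
_·_ : Sign → Sign → Sign
zer · _   = zer
pos · y   = y
neg · neg = pos
neg · zer = zer
neg · pos = neg

val-· : ∀ x y → val (x · y) ≡ val x *ᶻ val y
val-· neg neg = refl
val-· neg zer = refl
val-· neg pos = refl
val-· zer neg = refl
val-· zer zer = refl
val-· zer pos = refl
val-· pos neg = refl
val-· pos zer = refl
val-· pos pos = refl

Σℤ : ℕ → (ℕ → ℤ) → ℤ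
Σℤ zero    f = 0ℤ
Σℤ (suc n) f = f 0 +ᶻ Σℤ n (λ i → f (suc i))

Σℤ-cong : ∀ n {f g : ℕ → ℤ} → (∀ i → i < n → f i ≡ g i) → Σℤ n f ≡ Σℤ n g
Σℤ-cong zero    h = refl
Σℤ-cong (suc n) h = cong₂ _+ᶻ_ (h 0 (s≤s z≤n)) (Σℤ-cong n (λ i i<n → h (suc i) (s≤s i<n)))

Σℤ-+ : ∀ n (f g : ℕ → ℤ) → Σℤ n (λ i → f i +ᶻ g i) ≡ Σℤ n f +ᶻ Σℤ n g
Σℤ-+ zero    f g = refl
Σℤ-+ (suc n) f g = trans (cong (f 0 +ᶻ g 0 +ᶻ_) (Σℤ-+ n _ _))
  (solve 4 (λ a b c d → a :+ b :+ (c :+ d) := a :+ c :+ (b :+ d)) refl (f 0) (g 0) (Σℤ n (λ i → f (suc i))) (Σℤ n (λ i → g (suc i))))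
  where open ℤ-Solver.+-*-Solver

Σℤ-*ˡ : ∀ n c (f : ℕ → ℤ) → Σℤ n (λ i → c *ᶻ f i) ≡ c *ᶻ Σℤ n f
Σℤ-*ˡ zero    c f = symm (ℤ.*-zeroʳ c)
Σℤ-*ˡ (suc n) c f = trans (cong (c *ᶻ f 0 +ᶻ_) (Σℤ-*ˡ n c _)) (symm (ℤ.*-distribˡ-+ c (f 0) _))

Σℤ-mono : ∀ n {f g : ℕ → ℤ} → (∀ i → i < n → f i ≤ᶻ g i) → Σℤ n f ≤ᶻ Σℤ n g
Σℤ-mono zero    h = ℤ.≤-refl
Σℤ-mono (suc n) h = ℤ.+-mono-≤ (h 0 (s≤s z≤n)) (Σℤ-mono n (λ i i<n → h (suc i) (s≤s i<n)))

Σℤ-const : ∀ n c → Σℤ n (λ _ → c) ≡ + n *ᶻ c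
Σℤ-const zero    c = symm (ℤ.*-zeroˡ c)
Σℤ-const (suc n) c = trans (cong (c +ᶻ_) (Σℤ-const n c)) (symm (ℤ.suc-* (+ n) c))

Σℤ-sumF : ∀ n (f : ℕ → ℤ) → Σℤ n f ≡ sumF {n} (λ i → f (toℕ i))
Σℤ-sumF zero    f = refl
Σℤ-sumF (suc n) f = cong (f 0 +ᶻ_) (Σℤ-sumF n (λ i → f (suc i)))

sumF-cong : ∀ n {f g : Fin n → ℤ} → f ≗ g → sumF f ≡ sumF g
sumF-cong zero    h = refl
sumF-cong (suc n) h = cong₂ _+ᶻ_ (h zero) (sumF-cong n (h ∘ suc))

module Modular (q : ℕ) .{{_ : NonZero q}} where

  infix 4 _≈_
  record _≈_ (a b : ℤ) : Set where
    constructor by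
    field
      quotient : ℤ
      equation : a ≡ b +ᶻ quotient *ᶻ + q

  ≈-reflexive : ∀ {a b} → a ≡ b → a ≈ b
  ≈-reflexive {a} refl = by 0ℤ (symm (trans (cong (a +ᶻ_) (ℤ.*-zeroˡ (+ q))) (ℤ.+-identityʳ a)))

  ≈-refl : ∀ {a} → a ≈ a
  ≈-refl = ≈-reflexive refl

  ≈-sym : ∀ {a b} → a ≈ b → b ≈ a
  ≈-sym {_} {b} (by k refl) = by (-ᶻ k) (solve 3 (λ b k q → b := b :+ k :* q :+ :- k :* q) refl b k (+ q))
    where open ℤ-Solver.+-*-Solver

  ≈-trans : ∀ {a b c} → a ≈ b → b ≈ c → a ≈ c
  ≈-trans {_} {_} {c} (by k refl) (by l refl) = by (l +ᶻ k) (solve 4 (λ c l k q → c :+ l :* q :+ k :* q := c :+ (l :+ k) :* q) refl c l k (+ q))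
    where open ℤ-Solver.+-*-Solver

  +-cong : ∀ {a b c d} → a ≈ b → c ≈ d → a +ᶻ c ≈ b +ᶻ d
  +-cong {_} {b} {_} {d} (by k refl) (by l refl) = by (k +ᶻ l) (solve 5 (λ b k d l q → b :+ k :* q :+ (d :+ l :* q) := b :+ d :+ (k :+ l) :* q) refl b k d l (+ q))
    where open ℤ-Solver.+-*-Solver

  *-cong : ∀ {a b c d} → a ≈ b → c ≈ d → a *ᶻ c ≈ b *ᶻ d
  *-cong {_} {b} {_} {d} (by k refl) (by l refl) = by (b *ᶻ l +ᶻ k *ᶻ d +ᶻ k *ᶻ l *ᶻ + q)
      (solve 5 (λ b k d l q → (b :+ k :* q) :* (d :+ l :* q) := b :* d :+ (b :* l :+ k :* d :+ k :* l :* q) :* q) refl b k d l (+ q))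
    where open ℤ-Solver.+-*-Solver

  neg-cong : ∀ {a b} → a ≈ b → -ᶻ a ≈ -ᶻ b
  neg-cong {_} {b} (by k refl) = by (-ᶻ k) (solve 3 (λ b k q → :- (b :+ k :* q) := :- b :+ :- k :* q) refl b k (+ q))
    where open ℤ-Solver.+-*-Solver

  ^-cong : ∀ {a b} n → a ≈ b → a ^ᶻ n ≈ b ^ᶻ n
  ^-cong zero    h = ≈-refl
  ^-cong (suc n) h = *-cong h (^-cong n h)

  residue : ℤ → ℕ
  residue z = z %ℕ q

  residue< : ∀ z → residue z < q
  residue< z = n%ℕd<d z q

  residue≈ : ∀ z → + residue z ≈ z
  residue≈ z = ≈-sym (by (z /ℕ q) (a≡a%ℕn+[a/ℕn]*n z q))

  private
    too-big : ∀ a b k → a < q → + a ≡ + b +ᶻ + suc k *ᶻ + q → ⊥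
    too-big a b k a<q e = <⇒≱ a<q (begin
      q             ≤⟨ m≤m+n q (k * q) ⟩
      suc k * q     ≤⟨ m≤n+m (suc k * q) b ⟩
      b + suc k * q ≡⟨ ℤ.+-injective (trans (cong (+ b +ᶻ_) (ℤ.pos-* (suc k) q)) (symm e)) ⟩
      a             ∎)
      where open ≤-Reasoning

  unique-residue : ∀ {a b} → a < q → b < q → + a ≈ + b → a ≡ b
  unique-residue {a} {b} a<q b<q (by (+ zero) e) = ℤ.+-injective (trans e (trans (cong (+ b +ᶻ_) (ℤ.*-zeroˡ (+ q))) (ℤ.+-identityʳ (+ b))))
  unique-residue {a} {b} a<q b<q (by (+ suc k) e) = ⊥-elim (too-big a b k a<q e)
  unique-residue {a} {b} a<q b<q (by -[1+ k ] e) = ⊥-elim (too-big b a k b<q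
      (trans (solve 3 (λ b k q → b := b :+ :- k :* q :+ k :* q) refl (+ b) (+ suc k) (+ q)) (cong (_+ᶻ + suc k *ᶻ + q) (symm e))))
    where open ℤ-Solver.+-*-Solver

  residue-cong : ∀ {a b} → a ≈ b → residue a ≡ residue b
  residue-cong {a} {b} h = unique-residue (residue< a) (residue< b) (≈-trans (residue≈ a) (≈-trans h (≈-sym (residue≈ b))))

  residue-small : ∀ {i} → i < q → residue (+ i) ≡ i
  residue-small {i} i<q = unique-residue (residue< (+ i)) i<q (residue≈ (+ i))

  Periodic : (ℤ → ℤ) → Set
  Periodic f = ∀ {a b} → a ≈ b → f a ≡ f b

  opaque
    S : (ℤ → ℤ) → ℤ
    S f = Σℤ q (λ i → f (+ i))

    S-unfold : ∀ f → S f ≡ Σℤ q (λ i → f (+ i))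
    S-unfold f = refl

    S-cong : {f g : ℤ → ℤ} → (∀ z → f z ≡ g z) → S f ≡ S g
    S-cong h = Σℤ-cong q (λ i _ → h (+ i))

    S-mono : {f g : ℤ → ℤ} → (∀ z → f z ≤ᶻ g z) → S f ≤ᶻ S g
    S-mono h = Σℤ-mono q (λ i _ → h (+ i))

    S-+ : ∀ f g → S (λ z → f z +ᶻ g z) ≡ S f +ᶻ S g
    S-+ f g = Σℤ-+ q (λ i → f (+ i)) (λ i → g (+ i))

    S-*ˡ : ∀ c f → S (λ z → c *ᶻ f z) ≡ c *ᶻ S f
    S-*ˡ c f = Σℤ-*ˡ q c (λ i → f (+ i))

    S-const : ∀ c → S (λ _ → c) ≡ + q *ᶻ c
    S-const c = Σℤ-const q c

  -- Modulo q the maps `φ` and `ψ` are inverse permutations of the residues, and a periodic summand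
  -- does not notice the reduction.
  S-substitute : ∀ (f φ ψ : ℤ → ℤ) → Periodic f → (∀ {a b} → a ≈ b → φ a ≈ φ b) → (∀ {a b} → a ≈ b → ψ a ≈ ψ b) →
                 (∀ z → φ (ψ z) ≈ z) → (∀ z → ψ (φ z) ≈ z) → S (λ z → f (φ z)) ≡ S f
  S-substitute f φ ψ per φ-cong ψ-cong φψ ψφ = begin
    S (λ z → f (φ z))                    ≡⟨ trans (S-unfold _) (Σℤ-sumF q (λ i → f (φ (+ i)))) ⟩
    sumF {q} (λ i → f (φ (+ toℕ i)))     ≡⟨ sumF-cong q (λ i → per (≈-sym (at (φ (+ toℕ i))))) ⟩
    sumF {q} (λ i → f (+ toℕ (fin (φ (+ toℕ i))))) ≡⟨ sum-permute {q} {q} (λ i → f (+ toℕ i)) π ⟨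
    sumF {q} (λ i → f (+ toℕ i))         ≡⟨ trans (S-unfold f) (Σℤ-sumF q (λ i → f (+ i))) ⟨
    S f                                  ∎
    where
      open ≡-Reasoning
      fin : ℤ → Fin q
      fin z = fromℕ< (residue< z)
      at : ∀ z → + toℕ (fin z) ≈ z
      at z = ≈-trans (≈-reflexive (cong +_ (Fin.toℕ-fromℕ< (residue< z)))) (residue≈ z)
      back : ∀ {z} i → z ≈ + toℕ i → fin z ≡ i
      back {z} i h = Fin.toℕ-injective (unique-residue (Fin.toℕ<n (fin z)) (Fin.toℕ<n i) (≈-trans (at z) h))
      π : Permutation q q
      π = permutation (λ i → fin (φ (+ toℕ i))) (λ i → fin (ψ (+ toℕ i)))
            (λ i → back i (≈-trans (φ-cong (at (ψ (+ toℕ i)))) (φψ (+ toℕ i))))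
            (λ i → back i (≈-trans (ψ-cong (at (φ (+ toℕ i)))) (ψφ (+ toℕ i))))

-- A quadratic character modulo q = 2 e + 1, given by its values on residues.
record Character (q e : ℕ) .{{_ : NonZero q}} : Set where
  open Modular q
  field
    odd      : q ≡ suc (e + e)
    e-pos    : 0 < e
    sign     : ℕ → Sign
    euler    : ∀ i → i < q → (+ i) ^ᶻ e ≈ val (sign i)
    sign-0   : sign 0 ≡ zer
    sign-≢0  : ∀ i → 0 < i → i < q → sign i ≢ zer

  χ : ℤ → Sign
  χ z = sign (residue z)

  χ-cong : ∀ {a b} → a ≈ b → χ a ≡ χ b
  χ-cong h = cong sign (residue-cong h)

  χ-euler : ∀ z → z ^ᶻ e ≈ val (χ z)
  χ-euler z = ≈-trans (^-cong e (≈-sym (residue≈ z))) (euler (residue z) (residue< z))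

  private
    2<q : 2 < q
    2<q = subst (2 <_) (symm odd) (s≤s (+-mono-≤ e-pos e-pos))

    code : Sign → ℕ
    code neg = 0
    code zer = 1
    code pos = 2

    code-val : ∀ x → + code x ≡ val x +ᶻ 1ℤ
    code-val neg = refl
    code-val zer = refl
    code-val pos = refl

    code< : ∀ x → code x < q
    code< neg = ≤-trans (s≤s z≤n) 2<q
    code< zer = ≤-trans (s≤s (s≤s z≤n)) 2<q
    code< pos = 2<q

    code-injective : ∀ {x y} → code x ≡ code y → x ≡ y
    code-injective {neg} {neg} _ = refl
    code-injective {zer} {zer} _ = refl
    code-injective {pos} {pos} _ = refl

  -- Since q > 2, the numbers -1, 0, 1 are distinct modulo q; `code` shifts them to residues 0, 1, 2
  -- where this can be read off.
  val-≈ : ∀ {x y} → val x ≈ val y → x ≡ y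
  val-≈ {x} {y} h = code-injective (unique-residue (code< x) (code< y)
    (≈-trans (≈-reflexive (code-val x)) (≈-trans (+-cong h ≈-refl) (≈-reflexive (symm (code-val y))))))

  private
    ^-distrib : ∀ n x y → (x *ᶻ y) ^ᶻ n ≡ x ^ᶻ n *ᶻ y ^ᶻ n
    ^-distrib zero    x y = refl
    ^-distrib (suc n) x y = trans (cong (x *ᶻ y *ᶻ_) (^-distrib n x y))
      (solve 4 (λ x y a b → x :* y :* (a :* b) := x :* a :* (y :* b)) refl x y (x ^ᶻ n) (y ^ᶻ n))
      where open ℤ-Solver.+-*-Solver

  -- By Euler's criterion this is (x y)^e = x^e y^e, a sign being determined by its residue.
  χ-* : ∀ x y → χ (x *ᶻ y) ≡ χ x · χ y
  χ-* x y = val-≈ (≈-trans (≈-sym (χ-euler (x *ᶻ y))) (≈-trans (≈-reflexive (^-distrib e x y))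
    (≈-trans (*-cong (χ-euler x) (χ-euler y)) (≈-reflexive (symm (val-· (χ x) (χ y)))))))

  χ-zero : ∀ {z} → z ≈ 0ℤ → χ z ≡ zer
  χ-zero h = trans (χ-cong h) (trans (cong sign (residue-small (≤-trans (s≤s z≤n) 2<q))) sign-0)

  χ-nonzero : ∀ {z} → ¬ z ≈ 0ℤ → χ z ≢ zer
  χ-nonzero {z} z≉0 = sign-≢0 (residue z) (n≢0⇒n>0 λ e → z≉0 (≈-trans (≈-sym (residue≈ z)) (≈-reflexive (cong +_ e)))) (residue< z)

  -- The exponent is 2e - 1 = q - 2. Being a power, the inverse is total with 0 going to 0, hence an
  -- involution on all residues and admissible as a substitution.
  inverse : ℤ → ℤ
  inverse z = z ^ᶻ (e + e ∸ 1)

  inverse-cong : ∀ {a b} → a ≈ b → inverse a ≈ inverse b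
  inverse-cong = ^-cong (e + e ∸ 1)

  inverseʳ : ∀ z → ¬ z ≈ 0ℤ → z *ᶻ inverse z ≈ 1ℤ
  inverseʳ z z≉0 = ≈-trans (≈-reflexive (trans (cong (z ^ᶻ_) (m+[n∸m]≡n {1} (≤-trans e-pos (m≤m+n e e)))) (ℤ.^-distribˡ-+-* z e e)))
    (≈-trans (*-cong (χ-euler z) (χ-euler z)) (≈-reflexive (square (χ z) (χ-nonzero z≉0))))
    where
      square : ∀ x → x ≢ zer → val x *ᶻ val x ≡ 1ℤ
      square neg _ = refl
      square zer h = contradiction refl h
      square pos _ = refl

  _≈?0 : ∀ z → Dec (z ≈ 0ℤ)
  z ≈?0 with residue z Data.Nat.≟ 0
  ... | yes e = yes (≈-trans (≈-sym (residue≈ z)) (≈-reflexive (cong +_ e)))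
  ... | no ¬e = no λ h → ¬e (trans (residue-cong h) (residue-small (≤-trans (s≤s z≤n) 2<q)))

  1≉0 : ¬ 1ℤ ≈ 0ℤ
  1≉0 h = case unique-residue (≤-trans (s≤s (s≤s z≤n)) 2<q) (≤-trans (s≤s z≤n) 2<q) h of λ ()

  inverse-0 : ∀ {z} → z ≈ 0ℤ → inverse z ≈ 0ℤ
  inverse-0 {z} h = ≈-trans (inverse-cong h) (≈-reflexive (power-zero (e + e ∸ 1) (subst (0 <_) refl (m<n⇒0<n∸m (+-mono-≤ e-pos e-pos)))))
    where
      power-zero : ∀ n → 0 < n → 0ℤ ^ᶻ n ≡ 0ℤ
      power-zero (suc n) _ = refl

  inverse-≉0 : ∀ {z} → ¬ z ≈ 0ℤ → ¬ inverse z ≈ 0ℤ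
  inverse-≉0 {z} z≉0 h = 1≉0 (≈-trans (≈-sym (inverseʳ z z≉0)) (≈-trans (*-cong (≈-refl {z}) h) (≈-reflexive (ℤ.*-zeroʳ z))))

  inverse-involutive : ∀ z → inverse (inverse z) ≈ z
  inverse-involutive z with z ≈?0
  ... | yes h = ≈-trans (inverse-0 (inverse-0 h)) (≈-sym h)
  ... | no z≉0 = ≈-trans (≈-reflexive (symm (ℤ.*-identityʳ _))) (≈-trans (*-cong (≈-refl {inverse (inverse z)}) (≈-sym (inverseʳ z z≉0)))
      (≈-trans (≈-reflexive (solve 3 (λ z i j → j :* (z :* i) := z :* (i :* j)) refl z (inverse z) (inverse (inverse z))))
        (≈-trans (*-cong (≈-refl {z}) (inverseʳ (inverse z) (inverse-≉0 z≉0))) (≈-reflexive (ℤ.*-identityʳ z)))))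
    where open ℤ-Solver.+-*-Solver

  χᶻ : ℤ → ℤ
  χᶻ z = val (χ z)

  χᶻ-cong : ∀ {a b} → a ≈ b → χᶻ a ≡ χᶻ b
  χᶻ-cong h = cong val (χ-cong h)

  χᶻ-* : ∀ x y → χᶻ (x *ᶻ y) ≡ χᶻ x *ᶻ χᶻ y
  χᶻ-* x y = trans (cong val (χ-* x y)) (val-· (χ x) (χ y))

  S-shift : ∀ f a → Periodic f → S (λ z → f (z +ᶻ a)) ≡ S f
  S-shift f a per = S-substitute f (_+ᶻ a) (_+ᶻ (-ᶻ a)) per (λ h → +-cong h ≈-refl) (λ h → +-cong h ≈-refl)
    (λ z → ≈-reflexive (solve 2 (λ z a → z :+ :- a :+ a := z) refl z a))
    (λ z → ≈-reflexive (solve 2 (λ z a → z :+ a :+ :- a := z) refl z a))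
    where open ℤ-Solver.+-*-Solver

  S-scale : ∀ f c → ¬ c ≈ 0ℤ → Periodic f → S (λ z → f (c *ᶻ z)) ≡ S f
  S-scale f c c≉0 per = S-substitute f (c *ᶻ_) (inverse c *ᶻ_) per (*-cong (≈-refl {c})) (*-cong (≈-refl {inverse c}))
    (λ z → ≈-trans (≈-reflexive (symm (ℤ.*-assoc c (inverse c) z))) (one z))
    (λ z → ≈-trans (≈-reflexive (trans (symm (ℤ.*-assoc (inverse c) c z)) (cong (_*ᶻ z) (ℤ.*-comm (inverse c) c)))) (one z))
    where
      one : ∀ z → c *ᶻ inverse c *ᶻ z ≈ z
      one z = ≈-trans (*-cong (inverseʳ c c≉0) (≈-refl {z})) (≈-reflexive (ℤ.*-identityˡ z))

  S-invert : ∀ f → Periodic f → S (λ z → f (inverse z)) ≡ S f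
  S-invert f per = S-substitute f inverse inverse per inverse-cong inverse-cong inverse-involutive inverse-involutive

-- Sums of products of two and of four characters.

every : (Sign → Bool) → Bool
every P = P neg ∧ (P zer ∧ P pos)

every-sound : ∀ P → every P ≡ true → ∀ x → P x ≡ true
every-sound P e neg = proj₁ (∧-split e)
every-sound P e zer = proj₁ (∧-split (proj₂ (∧-split {P neg} e)))
every-sound P e pos = proj₂ (∧-split {P zer} (proj₂ (∧-split {P neg} e)))

_==_ : Sign → Sign → Bool
neg == neg = true
zer == zer = true
pos == pos = true
_   == _   = false

==-sound : ∀ {x y} → (x == y) ≡ true → x ≡ y
==-sound {neg} {neg} _ = refl
==-sound {zer} {zer} _ = refl
==-sound {pos} {pos} _ = refl

_≟ˢ_ : (x y : Sign) → Dec (x ≡ y)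
neg ≟ˢ neg = yes refl
neg ≟ˢ zer = no λ ()
neg ≟ˢ pos = no λ ()
zer ≟ˢ neg = no λ ()
zer ≟ˢ zer = yes refl
zer ≟ˢ pos = no λ ()
pos ≟ˢ neg = no λ ()
pos ≟ˢ zer = no λ ()
pos ≟ˢ pos = yes refl

·-nonzero : ∀ {x y} → x ≢ zer → y ≢ zer → x · y ≢ zer
·-nonzero {neg} {neg} _ _ ()
·-nonzero {neg} {zer} _ h _ = h refl
·-nonzero {neg} {pos} _ _ ()
·-nonzero {zer} h _ _ = h refl
·-nonzero {pos} _ h = h

·-square : ∀ {x} → x ≢ zer → x · x ≡ pos
·-square {neg} _ = refl
·-square {zer} h = contradiction refl h
·-square {pos} _ = refl

·-zeroʳ : ∀ x → x · zer ≡ zer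
·-zeroʳ neg = refl
·-zeroʳ zer = refl
·-zeroʳ pos = refl

square-val : ∀ {x} → x ≢ zer → val x *ᶻ val x ≡ 1ℤ
square-val {x} h = trans (symm (val-· x x)) (cong val (·-square h))

abs-val-* : ∀ x y → ∣ val x *ᶻ y ∣ ≤ ∣ y ∣
abs-val-* neg y = ≤-reflexive (trans (ℤ.∣i*j∣≡∣i∣*∣j∣ -1ℤ y) (*-identityˡ ∣ y ∣))
abs-val-* zer y = subst (_≤ ∣ y ∣) (cong ∣_∣ (symm (ℤ.*-zeroˡ y))) z≤n
abs-val-* pos y = ≤-reflexive (cong ∣_∣ (ℤ.*-identityˡ y))

e₁ e₂ e₃ e₄ : List ℤ → ℤ
e₁ []       = 0ℤ
e₁ (x ∷ xs) = x +ᶻ e₁ xs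
e₂ []       = 0ℤ
e₂ (x ∷ xs) = x *ᶻ e₁ xs +ᶻ e₂ xs
e₃ []       = 0ℤ
e₃ (x ∷ xs) = x *ᶻ e₂ xs +ᶻ e₃ xs
e₄ []       = 0ℤ
e₄ (x ∷ xs) = x *ᶻ e₃ xs +ᶻ e₄ xs

choose₂ choose₃ choose₄ : ℕ → ℕ
choose₂ zero    = 0
choose₂ (suc n) = n + choose₂ n
choose₃ zero    = 0
choose₃ (suc n) = choose₂ n + choose₃ n
choose₄ zero    = 0
choose₄ (suc n) = choose₃ n + choose₄ n

-- On values of signs this is the number of zeros.
defects : List ℤ → ℤ
defects []       = 0ℤ
defects (x ∷ xs) = 1ℤ -ᶻ x *ᶻ x +ᶻ defects xs

constant : Sign → List Sign → Bool
constant x []       = true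
constant x (y ∷ ys) = (x == y) ∧ constant x ys

-- Either constant value is accepted, because a residue carries a vertex of each sign. For nonzero
-- signs the two indicators are 2^(-s) times the products of 1 + x and of 1 - x over the entries x;
-- in their sum the terms of odd degree cancel.
uniform : List Sign → ℕ
uniform xs = if constant pos xs ∨ constant neg xs then 1 else 0

everyList : ℕ → (List Sign → Bool) → Bool
everyList zero    P = P []
everyList (suc n) P = every (λ x → everyList n (λ xs → P (x ∷ xs)))

everyList-sound : ∀ P xs → everyList (length xs) P ≡ true → P xs ≡ true
everyList-sound P []       e = e
everyList-sound P (x ∷ xs) e = everyList-sound (λ xs → P (x ∷ xs)) xs (every-sound (λ x → everyList (length xs) (λ xs → P (x ∷ xs))) e x)

-- For at most five signs ±1, 2^(s-1) times the indicator of their being equal is 1 + e₂ + e₄;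
-- a vanishing entry is paid for by 2^(s-2).
inversion : ℕ → ℕ → List Sign → Bool
inversion a c xs = does ((1ℤ +ᶻ (e₂ ys +ᶻ e₄ ys)) ℤ.≤? (+ a *ᶻ + uniform xs +ᶻ + c *ᶻ defects ys))
  where ys = map val xs

-- All other sums reduce to these three by affine substitutions and inversion. The cubic ones belong
-- to the Legendre curves y² = z (z - 1)(z - l), so `A` stands for Hasse's bound 2√q, here verified
-- by evaluation.
record KnownSums {q e : ℕ} .{{_ : NonZero q}} (ch : Character q e) (A : ℕ) : Set where
  open Modular q
  open Character ch
  field
    square-sum : S (λ z → χᶻ z *ᶻ χᶻ z) ≡ + (e + e)
    pair-sum   : S (λ z → χᶻ z *ᶻ χᶻ (z -ᶻ 1ℤ)) ≡ -1ℤ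
    cubic-sum  : ∀ l → l < q → ∣ S (λ z → χᶻ z *ᶻ χᶻ (z -ᶻ 1ℤ) *ᶻ χᶻ (z -ᶻ + l)) ∣ ≤ A

module CharacterSums {q e : ℕ} .{{_ : NonZero q}} {ch : Character q e} {A : ℕ} (sums : KnownSums ch A) where

  open Modular q
  open Character ch
  open KnownSums sums
  open ℤ-Solver.+-*-Solver

  χ-1 : χ 1ℤ ≡ pos
  χ-1 = idempotent (χ 1ℤ) (symm (χ-* 1ℤ 1ℤ)) (χ-nonzero 1≉0)
    where
      idempotent : ∀ x → x · x ≡ x → x ≢ zer → x ≡ pos
      idempotent zer _ h = contradiction refl h
      idempotent pos _ _ = refl

  S-reflect : ∀ f a → Periodic f → S (λ z → f (a -ᶻ z)) ≡ S f
  S-reflect f a per = S-substitute f (λ z → a -ᶻ z) (λ z → a -ᶻ z) per (λ h → +-cong (≈-refl {a}) (neg-cong h)) (λ h → +-cong (≈-refl {a}) (neg-cong h)) inv inv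
    where
      inv : ∀ z → a -ᶻ (a -ᶻ z) ≈ z
      inv z = ≈-reflexive (solve 2 (λ a z → a :- (a :- z) := z) refl a z)

  χᶻ-periodic : ∀ d → Periodic (λ z → χᶻ (z +ᶻ d))
  χᶻ-periodic d h = χᶻ-cong (+-cong h ≈-refl)

  -- Putting w = -d z turns w (w + d) into d² z (z - 1), and the square disappears under χ.
  pair-sum′ : ∀ d → ¬ d ≈ 0ℤ → S (λ w → χᶻ w *ᶻ χᶻ (w +ᶻ d)) ≡ -1ℤ
  pair-sum′ d d≉0 = begin
    S f                                         ≡⟨ S-scale f c c≉0 (λ h → cong₂ _*ᶻ_ (χᶻ-cong h) (χᶻ-periodic d h)) ⟨
    S (λ z → χᶻ (c *ᶻ z) *ᶻ χᶻ (c *ᶻ z +ᶻ d))   ≡⟨ S-cong pointwise ⟩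
    S (λ z → χᶻ z *ᶻ χᶻ (z -ᶻ 1ℤ))              ≡⟨ pair-sum ⟩
    -1ℤ                                         ∎
    where
      open ≡-Reasoning
      f = λ w → χᶻ w *ᶻ χᶻ (w +ᶻ d)
      c = -ᶻ d
      c≉0 : ¬ c ≈ 0ℤ
      c≉0 h = d≉0 (≈-trans (≈-reflexive (symm (ℤ.neg-involutive d))) (neg-cong h))
      pointwise : ∀ z → χᶻ (c *ᶻ z) *ᶻ χᶻ (c *ᶻ z +ᶻ d) ≡ χᶻ z *ᶻ χᶻ (z -ᶻ 1ℤ)
      pointwise z = begin
        χᶻ (c *ᶻ z) *ᶻ χᶻ (c *ᶻ z +ᶻ d)
          ≡⟨ cong₂ _*ᶻ_ (χᶻ-* c z) (trans (cong χᶻ (solve 2 (λ d z → :- d :* z :+ d := :- d :* (z :- con 1ℤ)) refl d z)) (χᶻ-* c (z -ᶻ 1ℤ))) ⟩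
        χᶻ c *ᶻ χᶻ z *ᶻ (χᶻ c *ᶻ χᶻ (z -ᶻ 1ℤ))
          ≡⟨ solve 3 (λ c x y → c :* x :* (c :* y) := c :* c :* (x :* y)) refl (χᶻ c) (χᶻ z) (χᶻ (z -ᶻ 1ℤ)) ⟩
        χᶻ c *ᶻ χᶻ c *ᶻ (χᶻ z *ᶻ χᶻ (z -ᶻ 1ℤ)) ≡⟨ cong (_*ᶻ (χᶻ z *ᶻ χᶻ (z -ᶻ 1ℤ))) (square-val (χ-nonzero c≉0)) ⟩
        1ℤ *ᶻ (χᶻ z *ᶻ χᶻ (z -ᶻ 1ℤ)) ≡⟨ ℤ.*-identityˡ _ ⟩
        χᶻ z *ᶻ χᶻ (z -ᶻ 1ℤ) ∎

  defect-sum : S (λ z → 1ℤ -ᶻ χᶻ z *ᶻ χᶻ z) ≡ 1ℤ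
  defect-sum = begin
    S (λ z → 1ℤ -ᶻ χᶻ z *ᶻ χᶻ z) ≡⟨ S-cong (λ z → cong (1ℤ +ᶻ_) (solve 1 (λ x → :- x := con -1ℤ :* x) refl (χᶻ z *ᶻ χᶻ z))) ⟩
    S (λ z → 1ℤ +ᶻ -1ℤ *ᶻ (χᶻ z *ᶻ χᶻ z)) ≡⟨ S-+ (λ _ → 1ℤ) _ ⟩
    S (λ _ → 1ℤ) +ᶻ S (λ z → -1ℤ *ᶻ (χᶻ z *ᶻ χᶻ z)) ≡⟨ cong₂ _+ᶻ_ (trans (S-const 1ℤ) (ℤ.*-identityʳ (+ q))) (trans (S-*ˡ -1ℤ _) (cong (-1ℤ *ᶻ_) square-sum)) ⟩
    + q +ᶻ -1ℤ *ᶻ + (e + e) ≡⟨ cong (λ k → + k +ᶻ -1ℤ *ᶻ + (e + e)) odd ⟩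
    1ℤ +ᶻ + (e + e) +ᶻ -1ℤ *ᶻ + (e + e) ≡⟨ solve 1 (λ x → con 1ℤ :+ x :+ con -1ℤ :* x := con 1ℤ) refl (+ (e + e)) ⟩
    1ℤ ∎
    where open ≡-Reasoning

  -- Scaling by -f₂ moves the zeros 0, -f₂, -f₃ to 0, 1 and l = f₃/f₂, at the price of a sign.
  cubic-sum′ : ∀ f₂ f₃ → ¬ f₂ ≈ 0ℤ → ∣ S (λ z → χᶻ z *ᶻ χᶻ (z +ᶻ f₂) *ᶻ χᶻ (z +ᶻ f₃)) ∣ ≤ A
  cubic-sum′ f₂ f₃ f₂≉0 = ≤-trans (≤-reflexive (cong ∣_∣ (begin
    S F ≡⟨ S-scale F c c≉0 (λ h → cong₂ _*ᶻ_ (cong₂ _*ᶻ_ (χᶻ-cong h) (χᶻ-periodic f₂ h)) (χᶻ-periodic f₃ h)) ⟨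
    S (λ z → F (c *ᶻ z)) ≡⟨ S-cong pointwise ⟩
    S (λ z → val κ *ᶻ G z) ≡⟨ S-*ˡ (val κ) G ⟩
    val κ *ᶻ S G ∎))) (≤-trans (abs-val-* κ (S G)) (cubic-sum l (residue< lam)))
    where
      open ≡-Reasoning
      F = λ z → χᶻ z *ᶻ χᶻ (z +ᶻ f₂) *ᶻ χᶻ (z +ᶻ f₃)
      c = -ᶻ f₂
      c≉0 : ¬ c ≈ 0ℤ
      c≉0 h = f₂≉0 (≈-trans (≈-reflexive (symm (ℤ.neg-involutive f₂))) (neg-cong h))
      lam = f₃ *ᶻ inverse f₂
      l = residue lam
      κ = χ c · χ c · χ c
      G = λ z → χᶻ z *ᶻ χᶻ (z -ᶻ 1ℤ) *ᶻ χᶻ (z -ᶻ + l)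
      third : ∀ z → c *ᶻ z +ᶻ f₃ ≈ c *ᶻ (z -ᶻ + l)
      third z = ≈-sym (≈-trans (*-cong (≈-refl {c}) (+-cong (≈-refl {z}) (neg-cong (residue≈ lam))))
        (≈-trans (≈-reflexive (solve 4 (λ f z g i → :- f :* (z :- g :* i) := :- f :* z :+ g :* (f :* i)) refl f₂ z f₃ (inverse f₂)))
          (+-cong (≈-refl {c *ᶻ z}) (≈-trans (*-cong (≈-refl {f₃}) (inverseʳ f₂ f₂≉0)) (≈-reflexive (ℤ.*-identityʳ f₃))))))
      pointwise : ∀ z → F (c *ᶻ z) ≡ val κ *ᶻ G z
      pointwise z = begin
        χᶻ (c *ᶻ z) *ᶻ χᶻ (c *ᶻ z +ᶻ f₂) *ᶻ χᶻ (c *ᶻ z +ᶻ f₃)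
          ≡⟨ cong₂ _*ᶻ_ (cong₂ _*ᶻ_ (χᶻ-* c z) (trans (cong χᶻ (solve 2 (λ f z → :- f :* z :+ f := :- f :* (z :- con 1ℤ)) refl f₂ z)) (χᶻ-* c (z -ᶻ 1ℤ)))) (trans (χᶻ-cong (third z)) (χᶻ-* c (z -ᶻ + l))) ⟩
        χᶻ c *ᶻ χᶻ z *ᶻ (χᶻ c *ᶻ χᶻ (z -ᶻ 1ℤ)) *ᶻ (χᶻ c *ᶻ χᶻ (z -ᶻ + l))
          ≡⟨ solve 4 (λ c x y w → c :* x :* (c :* y) :* (c :* w) := c :* c :* c :* (x :* y :* w)) refl (χᶻ c) (χᶻ z) (χᶻ (z -ᶻ 1ℤ)) (χᶻ (z -ᶻ + l)) ⟩
        χᶻ c *ᶻ χᶻ c *ᶻ χᶻ c *ᶻ G z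
          ≡⟨ cong (_*ᶻ G z) (trans (val-· (χ c · χ c) (χ c)) (cong (_*ᶻ χᶻ c) (val-· (χ c) (χ c)))) ⟨
        val κ *ᶻ G z ∎

  -- The substitution w = 1/γ turns a quartic sum into a cubic one.
  quartic-sum : ∀ d₁ d₂ d₃ → ¬ d₁ ≈ 0ℤ → ¬ d₂ ≈ 0ℤ → ¬ d₃ ≈ 0ℤ → ¬ d₁ ≈ d₂ →
                ∣ S (λ w → χᶻ w *ᶻ χᶻ (w +ᶻ d₁) *ᶻ χᶻ (w +ᶻ d₂) *ᶻ χᶻ (w +ᶻ d₃)) ∣ ≤ suc A
  quartic-sum d₁ d₂ d₃ d₁≉0 d₂≉0 d₃≉0 d₁≉d₂ = ≤-trans (≤-reflexive (cong ∣_∣ total))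
      (≤-trans (ℤ.∣i-j∣≤∣i∣+∣j∣ (val κ *ᶻ S H) 1ℤ) (≤-trans (+-monoˡ-≤ 1 (≤-trans (abs-val-* κ (S H)) H-bound)) (≤-reflexive (+-comm A 1))))
    where
      open ≡-Reasoning
      F C H : ℤ → ℤ
      F w = χᶻ w *ᶻ χᶻ (w +ᶻ d₁) *ᶻ χᶻ (w +ᶻ d₂) *ᶻ χᶻ (w +ᶻ d₃)
      C γ = χᶻ (1ℤ +ᶻ d₁ *ᶻ γ) *ᶻ χᶻ (1ℤ +ᶻ d₂ *ᶻ γ) *ᶻ χᶻ (1ℤ +ᶻ d₃ *ᶻ γ)
      κ = χ d₁ · χ d₂ · χ d₃
      i₁ = inverse d₁
      i₂ = inverse d₂
      i₃ = inverse d₃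
      H γ = χᶻ (γ +ᶻ i₁) *ᶻ χᶻ (γ +ᶻ i₂) *ᶻ χᶻ (γ +ᶻ i₃)
      factor : ∀ d γ → ¬ d ≈ 0ℤ → χᶻ (1ℤ +ᶻ d *ᶻ γ) ≡ χᶻ d *ᶻ χᶻ (γ +ᶻ inverse d)
      factor d γ d≉0 = trans (χᶻ-cong (≈-sym (≈-trans (≈-reflexive (solve 3 (λ d g i → d :* (g :+ i) := d :* i :+ d :* g) refl d γ (inverse d)))
                         (+-cong (inverseʳ d d≉0) ≈-refl)))) (χᶻ-* d (γ +ᶻ inverse d))
      C≡ : ∀ γ → C γ ≡ val κ *ᶻ H γ
      C≡ γ = begin
        C γ ≡⟨ cong₂ _*ᶻ_ (cong₂ _*ᶻ_ (factor d₁ γ d₁≉0) (factor d₂ γ d₂≉0)) (factor d₃ γ d₃≉0) ⟩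
        χᶻ d₁ *ᶻ χᶻ (γ +ᶻ i₁) *ᶻ (χᶻ d₂ *ᶻ χᶻ (γ +ᶻ i₂)) *ᶻ (χᶻ d₃ *ᶻ χᶻ (γ +ᶻ i₃))
          ≡⟨ solve 6 (λ a x b y c z → a :* x :* (b :* y) :* (c :* z) := a :* b :* c :* (x :* y :* z)) refl (χᶻ d₁) (χᶻ (γ +ᶻ i₁)) (χᶻ d₂) (χᶻ (γ +ᶻ i₂)) (χᶻ d₃) (χᶻ (γ +ᶻ i₃)) ⟩
        χᶻ d₁ *ᶻ χᶻ d₂ *ᶻ χᶻ d₃ *ᶻ H γ ≡⟨ cong (_*ᶻ H γ) (trans (val-· (χ d₁ · χ d₂) (χ d₃)) (cong (_*ᶻ χᶻ d₃) (val-· (χ d₁) (χ d₂)))) ⟨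
        val κ *ᶻ H γ ∎
      -- 1 - χ(γ)² is the indicator of γ = 0, where F vanishes and C equals 1. Elsewhere χ(1/γ) =
      -- χ(γ) = χ(γ)³, and each of the other three factors absorbs one χ(γ).
      F-inverse : ∀ γ → F (inverse γ) ≡ C γ -ᶻ (1ℤ -ᶻ χᶻ γ *ᶻ χᶻ γ)
      F-inverse γ with γ ≈?0
      ... | yes γ≈0 = begin
          F (inverse γ) ≡⟨ cong (λ x → val x *ᶻ χᶻ (inverse γ +ᶻ d₁) *ᶻ χᶻ (inverse γ +ᶻ d₂) *ᶻ χᶻ (inverse γ +ᶻ d₃)) (χ-zero (inverse-0 γ≈0)) ⟩
          0ℤ *ᶻ χᶻ (inverse γ +ᶻ d₁) *ᶻ χᶻ (inverse γ +ᶻ d₂) *ᶻ χᶻ (inverse γ +ᶻ d₃)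
            ≡⟨ solve 3 (λ x y z → con 0ℤ :* x :* y :* z := con 0ℤ) refl (χᶻ (inverse γ +ᶻ d₁)) (χᶻ (inverse γ +ᶻ d₂)) (χᶻ (inverse γ +ᶻ d₃)) ⟩
          1ℤ *ᶻ 1ℤ *ᶻ 1ℤ -ᶻ (1ℤ -ᶻ 0ℤ *ᶻ 0ℤ)
            ≡⟨ cong₂ (λ x y → x -ᶻ (1ℤ -ᶻ y *ᶻ y)) (cong₂ _*ᶻ_ (cong₂ _*ᶻ_ (unit d₁) (unit d₂)) (unit d₃)) (cong val (χ-zero γ≈0)) ⟨
          C γ -ᶻ (1ℤ -ᶻ χᶻ γ *ᶻ χᶻ γ) ∎
        where
          unit : ∀ d → χᶻ (1ℤ +ᶻ d *ᶻ γ) ≡ 1ℤ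
          unit d = trans (χᶻ-cong (≈-trans (+-cong (≈-refl {1ℤ}) (*-cong (≈-refl {d}) γ≈0)) (≈-reflexive (cong (1ℤ +ᶻ_) (ℤ.*-zeroʳ d))))) (cong val χ-1)
      ... | no γ≉0 = begin
          F (inverse γ) ≡⟨ cong (λ x → x *ᶻ χᶻ (inverse γ +ᶻ d₁) *ᶻ χᶻ (inverse γ +ᶻ d₂) *ᶻ χᶻ (inverse γ +ᶻ d₃)) χ-inverse ⟩
          g *ᶻ χᶻ (inverse γ +ᶻ d₁) *ᶻ χᶻ (inverse γ +ᶻ d₂) *ᶻ χᶻ (inverse γ +ᶻ d₃)
            ≡⟨ cong (λ x → x *ᶻ χᶻ (inverse γ +ᶻ d₁) *ᶻ χᶻ (inverse γ +ᶻ d₂) *ᶻ χᶻ (inverse γ +ᶻ d₃)) (trans (cong (_*ᶻ g) g²) (ℤ.*-identityˡ g)) ⟨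
          g *ᶻ g *ᶻ g *ᶻ χᶻ (inverse γ +ᶻ d₁) *ᶻ χᶻ (inverse γ +ᶻ d₂) *ᶻ χᶻ (inverse γ +ᶻ d₃)
            ≡⟨ solve 4 (λ g x y z → g :* g :* g :* x :* y :* z := g :* x :* (g :* y) :* (g :* z)) refl g (χᶻ (inverse γ +ᶻ d₁)) (χᶻ (inverse γ +ᶻ d₂)) (χᶻ (inverse γ +ᶻ d₃)) ⟩
          g *ᶻ χᶻ (inverse γ +ᶻ d₁) *ᶻ (g *ᶻ χᶻ (inverse γ +ᶻ d₂)) *ᶻ (g *ᶻ χᶻ (inverse γ +ᶻ d₃))
            ≡⟨ cong₂ _*ᶻ_ (cong₂ _*ᶻ_ (absorb d₁) (absorb d₂)) (absorb d₃) ⟩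
          C γ ≡⟨ ℤ.+-identityʳ (C γ) ⟨
          C γ -ᶻ (1ℤ -ᶻ 1ℤ) ≡⟨ cong (λ x → C γ -ᶻ (1ℤ -ᶻ x)) g² ⟨
          C γ -ᶻ (1ℤ -ᶻ g *ᶻ g) ∎
        where
          g = χᶻ γ
          g² : g *ᶻ g ≡ 1ℤ
          g² = square-val (χ-nonzero γ≉0)
          absorb : ∀ d → g *ᶻ χᶻ (inverse γ +ᶻ d) ≡ χᶻ (1ℤ +ᶻ d *ᶻ γ)
          absorb d = trans (symm (χᶻ-* γ (inverse γ +ᶻ d))) (χᶻ-cong (≈-trans (≈-reflexive (solve 3 (λ g i d → g :* (i :+ d) := g :* i :+ d :* g) refl γ (inverse γ) d))
                       (+-cong (inverseʳ γ γ≉0) (≈-refl {d *ᶻ γ}))))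
          χ-inverse : χᶻ (inverse γ) ≡ g
          χ-inverse = begin
            χᶻ (inverse γ) ≡⟨ ℤ.*-identityˡ _ ⟨
            1ℤ *ᶻ χᶻ (inverse γ) ≡⟨ cong (_*ᶻ χᶻ (inverse γ)) g² ⟨
            g *ᶻ g *ᶻ χᶻ (inverse γ) ≡⟨ ℤ.*-assoc g g _ ⟩
            g *ᶻ (g *ᶻ χᶻ (inverse γ)) ≡⟨ cong (g *ᶻ_) (trans (symm (χᶻ-* γ (inverse γ))) (trans (χᶻ-cong (inverseʳ γ γ≉0)) (cong val χ-1))) ⟩
            g *ᶻ 1ℤ ≡⟨ ℤ.*-identityʳ g ⟩
            g ∎
      total : S F ≡ val κ *ᶻ S H -ᶻ 1ℤ
      total = begin
        S F ≡⟨ S-invert F (λ h → cong₂ _*ᶻ_ (cong₂ _*ᶻ_ (cong₂ _*ᶻ_ (χᶻ-cong h) (χᶻ-periodic d₁ h)) (χᶻ-periodic d₂ h)) (χᶻ-periodic d₃ h)) ⟨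
        S (λ γ → F (inverse γ)) ≡⟨ S-cong (λ γ → trans (F-inverse γ) (cong₂ _+ᶻ_ (C≡ γ) (solve 1 (λ x → :- x := con -1ℤ :* x) refl (1ℤ -ᶻ χᶻ γ *ᶻ χᶻ γ)))) ⟩
        S (λ γ → val κ *ᶻ H γ +ᶻ -1ℤ *ᶻ (1ℤ -ᶻ χᶻ γ *ᶻ χᶻ γ)) ≡⟨ S-+ _ _ ⟩
        S (λ γ → val κ *ᶻ H γ) +ᶻ S (λ γ → -1ℤ *ᶻ (1ℤ -ᶻ χᶻ γ *ᶻ χᶻ γ)) ≡⟨ cong₂ _+ᶻ_ (S-*ˡ (val κ) H) (trans (S-*ˡ -1ℤ _) (cong (-1ℤ *ᶻ_) defect-sum)) ⟩
        val κ *ᶻ S H -ᶻ 1ℤ ∎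
      H-bound : ∣ S H ∣ ≤ A
      H-bound = ≤-trans (≤-reflexive (cong ∣_∣ (begin
          S H ≡⟨ S-shift H (-ᶻ i₁) (λ h → cong₂ _*ᶻ_ (cong₂ _*ᶻ_ (χᶻ-periodic i₁ h) (χᶻ-periodic i₂ h)) (χᶻ-periodic i₃ h)) ⟨
          S (λ z → H (z +ᶻ (-ᶻ i₁))) ≡⟨ S-cong (λ z → cong₂ _*ᶻ_ (cong₂ _*ᶻ_
              (cong χᶻ (solve 2 (λ z i → z :+ :- i :+ i := z) refl z i₁))
              (cong χᶻ (solve 3 (λ z i j → z :+ :- i :+ j := z :+ (j :- i)) refl z i₁ i₂)))
              (cong χᶻ (solve 3 (λ z i j → z :+ :- i :+ j := z :+ (j :- i)) refl z i₁ i₃))) ⟩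
          S (λ z → χᶻ z *ᶻ χᶻ (z +ᶻ (i₂ -ᶻ i₁)) *ᶻ χᶻ (z +ᶻ (i₃ -ᶻ i₁))) ∎)))
          (cubic-sum′ (i₂ -ᶻ i₁) (i₃ -ᶻ i₁) distinct)
        where
          distinct : ¬ i₂ -ᶻ i₁ ≈ 0ℤ
          distinct h = d₁≉d₂ (≈-trans (≈-sym (inverse-involutive d₁)) (≈-trans (inverse-cong (≈-sym i₂≈i₁)) (inverse-involutive d₂)))
            where
              i₂≈i₁ : i₂ ≈ i₁
              i₂≈i₁ = ≈-trans (≈-reflexive (solve 2 (λ a b → a := a :- b :+ b) refl i₂ i₁)) (≈-trans (+-cong h (≈-refl {i₁})) (≈-reflexive (ℤ.+-identityˡ i₁)))

  -- The function z ↦ σ χ(u - z) attached to a sign and a point.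
  Point : Set
  Point = Sign × ℤ

  at : ℤ → Point → ℤ
  at z (σ , u) = val σ *ᶻ χᶻ (u -ᶻ z)

  values : List Point → ℤ → List ℤ
  values cs z = map (at z) cs

  Apart : Point → Point → Set
  Apart (_ , u) (_ , v) = ¬ u ≈ v

  Spread : List Point → Set
  Spread = AllPairs Apart

  infix 4 _≽_
  record _≽_ (f : ℤ → ℤ) (k : ℕ) : Set where
    constructor at-least
    field
      bound : -ᶻ (+ k) ≤ᶻ S f
  open _≽_

  ≽-+ : ∀ {f g h : ℤ → ℤ} {a b} → (∀ z → h z ≡ f z +ᶻ g z) → f ≽ a → g ≽ b → h ≽ a + b
  ≽-+ {f} {g} {h} {a} {b} eq (at-least fa) (at-least gb) = at-least (subst₂ _≤ᶻ_
    (trans (symm (ℤ.neg-distrib-+ (+ a) (+ b))) refl) (trans (symm (S-+ f g)) (S-cong (λ z → symm (eq z)))) (ℤ.+-mono-≤ fa gb))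

  ≽-≡ : ∀ {f : ℤ → ℤ} {a b} → a ≡ b → f ≽ a → f ≽ b
  ≽-≡ refl h = h

  ≽-zero : ∀ {h : ℤ → ℤ} → (∀ z → h z ≡ 0ℤ) → h ≽ 0
  ≽-zero eq = at-least (ℤ.≤-reflexive (symm (trans (S-cong eq) (trans (S-const 0ℤ) (ℤ.*-zeroʳ (+ q))))))

  ≽-abs : ∀ {f : ℤ → ℤ} {k} → ∣ S f ∣ ≤ k → f ≽ k
  ≽-abs {f} {k} le = at-least (ℤ.≤-trans (ℤ.neg-mono-≤ (Data.Integer.+≤+ le)) (lemma (S f)))
    where
      lemma : ∀ i → -ᶻ (+ ∣ i ∣) ≤ᶻ i
      lemma (+ zero)  = ℤ.≤-refl
      lemma (+ suc n) = Data.Integer.-≤+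
      lemma -[1+ n ]  = ℤ.≤-refl

  pair-product : ∀ a b → Apart a b → S (λ z → at z a *ᶻ at z b) ≡ val (proj₁ a) *ᶻ val (proj₁ b) *ᶻ -1ℤ
  pair-product (σ , u) (τ , v) u≉v = begin
    S (λ z → val σ *ᶻ χᶻ (u -ᶻ z) *ᶻ (val τ *ᶻ χᶻ (v -ᶻ z)))
      ≡⟨ S-cong (λ z → trans (solve 4 (λ a x b y → a :* x :* (b :* y) := a :* b :* (x :* y)) refl (val σ) (χᶻ (u -ᶻ z)) (val τ) (χᶻ (v -ᶻ z)))
           (cong (λ w → val σ *ᶻ val τ *ᶻ (χᶻ (u -ᶻ z) *ᶻ χᶻ w)) (solve 3 (λ u v z → v :- z := u :- z :+ (v :- u)) refl u v z))) ⟩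
    S (λ z → val σ *ᶻ val τ *ᶻ f (u -ᶻ z)) ≡⟨ S-*ˡ (val σ *ᶻ val τ) _ ⟩
    val σ *ᶻ val τ *ᶻ S (λ z → f (u -ᶻ z)) ≡⟨ cong (val σ *ᶻ val τ *ᶻ_) (trans (S-reflect f u (λ h → cong₂ _*ᶻ_ (χᶻ-cong h) (χᶻ-periodic (v -ᶻ u) h))) (pair-sum′ (v -ᶻ u) v-u≉0)) ⟩
    val σ *ᶻ val τ *ᶻ -1ℤ ∎
    where
      open ≡-Reasoning
      f = λ w → χᶻ w *ᶻ χᶻ (w +ᶻ (v -ᶻ u))
      v-u≉0 : ¬ v -ᶻ u ≈ 0ℤ
      v-u≉0 h = u≉v (≈-sym (≈-trans (≈-reflexive (solve 2 (λ u v → v := v :- u :+ u) refl u v)) (≈-trans (+-cong h (≈-refl {u})) (≈-reflexive (ℤ.+-identityˡ u)))))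

  pair≽ : ∀ a b → Apart a b → (λ z → at z a *ᶻ at z b) ≽ 1
  pair≽ a b ap = ≽-abs (subst (λ k → ∣ k ∣ ≤ 1) (symm (pair-product a b ap))
    (subst (λ k → ∣ k ∣ ≤ 1) (symm (ℤ.*-assoc (val (proj₁ a)) _ _)) (≤-trans (abs-val-* (proj₁ a) _) (abs-val-* (proj₁ b) -1ℤ))))

  quad≽ : ∀ a b c d → Apart a b → Apart a c → Apart a d → Apart b c →
          (λ z → at z a *ᶻ at z b *ᶻ at z c *ᶻ at z d) ≽ suc A
  quad≽ (α , u) (β , v) (γ , w) (δ , x) u≉v u≉w u≉x v≉w = ≽-abs (≤-trans (≤-reflexive (cong ∣_∣ (begin
      S (λ z → val α *ᶻ χᶻ (u -ᶻ z) *ᶻ (val β *ᶻ χᶻ (v -ᶻ z)) *ᶻ (val γ *ᶻ χᶻ (w -ᶻ z)) *ᶻ (val δ *ᶻ χᶻ (x -ᶻ z)))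
        ≡⟨ S-cong (λ z → trans (solve 8 (λ a p b q c r d s → a :* p :* (b :* q) :* (c :* r) :* (d :* s) := a :* b :* c :* d :* (p :* q :* r :* s)) refl (val α) (χᶻ (u -ᶻ z)) (val β) (χᶻ (v -ᶻ z)) (val γ) (χᶻ (w -ᶻ z)) (val δ) (χᶻ (x -ᶻ z)))
             (cong₂ _*ᶻ_ signs (cong₂ _*ᶻ_ (cong₂ _*ᶻ_ (cong (χᶻ (u -ᶻ z) *ᶻ_) (move z v)) (move z w)) (move z x)))) ⟩
      S (λ z → val κ *ᶻ f (u -ᶻ z)) ≡⟨ S-*ˡ (val κ) _ ⟩
      val κ *ᶻ S (λ z → f (u -ᶻ z)) ≡⟨ cong (val κ *ᶻ_) (S-reflect f u (λ h → cong₂ _*ᶻ_ (cong₂ _*ᶻ_ (cong₂ _*ᶻ_ (χᶻ-cong h) (χᶻ-periodic (v -ᶻ u) h)) (χᶻ-periodic (w -ᶻ u) h)) (χᶻ-periodic (x -ᶻ u) h))) ⟩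
      val κ *ᶻ S f ∎)))
      (≤-trans (abs-val-* κ (S f)) (quartic-sum (v -ᶻ u) (w -ᶻ u) (x -ᶻ u) (diff u≉v) (diff u≉w) (diff u≉x) (λ h → v≉w (restore h)))))
    where
      open ≡-Reasoning
      κ = α · β · γ · δ
      f = λ y → χᶻ y *ᶻ χᶻ (y +ᶻ (v -ᶻ u)) *ᶻ χᶻ (y +ᶻ (w -ᶻ u)) *ᶻ χᶻ (y +ᶻ (x -ᶻ u))
      signs : val α *ᶻ val β *ᶻ val γ *ᶻ val δ ≡ val κ
      signs = symm (trans (val-· (α · β · γ) δ) (cong (_*ᶻ val δ) (trans (val-· (α · β) γ) (cong (_*ᶻ val γ) (val-· α β)))))
      move : ∀ z y → χᶻ (y -ᶻ z) ≡ χᶻ (u -ᶻ z +ᶻ (y -ᶻ u))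
      move z y = cong χᶻ (solve 3 (λ u y z → y :- z := u :- z :+ (y :- u)) refl u y z)
      diff : ∀ {y} → ¬ u ≈ y → ¬ y -ᶻ u ≈ 0ℤ
      diff {y} u≉y h = u≉y (≈-sym (≈-trans (≈-reflexive (solve 2 (λ u v → v := v :- u :+ u) refl u y)) (≈-trans (+-cong h (≈-refl {u})) (≈-reflexive (ℤ.+-identityˡ u)))))
      restore : v -ᶻ u ≈ w -ᶻ u → v ≈ w
      restore h = ≈-trans (≈-reflexive (solve 2 (λ u v → v := v :- u :+ u) refl u v)) (≈-trans (+-cong h (≈-refl {u})) (≈-reflexive (solve 2 (λ u v → v :- u :+ u := v) refl u w)))

  pairs₁ : ∀ a cs → All (Apart a) cs → (λ z → at z a *ᶻ e₁ (values cs z)) ≽ length cs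
  pairs₁ a []       []       = ≽-zero (λ z → ℤ.*-zeroʳ (at z a))
  pairs₁ a (c ∷ cs) (p ∷ ps) = ≽-+ (λ z → ℤ.*-distribˡ-+ (at z a) (at z c) (e₁ (values cs z))) (pair≽ a c p) (pairs₁ a cs ps)

  pairs : ∀ cs → Spread cs → (λ z → e₂ (values cs z)) ≽ choose₂ (length cs)
  pairs []       []       = ≽-zero (λ _ → refl)
  pairs (c ∷ cs) (p ∷ ps) = ≽-+ (λ _ → refl) (pairs₁ c cs p) (pairs cs ps)

  quads₁ : ∀ a b c cs → Apart a b → Apart a c → Apart b c → All (Apart a) cs →
           (λ z → at z a *ᶻ at z b *ᶻ at z c *ᶻ e₁ (values cs z)) ≽ length cs * suc A
  quads₁ a b c []       ab ac bc []       = ≽-zero (λ z → ℤ.*-zeroʳ (at z a *ᶻ at z b *ᶻ at z c))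
  quads₁ a b c (d ∷ cs) ab ac bc (p ∷ ps) = ≽-+ (λ z → ℤ.*-distribˡ-+ (at z a *ᶻ at z b *ᶻ at z c) (at z d) (e₁ (values cs z))) (quad≽ a b c d ab ac p bc) (quads₁ a b c cs ab ac bc ps)

  quads₂ : ∀ a b cs → Apart a b → All (Apart a) cs → All (Apart b) cs → Spread cs →
           (λ z → at z a *ᶻ at z b *ᶻ e₂ (values cs z)) ≽ choose₂ (length cs) * suc A
  quads₂ a b []       ab []       []       []       = ≽-zero (λ z → ℤ.*-zeroʳ (at z a *ᶻ at z b))
  quads₂ a b (c ∷ cs) ab (p ∷ ps) (r ∷ rs) (t ∷ ts) = ≽-≡ (symm (*-distribʳ-+ (suc A) (length cs) (choose₂ (length cs))))
    (≽-+ (λ z → solve 5 (λ a b c x y → a :* b :* (c :* x :+ y) := a :* b :* c :* x :+ a :* b :* y) refl (at z a) (at z b) (at z c) (e₁ (values cs z)) (e₂ (values cs z)))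
      (quads₁ a b c cs ab p r ps) (quads₂ a b cs ab ps rs ts))

  quads₃ : ∀ a cs → All (Apart a) cs → Spread cs → (λ z → at z a *ᶻ e₃ (values cs z)) ≽ choose₃ (length cs) * suc A
  quads₃ a []       []       []       = ≽-zero (λ z → ℤ.*-zeroʳ (at z a))
  quads₃ a (c ∷ cs) (p ∷ ps) (t ∷ ts) = ≽-≡ (symm (*-distribʳ-+ (suc A) (choose₂ (length cs)) (choose₃ (length cs))))
    (≽-+ (λ z → solve 4 (λ a c x y → a :* (c :* x :+ y) := a :* c :* x :+ a :* y) refl (at z a) (at z c) (e₂ (values cs z)) (e₃ (values cs z)))
      (quads₂ a c cs p ps t ts) (quads₃ a cs ps ts))

  quads : ∀ cs → Spread cs → (λ z → e₄ (values cs z)) ≽ choose₄ (length cs) * suc A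
  quads []       []       = ≽-zero (λ _ → refl)
  quads (c ∷ cs) (p ∷ ps) = ≽-≡ (symm (*-distribʳ-+ (suc A) (choose₃ (length cs)) (choose₄ (length cs))))
    (≽-+ (λ _ → refl) (quads₃ c cs p ps) (quads cs ps))

  Nonzero : Point → Set
  Nonzero (σ , _) = σ ≢ zer

  defects-sum : ∀ cs → All Nonzero cs → S (λ z → defects (values cs z)) ≡ + length cs
  defects-sum []             []       = trans (S-const 0ℤ) (ℤ.*-zeroʳ (+ q))
  defects-sum ((σ , u) ∷ cs) (h ∷ hs) = trans (S-+ _ _) (cong₂ _+ᶻ_ (trans (S-cong pointwise) (trans (S-reflect (λ w → 1ℤ -ᶻ χᶻ w *ᶻ χᶻ w) u (λ h → cong (λ x → 1ℤ -ᶻ x *ᶻ x) (χᶻ-cong h))) defect-sum)) (defects-sum cs hs))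
    where
      pointwise : ∀ z → 1ℤ -ᶻ at z (σ , u) *ᶻ at z (σ , u) ≡ 1ℤ -ᶻ χᶻ (u -ᶻ z) *ᶻ χᶻ (u -ᶻ z)
      pointwise z = cong (λ x → 1ℤ -ᶻ x) (trans (solve 2 (λ s x → s :* x :* (s :* x) := s :* s :* (x :* x)) refl (val σ) (χᶻ (u -ᶻ z)))
        (trans (cong (_*ᶻ (χᶻ (u -ᶻ z) *ᶻ χᶻ (u -ᶻ z))) (square-val h)) (ℤ.*-identityˡ _)))

  signs-at : List Point → ℤ → List Sign
  signs-at cs z = map (λ { (σ , u) → σ · χ (u -ᶻ z) }) cs

  vals-signs : ∀ cs z → map val (signs-at cs z) ≡ values cs z
  vals-signs []             z = refl
  vals-signs ((σ , u) ∷ cs) z = cong₂ _∷_ (val-· σ (χ (u -ᶻ z))) (vals-signs cs z)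

  -- a = 2^(s-1), c = 2^(s-2).
  cell-bound : ∀ a c cs → Spread cs → All Nonzero cs → everyList (length cs) (inversion a c) ≡ true →
    + q +ᶻ (-ᶻ (+ (choose₂ (length cs) + choose₄ (length cs) * suc A)))
      ≤ᶻ + a *ᶻ S (λ z → + uniform (signs-at cs z)) +ᶻ + c *ᶻ + length cs
  cell-bound a c cs sp nz chk = ℤ.≤-trans (ℤ.+-monoʳ-≤ (+ q) (bound (≽-+ (λ _ → refl) (pairs cs sp) (quads cs sp))))
    (subst₂ _≤ᶻ_
      (trans (S-+ (λ _ → 1ℤ) _) (cong (_+ᶻ S (λ z → e₂ (values cs z) +ᶻ e₄ (values cs z))) (trans (S-const 1ℤ) (ℤ.*-identityʳ (+ q)))))
      (trans (S-+ _ _) (cong₂ _+ᶻ_ (S-*ˡ (+ a) _) (trans (S-*ˡ (+ c) _) (cong (+ c *ᶻ_) (defects-sum cs nz)))))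
      (S-mono pointwise))
    where
      pointwise : ∀ z → 1ℤ +ᶻ (e₂ (values cs z) +ᶻ e₄ (values cs z)) ≤ᶻ + a *ᶻ + uniform (signs-at cs z) +ᶻ + c *ᶻ defects (values cs z)
      pointwise z = subst (λ ys → 1ℤ +ᶻ (e₂ ys +ᶻ e₄ ys) ≤ᶻ + a *ᶻ + uniform (signs-at cs z) +ᶻ + c *ᶻ defects ys) (vals-signs cs z)
        (does-sound (_ ℤ.≤? _) (everyList-sound (inversion a c) (signs-at cs z) (subst (λ k → everyList k (inversion a c) ≡ true) (symm (length-map _ cs)) chk)))
        where
          does-sound : ∀ {P : Set} (d : Dec P) → does d ≡ true → P
          does-sound (yes p) _ = p

  weight : List Point → ℤ
  weight []             = 0ℤ
  weight ((σ , _) ∷ cs) = val σ +ᶻ weight cs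

  cross : ∀ a cs → All (Apart a) cs → S (λ z → at z a *ᶻ e₁ (values cs z)) ≡ val (proj₁ a) *ᶻ weight cs *ᶻ -1ℤ
  cross a []       []       = trans (S-cong (λ z → ℤ.*-zeroʳ (at z a))) (trans (S-const 0ℤ) (trans (ℤ.*-zeroʳ (+ q)) (symm (cong (_*ᶻ -1ℤ) (ℤ.*-zeroʳ (val (proj₁ a)))))))
  cross a (c ∷ cs) (p ∷ ps) = trans (S-cong (λ z → ℤ.*-distribˡ-+ (at z a) (at z c) (e₁ (values cs z)))) (trans (S-+ _ _)
    (trans (cong₂ _+ᶻ_ (pair-product a c p) (cross a cs ps)) (solve 3 (λ a c w → a :* c :* con -1ℤ :+ a :* w :* con -1ℤ := a :* (c :+ w) :* con -1ℤ) refl (val (proj₁ a)) (val (proj₁ c)) (weight cs))))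

  -- The square of one term sums to q - 1, and two terms at different points have correlation -1
  -- times their signs; with N points and weight w the second moment is q N - w². The subtraction is
  -- moved to the left.
  second-moment : ∀ cs → Spread cs → All Nonzero cs →
    S (λ z → e₁ (values cs z) *ᶻ e₁ (values cs z)) +ᶻ weight cs *ᶻ weight cs ≡ + q *ᶻ + length cs
  second-moment []       []       []       = trans (ℤ.+-identityʳ _) (trans (S-const 0ℤ) refl)
  second-moment (c@(σ , u) ∷ cs) (p ∷ ps) (h ∷ hs) = begin
    S (λ z → (at z c +ᶻ E z) *ᶻ (at z c +ᶻ E z)) +ᶻ (val σ +ᶻ w) *ᶻ (val σ +ᶻ w)
      ≡⟨ cong (_+ᶻ (val σ +ᶻ w) *ᶻ (val σ +ᶻ w)) (trans (S-cong (λ z → solve 2 (λ a e → (a :+ e) :* (a :+ e) := a :* a :+ (con (+ 2) :* (a :* e) :+ e :* e)) refl (at z c) (E z))) (trans (S-+ _ _) (cong₂ _+ᶻ_ squares (trans (S-+ _ _) (cong (_+ᶻ S (λ z → E z *ᶻ E z)) (trans (S-*ˡ (+ 2) _) (cong (+ 2 *ᶻ_) (cross c cs p)))))))) ⟩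
    + (e + e) +ᶻ (+ 2 *ᶻ (val σ *ᶻ w *ᶻ -1ℤ) +ᶻ S (λ z → E z *ᶻ E z)) +ᶻ (val σ +ᶻ w) *ᶻ (val σ +ᶻ w)
      ≡⟨ solve 4 (λ k s w m → k :+ (con (+ 2) :* (s :* w :* con -1ℤ) :+ m) :+ (s :+ w) :* (s :+ w) := k :+ s :* s :+ (m :+ w :* w)) refl (+ (e + e)) (val σ) w (S (λ z → E z *ᶻ E z)) ⟩
    + (e + e) +ᶻ val σ *ᶻ val σ +ᶻ (S (λ z → E z *ᶻ E z) +ᶻ w *ᶻ w)
      ≡⟨ cong₂ _+ᶻ_ (trans (cong (+ (e + e) +ᶻ_) (square-val h)) (trans (ℤ.+-comm (+ (e + e)) 1ℤ) (cong +_ (symm odd)))) (second-moment cs ps hs) ⟩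
    + q +ᶻ + q *ᶻ + length cs ≡⟨ ℤ.*-suc (+ q) (+ length cs) ⟨
    + q *ᶻ + suc (length cs) ∎
    where
      open ≡-Reasoning
      E = λ z → e₁ (values cs z)
      w = weight cs
      squares : S (λ z → at z c *ᶻ at z c) ≡ + (e + e)
      squares = trans (S-cong (λ z → trans (solve 2 (λ s x → s :* x :* (s :* x) := s :* s :* (x :* x)) refl (val σ) (χᶻ (u -ᶻ z)))
        (trans (cong (_*ᶻ (χᶻ (u -ᶻ z) *ᶻ χᶻ (u -ᶻ z))) (square-val h)) (ℤ.*-identityˡ _))))
        (trans (S-reflect (λ w → χᶻ w *ᶻ χᶻ w) u (λ h → cong₂ _*ᶻ_ (χᶻ-cong h) (χᶻ-cong h))) square-sum)

-- The doubled Paley graph as a target.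

private
  sum-⊆ : {X : Set} (k : X → ℕ) (xs ys : List X) → Unique xs → (∀ {x} → x ∈ xs → x ∈ ys) → sum (map k xs) ≤ sum (map k ys)
  sum-⊆ k []       ys _        _   = z≤n
  sum-⊆ k (x ∷ xs) ys (x∉ ∷ u) sub = subst (k x + sum (map k xs) ≤_) (symm (sum-remove x∈ys))
      (+-monoʳ-≤ (k x) (sum-⊆ k xs (remove x∈ys) u (λ {y} y∈ → ∈-remove x∈ys (sub (there y∈)) (λ { refl → All.lookup x∉ y∈ refl }))))
    where
      x∈ys = sub (here refl)
      sum-remove : ∀ {x ys} (p : x ∈ ys) → sum (map k ys) ≡ k x + sum (map k (remove p))
      sum-remove (here refl)             = refl
      sum-remove {x} {y ∷ ys} (there p) = trans (cong (λ z → k y + z) (sum-remove p))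
        (trans (symm (+-assoc (k y) (k x) _)) (trans (cong (_+ sum (map k (remove p))) (+-comm (k y) (k x))) (+-assoc (k x) (k y) _)))

  sum-≥ : {X : Set} (k : X → ℕ) (b : ℕ) (xs : List X) → (∀ {x} → x ∈ xs → b ≤ k x) → length xs * b ≤ sum (map k xs)
  sum-≥ k b []       h = z≤n
  sum-≥ k b (x ∷ xs) h = +-mono-≤ (h (here refl)) (sum-≥ k b xs (h ∘ there))

  constant-sound : ∀ x ys → constant x ys ≡ true → All (x ≡_) ys
  constant-sound x []       e = []
  constant-sound x (y ∷ ys) e = ==-sound (proj₁ (∧-split e)) ∷ constant-sound x ys (proj₂ (∧-split {x == y} e))

  constant-values : ∀ τ zs → All (_≡ val τ) zs → e₁ zs ≡ + length zs *ᶻ val τ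
  constant-values τ []       []       = symm (ℤ.*-zeroˡ (val τ))
  constant-values τ (z ∷ zs) (h ∷ hs) = trans (cong₂ _+ᶻ_ h (constant-values τ zs hs)) (symm (ℤ.suc-* (+ length zs) (val τ)))

  abs-multiple : ∀ j τ → τ ≢ zer → ∣ + j *ᶻ val τ ∣ ≡ j
  abs-multiple j τ h = trans (ℤ.∣i*j∣≡∣i∣*∣j∣ (+ j) (val τ)) (trans (cong (j *_) (unit τ h)) (*-identityʳ j))
    where
      unit : ∀ τ → τ ≢ zer → ∣ val τ ∣ ≡ 1
      unit neg _ = refl
      unit zer h = contradiction refl h
      unit pos _ = refl

  signs₄ : (l r : Sign → Sign → Sign → Sign → Sign) →
    every (λ a → every (λ b → every (λ c → every (λ d → l a b c d == r a b c d)))) ≡ true → ∀ a b c d → l a b c d ≡ r a b c d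
  signs₄ l r h a b c d = ==-sound (every-sound (λ d → l a b c d == r a b c d)
    (every-sound (λ c → every (λ d → l a b c d == r a b c d))
    (every-sound (λ b → every (λ c → every (λ d → l a b c d == r a b c d)))
    (every-sound (λ a → every (λ b → every (λ c → every (λ d → l a b c d == r a b c d)))) h a) b) c) d)

  transfer : ∀ {y g k x} → g ≢ zer → k ≢ zer → y ≡ g · x · k → y · g · k ≡ x
  transfer {g = g} {k} {x} gz kz refl = trans (signs₄ (λ g k x _ → g · x · k · g · k) (λ g k x _ → g · g · (k · k) · x) refl g k x pos)
    (cong₂ (λ a b → a · b · x) (·-square gz) (·-square kz))

  other-sign : ∀ {x y} → x ≢ zer → y ≢ zer → y ≢ x → y ≡ neg · x
  other-sign {neg} {neg} _ _ h = contradiction refl h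
  other-sign {neg} {zer} _ h _ = contradiction refl h
  other-sign {neg} {pos} _ _ _ = refl
  other-sign {zer} h _ _ = contradiction refl h
  other-sign {pos} {neg} _ _ _ = refl
  other-sign {pos} {zer} _ h _ = contradiction refl h
  other-sign {pos} {pos} _ _ h = contradiction refl h

  square-abs : ∀ w → w *ᶻ w ≡ + (∣ w ∣ * ∣ w ∣)
  square-abs (+ n)    = symm (ℤ.pos-* n n)
  square-abs -[1+ n ] = refl

  square-nonneg : ∀ w → 0ℤ ≤ᶻ w *ᶻ w
  square-nonneg w = subst (0ℤ ≤ᶻ_) (symm (square-abs w)) (Data.Integer.+≤+ z≤n)

-- The connections as the two signs, where η is the sign by which reversal acts.
record Encoding (m n : ℕ) (η : Sign) : Set where
  field
    typ         : Sign → Conn m n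
    typ-zer     : typ zer ≡ none
    typ-onto    : ∀ c → present c ≡ true → Σ Sign λ x → x ≢ zer × c ≡ typ x
    present-pos : present (typ pos) ≡ true
    present-neg : present (typ neg) ≡ true
    pos≢neg     : typ pos ≢ typ neg
    flip-typ    : ∀ x → flipC (typ x) ≡ typ (η · x)

-- The vertices are pairs of a sign and a residue; the sign of the connection from (σ , x) to
-- (τ , y) is σ τ χ(y - x).
module Paley {q e : ℕ} .{{_ : NonZero q}} {ch : Character q e} {A : ℕ} (sums : KnownSums ch A)
  {m n : ℕ} (enc : Encoding m n (Character.χ ch -1ℤ)) (s' n₀ a c : ℕ)
  (inverted : everyList (suc s') (inversion a c) ≡ true)
  (cell-size : choose₂ (suc s') + choose₄ (suc s') * suc A + (a * n₀ + c * suc s') < q)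
  (2s'≤n₀ : s' + s' ≤ n₀) (4s'<2q : s' + s' + (s' + s') < q + q)
  (dense : q * suc n₀ < suc s' * (suc n₀ * suc n₀) + (suc n₀ ∸ suc s') * (n₀ * n₀))
  where

  open Modular q
  open Character ch
  open Encoding enc
  open CharacterSums sums

  s N₀ : ℕ
  s  = suc s'
  N₀ = suc n₀

  V : Set
  V = Fin (q + q)

  sg : V → Sign
  sg v = Data.Sum.[ (λ _ → pos) , (λ _ → neg) ]′ (splitAt q v)

  pt : V → Fin q
  pt v = Data.Sum.[ id , id ]′ (splitAt q v)

  P : V → ℤ
  P v = + toℕ (pt v)

  mk : Sign → Fin q → V
  mk neg i = q ↑ʳ i
  mk _   i = i ↑ˡ q

  sg-mk : ∀ x i → x ≢ zer → sg (mk x i) ≡ x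
  sg-mk neg i _ rewrite Fin.splitAt-↑ʳ q q i = refl
  sg-mk zer i h = contradiction refl h
  sg-mk pos i _ rewrite Fin.splitAt-↑ˡ q i q = refl

  pt-mk : ∀ x i → pt (mk x i) ≡ i
  pt-mk neg i rewrite Fin.splitAt-↑ʳ q q i = refl
  pt-mk zer i rewrite Fin.splitAt-↑ˡ q i q = refl
  pt-mk pos i rewrite Fin.splitAt-↑ˡ q i q = refl

  mk-sg-pt : ∀ v → mk (sg v) (pt v) ≡ v
  mk-sg-pt v = trans (by-side (splitAt q v)) (Fin.join-splitAt q q v)
    where
      by-side : ∀ w → mk (Data.Sum.[ (λ _ → pos) , (λ _ → neg) ]′ w) (Data.Sum.[ id , id ]′ w) ≡ Data.Fin.join q q w
      by-side (inj₁ _) = refl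
      by-side (inj₂ _) = refl

  sg-cases : ∀ v → sg v ≡ pos ⊎ sg v ≡ neg
  sg-cases v with splitAt q v
  ... | inj₁ _ = inj₁ refl
  ... | inj₂ _ = inj₂ refl

  sg≢zer : ∀ v → sg v ≢ zer
  sg≢zer v h with splitAt q v
  sg≢zer v () | inj₁ _
  sg≢zer v () | inj₂ _

  apart : ∀ {i j : Fin q} → i ≢ j → ¬ (+ toℕ i ≈ + toℕ j)
  apart {i} {j} i≢j h = i≢j (Fin.toℕ-injective (unique-residue (Fin.toℕ<n i) (Fin.toℕ<n j) h))

  χ-diff : ∀ {u v} → ¬ u ≈ v → χ (u -ᶻ v) ≢ zer
  χ-diff {u} {v} u≉v = χ-nonzero {u -ᶻ v} λ h → u≉v (≈-trans (≈-reflexive (solve 2 (λ u v → u := u :- v :+ v) refl u v))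
      (≈-trans (+-cong h (≈-refl {v})) (≈-reflexive (ℤ.+-identityˡ v))))
    where open ℤ-Solver.+-*-Solver

  χ-swap : ∀ u v → χ (u -ᶻ v) ≡ χ -1ℤ · χ (v -ᶻ u)
  χ-swap u v = trans (cong χ (solve 2 (λ u v → u :- v := con -1ℤ :* (v :- u)) refl u v)) (χ-* -1ℤ (v -ᶻ u))
    where open ℤ-Solver.+-*-Solver

  κ : V → V → Sign
  κ v w = sg v · sg w · χ (P w -ᶻ P v)

  graph : MixedGraph m n (q + q)
  graph = record
    { conn     = λ v w → typ (κ v w)
    ; loopless = λ v → trans (cong typ (trans (cong (sg v · sg v ·_) (χ-zero (≈-reflexive (ℤ.+-inverseʳ (P v))))) (·-zeroʳ (sg v · sg v)))) typ-zer
    ; flipped  = λ v w → trans (cong typ (trans (cong (sg w · sg v ·_) (χ-swap (P v) (P w)))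
        (signs₄ (λ a b c d → b · a · (c · d)) (λ a b c d → c · (a · b · d)) refl (sg v) (sg w) (χ -1ℤ) (χ (P w -ᶻ P v))))) (symm (flip-typ (κ v w)))
    }

  Demand : Set
  Demand = V × Sign

  demand : Demand → Constraint m n (q + q)
  demand (v , x) = v , typ x

  place : Demand → Fin q
  place (v , _) = pt v

  point : Demand → Point
  point (v , x) = sg v · x , P v

  Fits : V → List Demand → Set
  Fits y = All (λ { (v , x) → κ y v ≡ x })

  fits⇒sat : ∀ {y D} → Fits y D → Sat graph y (map demand D)
  fits⇒sat fits = All.map⁺ (All.map (cong typ) fits)

  -- General position means distinct residues, which is stronger than distinct vertices: the
  -- character sums are estimated at distinct points only. A full list then has enough solutions
  -- without further conditions.
  Ok : List (Constraint m n (q + q)) → Set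
  Ok L = Σ (List Demand) λ D → L ≡ map demand D × All (λ d → proj₂ d ≢ zer) D × Unique (map place D)

  spread : ∀ {X : Set} (i : X → Fin q) (σ : X → Sign) xs → Unique (map i xs) → Spread (map (λ x → σ x , + toℕ (i x)) xs)
  spread i σ []       []       = []
  spread i σ (x ∷ xs) (p ∷ ps) = All.map⁺ (All.map apart (All.map⁻ p)) ∷ spread i σ xs ps

  uniform-fits : ∀ x i D → x ≢ zer → constant x (signs-at (map point D) (+ toℕ i)) ≡ true → Fits (mk x i) D
  uniform-fits x i D x≢zer h = go D (constant-sound x _ h)
    where
      go : ∀ D → All (x ≡_) (signs-at (map point D) (+ toℕ i)) → Fits (mk x i) D
      go []            []       = []
      go ((v , y) ∷ D) (h ∷ hs) = trans (cong₂ (λ a j → a · sg v · χ (P v -ᶻ + toℕ j)) (sg-mk x i x≢zer) (pt-mk x i))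
          (transfer (sg≢zer v) (λ e → x≢zer (trans h (trans (cong (sg v · y ·_) e) (·-zeroʳ (sg v · y))))) h) ∷ go D hs

  sum-all : (ℤ → ℕ) → ℕ
  sum-all k = sum (map (λ i → k (+ toℕ i)) (allFin q))

  S-sum : ∀ k → S (λ z → + k z) ≡ + sum-all k
  S-sum k = trans (S-unfold _) (trans (tabulated q (λ i → k (+ i))) (cong (+_ ∘ sum) (symm (map-tabulate {n = q} id (λ i → k (+ toℕ i))))))
    where
      tabulated : ∀ l (k : ℕ → ℕ) → Σℤ l (λ i → + k i) ≡ + sum (Data.List.tabulate {n = l} (λ i → k (toℕ i)))
      tabulated zero    k = refl
      tabulated (suc l) k = cong (+ k 0 +ᶻ_) (tabulated l (k ∘ suc))

  record Cell (D : List Demand) : Set where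
    field
      members  : List V
      distinct : Unique (map pt members)
      fit      : All (λ y → Fits y D) members
      number   : length members ≡ N₀

  -- The vertex (σ , z) meets every demand exactly when all entries of `signs-at` at z equal σ, so
  -- each residue with constant entries gives one vertex, whose sign is the common value. Truncating
  -- to N₀ makes any two cells the same size for `meet`.
  cell : ∀ D → All (λ d → proj₂ d ≢ zer) D → Unique (map place D) → length D ≡ s → Cell D
  cell D nz un len = record
    { members  = map vertex (take N₀ zs)
    ; distinct = subst Unique (symm (vertex-pt (take N₀ zs))) (Unique.take⁺ N₀ (Unique.filter⁺ good? (Unique.allFin⁺ q)))
    ; fit      = All.map⁺ (All.take⁺ N₀ (All.map vertex-fits (All.all-filter good? (allFin q))))
    ; number   = trans (length-map vertex (take N₀ zs)) (trans (length-take N₀ zs) (m≤n⇒m⊓n≡m enough))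
    }
    where
      cs = map point D
      len-cs : length cs ≡ s
      len-cs = trans (length-map point D) len
      signs : Fin q → List Sign
      signs i = signs-at cs (+ toℕ i)
      good : Fin q → Bool
      good i = constant pos (signs i) ∨ constant neg (signs i)
      good? = λ i → good i Bool.≟ true
      zs = filter good? (allFin q)
      vertex : Fin q → V
      vertex i = if constant pos (signs i) then mk pos i else mk neg i
      vertex-pt : ∀ is → map pt (map vertex is) ≡ is
      vertex-pt []       = refl
      vertex-pt (i ∷ is) = cong₂ _∷_ pt-vertex (vertex-pt is)
        where
          pt-vertex : pt (vertex i) ≡ i
          pt-vertex with constant pos (signs i)
          ... | true  = pt-mk pos i
          ... | false = pt-mk neg i
      vertex-fits : ∀ {i} → good i ≡ true → Fits (vertex i) D
      vertex-fits {i} g with constant pos (signs i) in eq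
      ... | true  = uniform-fits pos i D (λ ()) eq
      ... | false = uniform-fits neg i D (λ ()) g
      nonzeros : ∀ D → All (λ d → proj₂ d ≢ zer) D → All Nonzero (map point D)
      nonzeros []            []       = []
      nonzeros ((v , x) ∷ D) (h ∷ hs) = ·-nonzero (sg≢zer v) h ∷ nonzeros D hs
      X = choose₂ s + choose₄ s * suc A
      count : S (λ z → + uniform (signs-at cs z)) ≡ + length zs
      count = trans (S-sum (λ z → uniform (signs-at cs z))) (cong +_ (symm (length-filter-true good (allFin q))))
      bound : + q +ᶻ (-ᶻ (+ X)) ≤ᶻ + (a * length zs + c * s)
      bound = subst₂ _≤ᶻ_ (cong (λ k → + q +ᶻ (-ᶻ (+ (choose₂ k + choose₄ k * suc A)))) len-cs)
        (cong₂ _+ᶻ_ (trans (cong (+ a *ᶻ_) count) (symm (ℤ.pos-* a (length zs)))) (trans (cong (λ k → + c *ᶻ + k) len-cs) (symm (ℤ.pos-* c s))))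
        (cell-bound a c cs (spread place (λ d → sg (proj₁ d) · proj₂ d) D un) (nonzeros D nz) (subst (λ k → everyList k (inversion a c) ≡ true) (symm len-cs) inverted))
      bound′ : q ≤ X + (a * length zs + c * s)
      bound′ = ℤ.drop‿+≤+ (subst (_≤ᶻ + X +ᶻ + (a * length zs + c * s)) (solve 2 (λ x y → x :+ (y :+ :- x) := y) refl (+ X) (+ q)) (ℤ.+-monoʳ-≤ (+ X) bound))
        where open ℤ-Solver.+-*-Solver
      enough : N₀ ≤ length zs
      enough = ≰⇒> λ le → <⇒≱ cell-size (≤-trans bound′ (+-monoʳ-≤ X (+-monoˡ-≤ (c * s) (*-monoʳ-≤ a le))))

  full : ∀ L → Ok L → length L ≡ s → AtLeast (suc (s' + s')) (λ y → Sat graph y L)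
  full L (D , refl , nz , un) len = members , Unique.map⁻ distinct , All.map fits⇒sat fit , ≤-trans (s≤s 2s'≤n₀) (≤-reflexive (symm number))
    where open Cell (cell D nz un (trans (symm (length-map demand D)) len))

  -- A used residue is forbidden with both of its signs, whence 2 s'.
  forbidden : ∀ L c → Ok L → length L < s → present c ≡ true →
    Σ (List V) λ bad → length bad ≤ s' + s' × (∀ y → y ∉ bad → Ok ((y , c) ∷ L))
  forbidden L c (D , refl , nz , un) (s≤s len) pr with typ-onto c pr
  ... | x , x≢zer , refl = map (mk pos) us ++ map (mk neg) us , short , λ y y∉ →
        (y , x) ∷ D , refl , x≢zer ∷ nz , All.tabulate (λ {i} i∈ e → y∉ (occurs y (subst (_∈ us) (symm e) i∈))) ∷ un
    where
      us = map place D
      short : length (map (mk pos) us ++ map (mk neg) us) ≤ s' + s'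
      short = ≤-trans (≤-reflexive (trans (length-++ (map (mk pos) us)) (cong₂ _+_ (each pos) (each neg)))) (+-mono-≤ len len)
        where
          each : ∀ x → length (map (mk x) us) ≡ length (map demand D)
          each x = trans (length-map (mk x) us) (trans (length-map place D) (symm (length-map demand D)))
      occurs : ∀ y → pt y ∈ us → y ∈ map (mk pos) us ++ map (mk neg) us
      occurs y p with sg-cases y
      ... | inj₁ e = ∈-++⁺ˡ (subst (_∈ map (mk pos) us) (trans (cong (λ x → mk x (pt y)) (symm e)) (mk-sg-pt y)) (∈-map⁺ (mk pos) p))
      ... | inj₂ e = ∈-++⁺ʳ (map (mk pos) us) (subst (_∈ map (mk neg) us) (trans (cong (λ x → mk x (pt y)) (symm e)) (mk-sg-pt y)) (∈-map⁺ (mk neg) p))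

  -1≉0 : ¬ -1ℤ ≈ 0ℤ
  -1≉0 h = 1≉0 (neg-cong h)

  -- The function Σ σ χ(u - z) over the vertices (σ , u) of a cell.  It is extremal at the
  -- demanded places, and nearly so at every vertex which misses a sign towards the cell.
  module Profile (βs : List V) (distinct : Unique (map pt βs)) (number : length βs ≡ N₀) where

    cs : List Point
    cs = map (λ β → sg β , P β) βs

    energy : ℤ → ℕ
    energy z = ∣ e₁ (values cs z) ∣ * ∣ e₁ (values cs z) ∣

    total : sum-all energy ≤ q * N₀
    total = ℤ.drop‿+≤+ (subst₂ _≤ᶻ_ (trans (S-cong (λ z → square-abs (e₁ (values cs z)))) (S-sum energy))
        (trans (second-moment cs (spread pt sg βs distinct) (nonzero βs)) (trans (symm (ℤ.pos-* q (length cs))) (cong (λ k → + (q * k)) (trans (length-map _ βs) number))))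
        (subst (_≤ᶻ M +ᶻ weight cs *ᶻ weight cs) (ℤ.+-identityʳ M) (ℤ.+-monoʳ-≤ M (square-nonneg (weight cs)))))
      where
        M = S (λ z → e₁ (values cs z) *ᶻ e₁ (values cs z))
        nonzero : ∀ βs → All Nonzero (map (λ β → sg β , P β) βs)
        nonzero []       = []
        nonzero (β ∷ βs) = sg≢zer β ∷ nonzero βs

    entry : V → ℤ → Sign
    entry β z = sg β · χ (P β -ᶻ z)

    entries : ∀ βs z τ → All (λ β → entry β z ≡ τ) βs → All (_≡ val τ) (values (map (λ β → sg β , P β) βs) z)
    entries []       z τ []       = []
    entries (β ∷ βs) z τ (h ∷ hs) = trans (symm (val-· (sg β) (χ (P β -ᶻ z)))) (cong val h) ∷ entries βs z τ hs

    extremal : ∀ v x → x ≢ zer → All (λ β → κ β v ≡ x) βs → energy (P v) ≡ N₀ * N₀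
    extremal v x x≢zer fits = cong₂ _*_ magnitude magnitude
      where
        τ = χ -1ℤ · (x · sg v)
        same : ∀ {β} → κ β v ≡ x → entry β (P v) ≡ τ
        same {β} refl = trans (cong (sg β ·_) (χ-swap (P β) (P v)))
          (trans (cong (λ o → sg β · (χ -1ℤ · (o · χ (P v -ᶻ P β)))) (symm (·-square (sg≢zer v))))
            (signs₄ (λ b v n k → b · (n · (v · v · k))) (λ b v n k → n · (b · v · k · v)) refl (sg β) (sg v) (χ -1ℤ) (χ (P v -ᶻ P β))))
        magnitude : ∣ e₁ (values cs (P v)) ∣ ≡ N₀
        magnitude = trans (cong ∣_∣ (constant-values τ (values cs (P v)) (entries βs (P v) τ (All.map same fits))))
          (trans (abs-multiple _ τ (·-nonzero (χ-nonzero -1≉0) (·-nonzero x≢zer (sg≢zer v)))) (trans (length-map _ cs) (trans (length-map _ βs) number)))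

    -- The members lie over distinct residues, so at most one of them lies over `i`; its entry is 0,
    -- and the sum falls short of the extremal value by at most one.
    near-constant : ∀ i τ βs → Unique (map pt βs) → (∀ {β} → β ∈ βs → pt β ≢ i → entry β (+ toℕ i) ≡ τ) →
      Σ ℕ λ j → e₁ (values (map (λ β → sg β , P β) βs) (+ toℕ i)) ≡ + j *ᶻ val τ × length βs ≤ suc j
    near-constant i τ []       _        _ = 0 , symm (ℤ.*-zeroˡ (val τ)) , z≤n
    near-constant i τ (β ∷ βs) (β∉ ∷ u) h with pt β Fin.≟ i
    ... | yes refl = length βs , trans (cong₂ _+ᶻ_ vanish (constant-values τ _ (entries βs (P β) τ (All.tabulate λ β∈ → h (there β∈) λ e → All.lookup (All.map⁻ β∉) β∈ (symm e)))))
            (trans (ℤ.+-identityˡ _) (cong (λ k → + k *ᶻ val τ) (trans (length-map _ (map _ βs)) (length-map _ βs)))) , ≤-refl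
      where
        vanish : val (sg β) *ᶻ χᶻ (P β -ᶻ P β) ≡ 0ℤ
        vanish = trans (cong (λ k → val (sg β) *ᶻ val k) (χ-zero (≈-reflexive (ℤ.+-inverseʳ (P β))))) (ℤ.*-zeroʳ (val (sg β)))
    ... | no β≢i with near-constant i τ βs u (h ∘ there)
    ...   | j , eq , le = suc j , trans (cong₂ _+ᶻ_ (trans (symm (val-· (sg β) (χ (P β -ᶻ + toℕ i)))) (cong val (h (here refl) β≢i))) eq) (symm (ℤ.suc-* (+ j) (val τ))) , s≤s le

    nearly-extremal : ∀ α x → x ≢ zer → (∀ {β} → β ∈ βs → κ α β ≢ x) → n₀ * n₀ ≤ energy (P α)
    nearly-extremal α x x≢zer misses = *-mono-≤ magnitude magnitude
      where
        τ = neg · x · sg α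
        same : ∀ {β} → β ∈ βs → pt β ≢ pt α → entry β (P α) ≡ τ
        same {β} β∈ β≢α = trans (cong (λ o → sg β · (o · χ (P β -ᶻ P α))) (symm (·-square (sg≢zer α))))
          (trans (signs₄ (λ b a k _ → b · (a · a · k)) (λ b a k _ → a · b · k · a) refl (sg β) (sg α) (χ (P β -ᶻ P α)) pos)
            (cong (_· sg α) (other-sign x≢zer (·-nonzero (·-nonzero (sg≢zer α) (sg≢zer β)) (χ-diff (apart β≢α))) (misses β∈))))
        magnitude : n₀ ≤ ∣ e₁ (values cs (P α)) ∣
        magnitude with near-constant (pt α) τ βs distinct same
        ... | j , eq , le = subst (n₀ ≤_) (symm (trans (cong ∣_∣ eq) (abs-multiple j τ (·-nonzero (·-nonzero (λ ()) x≢zer) (sg≢zer α)))))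
              (≤-pred (≤-trans (≤-reflexive (symm number)) le))

  -- Otherwise the squared profile of the cell is N₀² at the s demanded residues and at least n₀² at
  -- N₀ - s or more residues of `αs` outside them. By `dense` this exceeds q N₀, the bound that the
  -- second moment puts on the sum over all residues.
  meet : ∀ αs D x → x ≢ zer → Unique (map pt αs) → length αs ≡ N₀ →
    All (λ d → proj₂ d ≢ zer) D → Unique (map place D) → length D ≡ s → (B : Cell D) →
    ¬ (∀ {α β} → α ∈ αs → β ∈ Cell.members B → κ α β ≢ x)
  meet αs D x x≢zer uα lenα nz un len B misses = <⇒≱ dense (begin
      s * (N₀ * N₀) + (N₀ ∸ s) * (n₀ * n₀)
        ≤⟨ +-mono-≤ (≤-trans (≤-reflexive (cong (_* (N₀ * N₀)) (symm len-us))) (sum-≥ E (N₀ * N₀) us at-demands))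
             (≤-trans (*-monoˡ-≤ (n₀ * n₀) many) (sum-≥ E (n₀ * n₀) vs at-αs)) ⟩
      sum (map E us) + sum (map E vs) ≡⟨ trans (cong sum (map-++ E us vs)) (sum-++ (map E us) (map E vs)) ⟨
      sum (map E (us ++ vs)) ≤⟨ sum-⊆ E (us ++ vs) (allFin q) unique (λ _ → ∈-allFin _) ⟩
      sum-all energy ≤⟨ total ⟩
      q * N₀ ∎)
    where
      open ≤-Reasoning
      open Cell B
      open Profile members distinct number
      open DecMembership (Fin._≟_ {q}) using (_∈?_)
      E : Fin q → ℕ
      E i = energy (+ toℕ i)
      us = map place D
      out? = λ i → ¬? (i ∈? us)
      vs = filter out? (map pt αs)
      len-us : length us ≡ s
      len-us = trans (length-map place D) len
      at-demands : ∀ {i} → i ∈ us → N₀ * N₀ ≤ E i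
      at-demands i∈ with ∈-map⁻ place i∈
      ... | d , d∈ , refl = ≤-reflexive (symm (extremal (proj₁ d) (proj₂ d) (All.lookup nz d∈) (All.map (λ fits → All.lookup fits d∈) fit)))
      at-αs : ∀ {i} → i ∈ vs → n₀ * n₀ ≤ E i
      at-αs i∈ with ∈-map⁻ pt (proj₁ (∈-filter⁻ out? {xs = map pt αs} i∈))
      ... | α , α∈ , refl = nearly-extremal α x x≢zer (misses α∈)
      unique : Unique (us ++ vs)
      unique = Unique.++⁺ un (Unique.filter⁺ out? uα) (λ { (p , r) → proj₂ (∈-filter⁻ out? {xs = map pt αs} r) p })
      covered : ∀ {i} → i ∈ map pt αs → i ∈ us ++ vs
      covered {i} i∈ with i ∈? us
      ... | yes p = ∈-++⁺ˡ p
      ... | no ¬p = ∈-++⁺ʳ us (∈-filter⁺ out? i∈ ¬p)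
      many : N₀ ∸ s ≤ length vs
      many = m≤n+o⇒m∸n≤o N₀ s (≤-trans (≤-reflexive (symm (trans (length-map pt αs) lenα)))
        (≤-trans (unique-⊆⇒length≤ _ _ uα covered) (≤-reflexive (trans (length-++ us) (cong (_+ length vs) len-us)))))

  pair : ∀ L L' c → Ok L → Ok L' → length L ≡ s → length L' ≡ s → present c ≡ true →
    ∃ λ α → ∃ λ ω → Sat graph α L × Sat graph ω L' × conn graph α ω ≡ c
  pair L L' c (D , refl , nz , un) (D' , refl , nz' , un') len len' pr with typ-onto c pr
  ... | x , x≢zer , refl = search
    where
      A′ = cell D nz un (trans (symm (length-map demand D)) len)
      len-D' = trans (symm (length-map demand D')) len'
      B = cell D' nz' un' len-D'
      open Cell
      search : ∃ λ α → ∃ λ ω → Sat graph α (map demand D) × Sat graph ω (map demand D') × typ (κ α ω) ≡ typ x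
      search with Any.any? (λ α → Any.any? (λ β → κ α β ≟ˢ x) (members B)) (members A′)
      ... | no none-found = contradiction (λ {α} {β} α∈ β∈ e → none-found (lose α∈ (lose β∈ e)))
              (meet (members A′) D' x x≢zer (distinct A′) (number A′) nz' un' len-D' B)
      ... | yes some with find some
      ...   | α , α∈ , some′ with find some′
      ...     | β , β∈ , e = α , β , fits⇒sat (All.lookup (fit A′) α∈) , fits⇒sat (All.lookup (fit B) β∈) , cong typ e

  receiver : Receiver m n s (q + q)
  receiver = graph , FromCells.target graph (s' + s') 4s'<2q (typ pos) (typ neg) present-pos present-neg pos≢neg
    Ok ([] , refl , [] , []) forbidden full pair

-- Evaluating the character tables.

private
  tab : ℕ → (ℕ → Sign) → List Sign
  tab zero    g = []
  tab (suc n) g = g 0 ∷ tab n (g ∘ suc)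

  tally : Sign → ℕ × ℕ → ℕ × ℕ
  tally neg (p , n) = p , suc n
  tally zer (p , n) = p , n
  tally pos (p , n) = suc p , n

  correlation : List Sign → List Sign → ℕ × ℕ
  correlation []       _        = 0 , 0
  correlation (_ ∷ _)  []       = 0 , 0
  correlation (x ∷ xs) (y ∷ ys) = tally (x · y) (correlation xs ys)

  balanced : ℕ → ℕ × ℕ → Bool
  balanced A (p , n) = (p ≤ᵇ n + A) ∧ (n ≤ᵇ p + A)

  -- The cubic sums for all l are the correlations of one table, that of χ(i) χ(i - 1), with the
  -- windows of a table of χ over two periods; moving the window is dropping an entry.
  windows : ℕ → ℕ → List Sign → List Sign → Bool
  windows A zero    xs ys       = true
  windows A (suc k) xs []       = false
  windows A (suc k) xs (y ∷ ys) = balanced A (correlation xs (y ∷ ys)) ∧ windows A k xs ys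

  excess : ℕ × ℕ → ℤ
  excess (p , n) = + p -ᶻ + n

  excess-tally : ∀ x pn → excess (tally x pn) ≡ val x +ᶻ excess pn
  excess-tally neg (p , n) = solve 2 (λ p n → p :- (con 1ℤ :+ n) := con -1ℤ :+ (p :- n)) refl (+ p) (+ n)
    where open ℤ-Solver.+-*-Solver
  excess-tally zer (p , n) = symm (ℤ.+-identityˡ _)
  excess-tally pos (p , n) = ℤ.+-assoc 1ℤ (+ p) (-ᶻ (+ n))

  balanced-sound : ∀ A pn → balanced A pn ≡ true → ∣ excess pn ∣ ≤ A
  balanced-sound A (p , n) h = subst (λ k → ∣ k ∣ ≤ A) (symm (ℤ.m-n≡m⊖n p n)) (apart≤ (≤-total p n))
    where
      le₁ = ≤ᵇ-sound p (n + A) (proj₁ (∧-split h))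
      le₂ = ≤ᵇ-sound n (p + A) (proj₂ (∧-split {p ≤ᵇ n + A} h))
      apart≤ : p ≤ n ⊎ n ≤ p → ∣ p Data.Integer.⊖ n ∣ ≤ A
      apart≤ (inj₁ p≤n) = ≤-trans (≤-reflexive (ℤ.∣⊖∣-≤ p≤n)) (m≤n+o⇒m∸n≤o n p le₂)
      apart≤ (inj₂ n≤p) = ≤-trans (≤-reflexive (trans (ℤ.∣m⊖n∣≡∣n⊖m∣ p n) (ℤ.∣⊖∣-≤ n≤p))) (m≤n+o⇒m∸n≤o p n le₁)

  correlation-sum : ∀ l N (f g : ℕ → Sign) → l ≤ N → excess (correlation (tab l f) (tab N g)) ≡ Σℤ l (λ i → val (f i) *ᶻ val (g i))
  correlation-sum zero    N       f g _         = refl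
  correlation-sum (suc l) (suc N) f g (s≤s l≤N) = trans (excess-tally (f 0 · g 0) _)
    (cong₂ _+ᶻ_ (val-· (f 0) (g 0)) (correlation-sum l N (f ∘ suc) (g ∘ suc) l≤N))

  windows-sound : ∀ A K l N (f g : ℕ → Sign) → windows A K (tab l f) (tab N g) ≡ true →
    ∀ k → k < K → k + l ≤ N → ∣ Σℤ l (λ i → val (f i) *ᶻ val (g (k + i))) ∣ ≤ A
  windows-sound A (suc K) l (suc N) f g h zero    _         l≤N       = subst (λ z → ∣ z ∣ ≤ A) (correlation-sum l (suc N) f g l≤N) (balanced-sound A (correlation (tab l f) (tab (suc N) g)) (proj₁ (∧-split h)))
  windows-sound A (suc K) l (suc N) f g h (suc k) (s≤s k<K) (s≤s le) = windows-sound A K l N f (g ∘ suc) (proj₂ (∧-split {balanced A (correlation (tab l f) (tab (suc N) g))} h)) k k<K le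

  nonzero-tab : ℕ → (ℕ → Sign) → Bool
  nonzero-tab zero    g = true
  nonzero-tab (suc n) g = ((g 0 · g 0) == pos) ∧ nonzero-tab n (g ∘ suc)

  nonzero-tab-sound : ∀ n g → nonzero-tab n g ≡ true → ∀ i → i < n → g i ≢ zer
  nonzero-tab-sound (suc n) g h zero    _         e = case trans (symm (proj₁ (∧-split h))) (cong (λ x → (x · x) == pos) e) of λ ()
  nonzero-tab-sound (suc n) g h (suc i) (s≤s i<n) e = nonzero-tab-sound n (g ∘ suc) (proj₂ (∧-split {(g 0 · g 0) == pos} h)) i i<n e

-- Euler's criterion: the residue of i^e is 0, 1 or q - 1.
module Euler (q e : ℕ) .{{_ : NonZero q}} where
  open Modular q

  classify : ℕ → Sign
  classify r = if r ≡ᵇ 1 then pos else (if suc r ≡ᵇ q then neg else zer)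

  euler-sign : ℕ → Sign
  euler-sign i = classify (i ^ e % q)

  classify-≈ : ∀ r → classify r ≢ zer → + r ≈ val (classify r)
  classify-≈ r h with r ≡ᵇ 1 in eq₁ | suc r ≡ᵇ q in eq₂
  ... | true  | _     = ≈-reflexive (cong +_ (≡ᵇ⇒≡ r 1 (subst Data.Bool.T (symm eq₁) tt)))
  ... | false | true  = by 1ℤ (trans (solve 1 (λ r → r := con -1ℤ :+ con 1ℤ :* (con 1ℤ :+ r)) refl (+ r)) (cong (λ k → -1ℤ +ᶻ 1ℤ *ᶻ + k) (≡ᵇ⇒≡ (suc r) q (subst Data.Bool.T (symm eq₂) tt))))
    where open ℤ-Solver.+-*-Solver
  ... | false | false = contradiction refl h

  pos-^ : ∀ i n → (+ i) ^ᶻ n ≡ + (i ^ n)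
  pos-^ i zero    = refl
  pos-^ i (suc n) = trans (cong (+ i *ᶻ_) (pos-^ i n)) (symm (ℤ.pos-* i (i ^ n)))

  character : q ≡ suc (e + e) → 0 < e → euler-sign 0 ≡ zer → nonzero-tab (e + e) (euler-sign ∘ suc) ≡ true → Character q e
  character odd e-pos at-0 checked = record
    { odd = odd ; e-pos = e-pos ; sign = euler-sign ; euler = euler ; sign-0 = at-0 ; sign-≢0 = sign-≢0 }
    where
      sign-≢0 : ∀ i → 0 < i → i < q → euler-sign i ≢ zer
      sign-≢0 (suc i) _ i<q = nonzero-tab-sound (e + e) (euler-sign ∘ suc) checked i (≤-pred (subst (suc i <_) odd i<q))
      power-zero : ∀ n → 0 < n → 0ℤ ^ᶻ n ≡ 0ℤ
      power-zero (suc n) _ = refl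
      euler : ∀ i → i < q → (+ i) ^ᶻ e ≈ val (euler-sign i)
      euler zero    _   = ≈-reflexive (trans (power-zero e e-pos) (symm (cong val at-0)))
      euler (suc i) i<q = ≈-trans (≈-reflexive (pos-^ (suc i) e)) (≈-trans (by (+ (suc i ^ e / q)) (trans (cong +_ (m≡m%n+[m/n]*n (suc i ^ e) q)) (cong (+ (suc i ^ e % q) +ᶻ_) (ℤ.pos-* (suc i ^ e / q) q))))
        (classify-≈ (suc i ^ e % q) (sign-≢0 (suc i) (s≤s z≤n) i<q)))

  module _ (ch : Character q e) where
    open Character ch

    sums : ∀ A → Σℤ q (λ i → χᶻ (+ i) *ᶻ χᶻ (+ i)) ≡ + (e + e) → Σℤ q (λ i → χᶻ (+ i) *ᶻ χᶻ (+ i -ᶻ 1ℤ)) ≡ -1ℤ →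
      windows A (suc q) (tab q (λ i → χ (+ i) · χ (+ i -ᶻ 1ℤ))) (tab (q + q) (χ ∘ +_)) ≡ true → KnownSums ch A
    sums A squares pairs checked = record
      { square-sum = trans (S-unfold _) squares
      ; pair-sum   = trans (S-unfold _) pairs
      ; cubic-sum  = λ l l<q → subst (λ z → ∣ z ∣ ≤ A)
          (symm (trans (S-unfold _) (Σℤ-cong q λ i _ → cong₂ _*ᶻ_ (symm (val-· (χ (+ i)) (χ (+ i -ᶻ 1ℤ)))) (χᶻ-cong (shift l<q i)))))
          -- χ(i - l) is entry q - l + i of the doubled table. The value l = 0 uses the window
          -- starting at q, which makes q + 1 windows.
          (windows-sound A (suc q) q (q + q) (λ i → χ (+ i) · χ (+ i -ᶻ 1ℤ)) (χ ∘ +_) checked (q ∸ l) (s≤s (m∸n≤m q l)) (+-monoˡ-≤ q (m∸n≤m q l)))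
      }
      where
        open ℤ-Solver.+-*-Solver
        shift : ∀ {l} → l < q → ∀ i → + i -ᶻ + l ≈ + (q ∸ l + i)
        shift {l} l<q i = by -1ℤ (symm (trans (cong (λ k → + (q ∸ l) +ᶻ + i +ᶻ -1ℤ *ᶻ + k) (symm (m∸n+n≡m (<⇒≤ l<q))))
          (solve 3 (λ d i l → d :+ i :+ con -1ℤ :* (d :+ l) := i :- l) refl (+ (q ∸ l)) (+ i) (+ l))))

private
  -- Reversal negates, so this fits characters with χ(-1) = -1, as for the primes 251 and 787, which
  -- are 3 modulo 4.
  tournament : Encoding 1 0 neg
  tournament = record
    { typ         = λ { neg → arcIn zero ; zer → none ; pos → arcOut zero }
    ; typ-zer     = refl
    ; typ-onto    = λ { (arcOut zero) _ → pos , (λ ()) , refl ; (arcIn zero) _ → neg , (λ ()) , refl }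
    ; present-pos = refl
    ; present-neg = refl
    ; pos≢neg     = λ ()
    ; flip-typ    = λ { neg → refl ; zer → refl ; pos → refl }
    }

  -- Reversal does nothing, so this fits characters with χ(-1) = 1, as for the primes 241 and 797,
  -- which are 1 modulo 4.
  two-edge-colours : Encoding 0 2 pos
  two-edge-colours = record
    { typ         = λ { neg → edge (suc zero) ; zer → none ; pos → edge zero }
    ; typ-zer     = refl
    ; typ-onto    = λ { (edge zero) _ → pos , (λ ()) , refl ; (edge (suc zero)) _ → neg , (λ ()) , refl }
    ; present-pos = refl
    ; present-neg = refl
    ; pos≢neg     = λ ()
    ; flip-typ    = λ { neg → refl ; zer → refl ; pos → refl }
    }

  character-251 : Character 251 125
  character-251 = Euler.character 251 125 refl (by-evaluation tt) refl refl

  -- For l other than 0 and 1 the Legendre curve has q + 1 + (cubic sum) points, a multiple of 4. So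
  -- the sum is divisible by 4 when q = 251, and 28 is the largest such value below 2√251. The same
  -- reasoning gives 56, 30 and 54 for the other three primes.
  sums-251 : KnownSums character-251 28
  sums-251 = Euler.sums 251 125 character-251 28 refl refl refl

  paley-251 : Receiver 1 0 4 502
  -- 8 and 4 are 2^(s - 1) and 2^(s - 2) for s = 4; 24 is the largest `n₀` that `cell-size` permits:
  -- 6 + 29 + 8 · 24 + 4 · 4 = 243 < 251.
  paley-251 = Paley.receiver sums-251 tournament 3 24 8 4 refl (by-evaluation tt) (by-evaluation tt) (by-evaluation tt) (by-evaluation tt)

  character-787 : Character 787 393
  character-787 = Euler.character 787 393 refl (by-evaluation tt) refl refl

  sums-787 : KnownSums character-787 56
  sums-787 = Euler.sums 787 393 character-787 56 refl refl refl

  paley-787 : Receiver 1 0 5 1574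
  paley-787 = Paley.receiver sums-787 tournament 4 28 16 8 refl (by-evaluation tt) (by-evaluation tt) (by-evaluation tt) (by-evaluation tt)

  character-241 : Character 241 120
  character-241 = Euler.character 241 120 refl (by-evaluation tt) refl refl

  sums-241 : KnownSums character-241 30
  sums-241 = Euler.sums 241 120 character-241 30 refl refl refl

  paley-241 : Receiver 0 2 4 482
  paley-241 = Paley.receiver sums-241 two-edge-colours 3 23 8 4 refl (by-evaluation tt) (by-evaluation tt) (by-evaluation tt) (by-evaluation tt)

  character-797 : Character 797 398
  character-797 = Euler.character 797 398 refl (by-evaluation tt) refl refl

  sums-797 : KnownSums character-797 54
  sums-797 = Euler.sums 797 398 character-797 54 refl refl refl

  paley-797 : Receiver 0 2 5 1594
  paley-797 = Paley.receiver sums-797 two-edge-colours 4 29 16 8 refl (by-evaluation tt) (by-evaluation tt) (by-evaluation tt) (by-evaluation tt)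

-- Assembling the targets and the theorem.

private
  two-types : ∀ m n → 2 ≡ Types m n → (m ≡ 1 × n ≡ 0) ⊎ (m ≡ 0 × n ≡ 2)
  two-types zero          (suc (suc zero)) _  = inj₂ (refl , refl)
  two-types (suc zero)    zero             _  = inj₁ (refl , refl)
  two-types (suc zero)    (suc n)          ()
  two-types (suc (suc m)) n                e  = contradiction (subst (4 ≤_) (symm e) four≤) λ { (s≤s (s≤s ())) }
    where
      four≤ : 4 ≤ Types (suc (suc m)) n
      four≤ = ≤-trans (*-monoʳ-≤ 2 (s≤s (s≤s (z≤n {m})))) (m≤m+n (2 * suc (suc m)) n)

  small-receiver : ∀ m n → 2 ≡ Types m n → ∀ s → s ≡ 4 ⊎ s ≡ 5 → Σ ℕ λ K → K ≤ 2 * s ^ 2 * 2 ^ s + 2 × Receiver m n s K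
  small-receiver m n p≡ s s≡ with two-types m n p≡ | s≡
  ... | inj₁ (refl , refl) | inj₁ refl = 502  , by-evaluation tt , paley-251
  ... | inj₁ (refl , refl) | inj₂ refl = 1574 , by-evaluation tt , paley-787
  ... | inj₂ (refl , refl) | inj₁ refl = 482  , by-evaluation tt , paley-241
  ... | inj₂ (refl , refl) | inj₂ refl = 1594 , by-evaluation tt , paley-797

  receiver-p=2 : ∀ m n → 2 ≡ Types m n → ∀ a → Σ ℕ λ K → K ≤ 2 * (4 + a) ^ 2 * 2 ^ (4 + a) + 2 × Receiver m n (4 + a) K
  receiver-p=2 m n p≡ 0 = small-receiver m n p≡ 4 (inj₁ refl)
  receiver-p=2 m n p≡ 1 = small-receiver m n p≡ 5 (inj₂ refl)
  receiver-p=2 m n p≡ 2 = 4610  , by-evaluation tt , receiver-p=2-s=6 m n p≡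
  receiver-p=2 m n p≡ 3 = 12546 , by-evaluation tt , receiver-p=2-s=7 m n p≡
  receiver-p=2 m n p≡ (suc (suc (suc (suc a)))) = _ , m≤m+n _ 2 , receiver-p=2-big m n a p≡

  receiver : ∀ m n p → p ≡ Types m n → 2 ≤ p → ∀ a → Σ ℕ λ K → K ≤ 2 * (4 + a) ^ p * p ^ (4 + a) + 2 × Receiver m n (4 + a) K
  receiver m n 1 _ (s≤s ()) _
  receiver m n 2 p≡ _ a = receiver-p=2 m n p≡ a
  receiver m n 3 p≡ _ a = _ , m≤m+n _ 2 , receiver-p=3 m n a p≡
  receiver m n p@(suc (suc (suc (suc _)))) p≡ _ a = subst (λ p → Σ ℕ λ K → K ≤ 2 * (4 + a) ^ p * p ^ (4 + a) + 2 × Receiver m n (4 + a) K) (symm p≡)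
    (_ , m≤m+n _ 2 , receiver-p≥4 m n a (subst (4 ≤_) p≡ (s≤s (s≤s (s≤s (s≤s z≤n))))))

theorem5 : (m n Δ : ℕ) → 2 ≤ 2 * m + n → 5 ≤ Δ →
    (Σ ℕ λ N → Σ (SimpleGraph N) λ G → MaxDegree G Δ ×
    Σ (MixedGraph m n N) λ G' → Underlies G G' ×
    ((K : ℕ) (H : MixedGraph m n K) → HasColHom G' H →
    (2 * m + n) ^ Δ ≤ K * K))
    ×
    ((N : ℕ) (G : SimpleGraph N) → MaxDegree G Δ →
    (G' : MixedGraph m n N) → Underlies G G' →
    χ≤ G' (2 * (Δ ∸ 1) ^ (2 * m + n) * (2 * m + n) ^ (Δ ∸ 1) + 2))
theorem5 m n (suc (suc (suc (suc (suc a))))) 2≤p 5≤Δ@(s≤s (s≤s (s≤s (s≤s (s≤s _))))) = lower-bound m n (5 + a) 2≤p 5≤Δ , upper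
  where
    upper : ∀ N (G : SimpleGraph N) → MaxDegree G (5 + a) → (G' : MixedGraph m n N) → Underlies G G' →
            χ≤ G' (2 * (4 + a) ^ (2 * m + n) * (2 * m + n) ^ (4 + a) + 2)
    upper N G (deg≤ , _) G' und with receiver m n (2 * m + n) refl 2≤p a
    ... | K , K≤ , H , T = K , K≤ , H , Greedy.hom G deg≤ G' und H T
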